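{- In the incremental model, there is an algorithm for the dynamic MAX-$k$ coverage problem that maintains a solution set with $(1-1/e-\epsilon)$-approximation at every time step and whose amortized running time is at most $O(\epsilon^{ -1}\log n)$.
   Context: MAX-$k$ coverage is given by a bipartite coverage graph $(V_L,V_R,E)$: nodes of $V_L$ ($|V_L|=n$) represent sets, nodes of $V_R$ represent ground elements, and $u\in V_L$, $v\in V_R$ are adjacent iff the set $u$ contains the element $v$. In the dynamic problem the coverage graph changes by one update per time step; $f_t(S)$, for $S\subseteq V_L$, is the number of nodes of $V_R$ that are neighbors of some node of $S$ at time $t$. At every time $t$ the algorithm must hold a set $S_t\subseteq V_L$ with $|S_t|\le k$; it is an $\alpha$-approximation at time $t$ if $f_t(S_t)\ge\alpha\cdot\max_{S\subseteq V_L,|S|\le k}f_t(S)$. In the incremental model the graph starts empty and the only updates are insertions of nodes and insertions of edges. The amortized running time is the average running time per update. An upper bound on the value of $n$ is assumed to be known to the algorithm. $\epsilon>0$ is the accuracy parameter. -}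

module Defs where

open import Data.Bool.Base using (if_then_else_)
open import Data.Fin.Base using (toℕ)
open import Data.Fin.Properties using (any?)
open import Data.Fin.Subset using (Subset; _∈_; ∣_∣; inside; outside)
open import Data.Fin.Subset.Properties using (_∈?_)
open import Data.Integer.Base using (+_) renaming (∣_∣ to abs)
open import Data.List.Base using (List; []; _∷_; _++_; length; map; filter; upTo; foldl)
open import Data.List.Extrema.Nat using (max)
open import Data.List.Membership.Propositional using () renaming (_∈_ to _∈ₗ_; _∉_ to _∉ₗ_)
import Data.List.Membership.DecPropositional as DecMembership
open import Data.List.Relation.Unary.All using (All)
open import Data.Nat.Base using (ℕ; zero; suc; _+_; _*_; _∸_; _^_; _≤_; _<_; _/_; _⊔_)
open import Data.Nat.Logarithm using (⌈log₂_⌉)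
open import Data.Nat.Properties using (_≟_; _≤?_; _<?_; m^n≢0)
open import Data.Product.Base using (_×_; _,_; ∃-syntax)
open import Data.Product.Properties using (≡-dec)
open import Data.Rational.Base as ℚ using (ℚ; Positive; 1ℚ; ↥_; ↧ₙ_)
open import Data.Rational.Properties using (pos⇒nonZero)
open import Data.Unit.Base using (⊤)
open import Data.Vec.Base as Vec using (tabulate)
open import Relation.Binary.PropositionalEquality using (_≡_; _≢_)
open import Relation.Nullary using (Dec; does)
open import Relation.Nullary.Decidable using (_×-dec_)

open DecMembership _≟_ using () renaming (_∈?_ to _∈ℕ?_)
open DecMembership (≡-dec _≟_ _≟_) using () renaming (_∈?_ to _∈E?_)

------------------------------------------------------------------------
-- Coverage graphs

-- V_L = {0, …, left - 1} and V_R = {0, …, right - 1}; nodes are numbered in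
-- order of insertion.
record Graph : Set where
  constructor graph
  field
    left right : ℕ
    edges      : List (ℕ × ℕ)
open Graph public

empty : Graph
empty = graph 0 0 []

Covered : (g : Graph) → Subset (left g) → ℕ → Set
Covered g S v = ∃[ u ] (u ∈ S × (toℕ u , v) ∈ₗ edges g)

covered? : ∀ g S v → Dec (Covered g S v)
covered? g S v = any? λ u → (u ∈? S) ×-dec ((toℕ u , v) ∈E? edges g)

coverage : (g : Graph) → Subset (left g) → ℕ
coverage g S = length (filter (covered? g S) (upTo (right g)))

subsets : ∀ n → List (Subset n)
subsets zero    = Vec.[] ∷ []
subsets (suc n) = map (outside Vec.∷_) (subsets n) ++ map (inside Vec.∷_) (subsets n)

opt : ℕ → Graph → ℕ
opt k g = max 0 (map (coverage g) (filter (λ S → ∣ S ∣ ≤? k) (subsets (left g))))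

------------------------------------------------------------------------
-- The incremental model

data Update : Set where
  newLeft newRight : Update
  newEdge          : (u v : ℕ) → Update

apply : Graph → Update → Graph
apply (graph l r E) newLeft       = graph (suc l) r E
apply (graph l r E) newRight      = graph l (suc r) E
apply (graph l r E) (newEdge u v) = graph l r ((u , v) ∷ E)

-- N is the known upper bound on the number of left nodes.
Allowed : ℕ → Graph → Update → Set
Allowed N g newLeft       = left g < N
Allowed N g newRight      = ⊤
Allowed N g (newEdge u v) = u < left g × v < right g × (u , v) ∉ₗ edges g

data Incremental (N : ℕ) (g : Graph) : List Update → Set where
  []  : Incremental N g []
  _∷_ : ∀ {u us} → Allowed N g u → Incremental N (apply g u) us →
        Incremental N g (u ∷ us)

------------------------------------------------------------------------
-- The machine model: programs of a unit-cost word RAM.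
--
-- Memory consists of arrays of words. A program mentions only finitely many
-- array names, so this is a RAM with the arrays interleaved; array a at
-- index 0 serves as a register.

Memory : Set
Memory = (array index : ℕ) → ℕ

_[_at_≔_] : Memory → ℕ → ℕ → ℕ → Memory
(m [ a at i ≔ x ]) b j =
  if does (a ≟ b) then (if does (i ≟ j) then x else m b j) else m b j

data Op : Set where
  add sub mul div lt eq : Op

⟦_⟧ : Op → ℕ → ℕ → ℕ
⟦ add ⟧ x y       = x + y
⟦ sub ⟧ x y       = x ∸ y
⟦ mul ⟧ x y       = x * y
⟦ div ⟧ x zero    = 0
⟦ div ⟧ x (suc y) = x / suc y
⟦ lt ⟧  x y       = if does (x <? y) then 1 else 0
⟦ eq ⟧  x y       = if does (x ≟ y) then 1 else 0

data Expr : Set where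
  lit  : ℕ → Expr
  read : (array : ℕ) → Expr → Expr
  op   : Op → Expr → Expr → Expr

eval : Memory → Expr → ℕ
eval m (lit n)     = n
eval m (read a i)  = m a (eval m i)
eval m (op o e e′) = ⟦ o ⟧ (eval m e) (eval m e′)

exprCost : Expr → ℕ
exprCost (lit n)     = 1
exprCost (read a i)  = 1 + exprCost i
exprCost (op o e e′) = 1 + exprCost e + exprCost e′

-- Every word arising in the evaluation, addresses included, is at most B.
Fits : ℕ → Memory → Expr → Set
Fits B m e@(lit n)      = eval m e ≤ B
Fits B m e@(read a i)   = eval m e ≤ B × Fits B m i
Fits B m e@(op o e₁ e₂) = eval m e ≤ B × Fits B m e₁ × Fits B m e₂

infixr 4 _⨾_

data Cmd : Set where
  skip  : Cmd
  write : (array : ℕ) (index value : Expr) → Cmd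
  _⨾_   : Cmd → Cmd → Cmd
  cond  : Expr → Cmd → Cmd → Cmd
  while : Expr → Cmd → Cmd

-- Run B c m m′ t: with words bounded by B, the command c started in memory m
-- halts in memory m′ after t unit-cost steps. A word exceeding B is an error:
-- no run exists.
data Run (B : ℕ) : Cmd → Memory → Memory → ℕ → Set where
  run-skip   : ∀ {m} → Run B skip m m 1
  run-write  : ∀ {m a i e} → Fits B m i → Fits B m e →
               Run B (write a i e) m (m [ a at eval m i ≔ eval m e ])
                 (1 + exprCost i + exprCost e)
  run-seq    : ∀ {m m₁ m₂ c d s t} → Run B c m m₁ s → Run B d m₁ m₂ t →
               Run B (c ⨾ d) m m₂ (s + t)
  run-then   : ∀ {m m′ b c d t} → Fits B m b → eval m b ≢ 0 → Run B c m m′ t →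
               Run B (cond b c d) m m′ (1 + exprCost b + t)
  run-else   : ∀ {m m′ b c d t} → Fits B m b → eval m b ≡ 0 → Run B d m m′ t →
               Run B (cond b c d) m m′ (1 + exprCost b + t)
  run-repeat : ∀ {m m₁ m₂ b c s t} → Fits B m b → eval m b ≢ 0 → Run B c m m₁ s →
               Run B (while b c) m₁ m₂ t →
               Run B (while b c) m m₂ (1 + exprCost b + s + t)
  run-exit   : ∀ {m b c} → Fits B m b → eval m b ≡ 0 →
               Run B (while b c) m m (1 + exprCost b)

-- Arrays 0 to 3 form the interface; all others are working storage.
params request answer pool : ℕ
params  = 0
request = 1
answer  = 2
pool    = 3

-- Memory before the first update: zero except for N, k and ε in lowest terms.
start : (N k : ℕ) → ℚ → Memory
start N k ε =
  (((λ _ _ → 0) [ params at 0 ≔ N ]) [ params at 1 ≔ k ])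
    [ params at 2 ≔ abs (↥ ε) ] [ params at 3 ≔ ↧ₙ ε ]

encode : Update → ℕ × ℕ × ℕ
encode newLeft       = 0 , 0 , 0
encode newRight      = 1 , 0 , 0
encode (newEdge u v) = 2 , u , v

receive : Update → Memory → Memory
receive r m with encode r
... | tag , u , v =
  ((m [ request at 0 ≔ tag ]) [ request at 1 ≔ u ]) [ request at 2 ≔ v ]

-- The solution held in memory is listed explicitly in a block of the pool,
-- whose length and offset are the words 0 and 1 of the answer array.
held : Memory → List ℕ
held m = map (λ i → m pool (m answer 1 + i)) (upTo (m answer 0))

fromList : ∀ n → List ℕ → Subset n
fromList n xs = tabulate λ u → does (toℕ u ∈ℕ? xs)

------------------------------------------------------------------------
-- The approximation guarantee

ℕ→ℚ : ℕ → ℚ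
ℕ→ℚ n = + n ℚ./ 1

-- "lim a ≤ x", for a convergent sequence a of rationals.
LimitAtMost : (ℕ → ℚ) → ℚ → Set
LimitAtMost a x =
  ∀ δ → .{{Positive δ}} → ∃[ M ] (∀ m → M ≤ m → a m ℚ.≤ x ℚ.+ δ)

-- (1 + 1/m)⁻ᵐ = (m / (m + 1))ᵐ, which tends to 1/e.
1/e≈ : ℕ → ℚ
1/e≈ m = ((+ (m ^ m)) ℚ./ (suc m ^ m)) {{m^n≢0 (suc m) m}}

-- x ≥ (1 - 1/e - ε) y
AtLeast[1-1/e-_] : ℚ → ℕ → ℕ → Set
AtLeast[1-1/e- ε ] x y =
  LimitAtMost (λ m → (1ℚ ℚ.- 1/e≈ m ℚ.- ε) ℚ.* ℕ→ℚ y) (ℕ→ℚ x)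

record Solution (k : ℕ) (ε : ℚ) (g : Graph) (m : Memory) : Set where
  S : Subset (left g)
  S = fromList (left g) (held m)
  field
    inV_L  : All (_< left g) (held m)
    size≤k : ∣ S ∣ ≤ k
    approx : AtLeast[1-1/e- ε ] (coverage g S) (opt k g)

------------------------------------------------------------------------
-- Dynamic algorithms

-- Serving the updates us one by one from graph g and memory m, running the
-- command c once per update, takes t steps in total, and memory holds a
-- solution before the first and after every update.
data Maintains (B k : ℕ) (ε : ℚ) (c : Cmd) (g : Graph) (m : Memory) :
               List Update → ℕ → Set where
  done : Solution k ε g m → Maintains B k ε c g m [] 0
  next : ∀ {u us m′ s t} → Solution k ε g m →
         Run B c (receive u m) m′ s →
         Maintains B k ε c (apply g u) m′ us t →
         Maintains B k ε c g m (u ∷ us) (s + t)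

-- Words have O(log (input size)) bits: they are bounded by a fixed power d of
-- the sum of the parameters and the number of updates.
wordBound : (d N k : ℕ) → ℚ → List Update → ℕ
wordBound d N k ε us = (N + k + abs (↥ ε) + ↧ₙ ε + length us) ^ d

-- ε⁻¹ log n, for the n = |V_L| reached by the updates. Both factors are
-- replaced by 1 where they are smaller: log n at n ≤ 1 and ε⁻¹ at ε > 1.
ε⁻¹log : (ε : ℚ) .{{_ : Positive ε}} → List Update → ℚ
ε⁻¹log ε us =
  (1ℚ ℚ.⊔ (ℚ.1/ ε) {{pos⇒nonZero ε}})
    ℚ.* ℕ→ℚ ⌈log₂ (2 ⊔ left (foldl apply empty us)) ⌉

{-# OPTIONS --safe #-}
module Submission where

-- The algorithm keeps a guess o of the optimum. For the guess it processes the edges one by one and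
-- picks a node u as soon as k · gain(u) ≥ o - f, where f counts the covered elements and gain(u) the
-- uncovered neighbours of u. Each pick closes a 1/k fraction of the distance from f to o, so after k
-- picks f ≥ (1 - (1 - 1/k)ᵏ) o ≥ (1 - 1/e) o; and while no node can be picked, k nodes cover fewer
-- than o elements. A complete guess becomes the answer, and the next guess exceeds (1 + ε) o by at
-- most 1, or is the largest degree if that is larger. A guess takes time linear in the number m of
-- edges: a node is checked only when f reaches a value at which its gain would suffice, and an edge
-- is removed once. Summing over guesses, the largest degree is at least m / n, so the guesses below
-- m / n cost a geometric series, O(m / ε); complete guesses are at most 2 m, so O(ε⁻¹ log n) more
-- guesses follow.

open import Defs
open import Data.Bool.Base using (Bool; true; false; if_then_else_; _∧_; _∨_; T)
open import Data.Bool.Properties using (∨-zeroʳ)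
open import Data.Fin.Base as Fin using (Fin; toℕ; fromℕ<)
open import Data.Fin.Properties using (toℕ-fromℕ<)
open import Data.Fin.Subset using (Subset; ∣_∣; inside; outside) renaming (_∈_ to _∈ₛ_)
import Data.Integer.Base as ℤ
import Data.Integer.Properties as ℤₚ
open import Data.List.Base using (List; []; _∷_; _++_; length; map; filter; foldl; upTo)
open import Data.List.Extrema.Nat using (max<v⁺)
import Data.List.Membership.DecPropositional as DecMembership
open import Data.List.Membership.Propositional using (_∈_; _∉_)
open import Data.List.Membership.Propositional.Properties using (∈-∃++; ∈-++⁻; ∈-++⁺ˡ; ∈-++⁺ʳ; ∈-map⁺; ∈-map⁻; ∈-upTo⁺; ∈-upTo⁻; ∈-filter⁺; ∈-filter⁻)
open import Data.List.Properties using (length-++; length-map; length-upTo)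
open import Data.List.Relation.Unary.All as All using (All; []; _∷_)
open import Data.List.Relation.Unary.All.Properties using (all-filter) renaming (map⁺ to All-map⁺)
open import Data.List.Relation.Unary.AllPairs using ([]; _∷_)
open import Data.List.Relation.Unary.Any using (here; there)
open import Data.List.Relation.Unary.Unique.Propositional using (Unique)
open import Data.List.Relation.Unary.Unique.Propositional.Properties using (filter⁺; upTo⁺) renaming (map⁺ to Unique-map⁺)
open import Data.Nat.Base
open import Data.Nat.DivMod using (m/n≤m; m/n*n≤m; m%n<n; m≡m%n+[m/n]*n)
open import Data.Nat.Induction using (<-rec)
open import Data.Nat.Logarithm using (⌈log₂_⌉; ⌈log₂⌉-mono-≤; ⌈log₂⌈n/2⌉⌉≡⌈log₂n⌉∸1; ⌈log₂2^n⌉≡n)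
open import Data.Nat.Properties
open import Data.Nat.Tactic.RingSolver using (solve-∀)
open import Data.Product.Base using (_×_; _,_; proj₁; proj₂; ∃-syntax)
open import Data.Rational.Base as ℚ using (ℚ; mkℚ; toℚᵘ; Positive; 0ℚ; 1ℚ; ↥_; ↧ₙ_)
import Data.Rational.Properties as ℚₚ
open import Data.Rational.Solver using (module +-*-Solver)
open import Data.Rational.Unnormalised.Base as ℚᵘ using (mkℚᵘ; *≡*; *≤*) renaming (_≃_ to _≃ᵘ_)
import Data.Rational.Unnormalised.Properties as ℚᵘₚ
open import Data.Sum.Base using (_⊎_; inj₁; inj₂; [_,_]′)
open import Data.Vec.Base as Vec using ()
open import Data.Vec.Properties using (lookup∘tabulate; lookup⇒[]=; []=⇒lookup)
open import Function.Base using (_∘_; case_of_)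
open import Relation.Binary.Definitions using (tri<; tri≈; tri>)
open import Relation.Binary.PropositionalEquality
open import Relation.Nullary using (contradiction; does; yes; no)
open import Relation.Nullary.Decidable using (True; toWitness; dec-true)

-- Keeping the old answer while a guess is incomplete is sound because, once nothing can be picked,
-- the guess exceeds the optimum: `opt + 1 ≤ o` holds for integers, and this unit absorbs the
-- rounding unit in the choice of the next guess. The same situation forces every degree below `o`,
-- so a guess raised to the largest degree is always completed before the program halts. The raise
-- is what makes the cost of a guess at most `n * o`, the source of the geometric series. The factor
-- 2 on complete guesses is `(1 - 1/k)ᵏ ≤ 1/2`. The constant `1/e` enters only through its
-- approximations: `(1 - 1/k)ᵏ ≤ (m / (m + 1))ᵐ` for `m ≥ k`, so no limit is evaluated. Clearing
-- tables between guesses would cost time, so every guess has addresses of its own. While a pick is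
-- being carried out, coverage and gains are out of step; the invariants therefore carry exemptions
-- for the nodes in `x` and `w`. Estimates are stated over ℕ with denominators cleared.

-- Pairing, point updates and counting in lists

pair : ℕ → ℕ → ℕ
pair x y = (x + y) * (x + y) + y

-- For `y ≤ s` the number `s * s + y` lies below the next square, so it determines `s`. This pairing
-- needs no division, and it is polynomial, which keeps addresses within a word.
pair-gap : ∀ {s t y z} → y ≤ s → s < t → s * s + y < t * t + z
pair-gap {s} {t} {y} {z} y≤s s<t = begin-strict
  s * s + y        ≤⟨ +-monoʳ-≤ (s * s) y≤s ⟩
  s * s + s        ≡⟨ +-comm (s * s) s ⟩
  suc s * s        <⟨ *-monoʳ-< (suc s) (n<1+n s) ⟩
  suc s * suc s    ≤⟨ *-mono-≤ s<t s<t ⟩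
  t * t            ≤⟨ m≤m+n (t * t) z ⟩
  t * t + z        ∎
  where open ≤-Reasoning

pair-injective : ∀ x y x′ y′ → pair x y ≡ pair x′ y′ → x ≡ x′ × y ≡ y′
pair-injective x y x′ y′ same with <-cmp (x + y) (x′ + y′)
... | tri< below _ _ = contradiction same (<⇒≢ (pair-gap (m≤n+m y x) below))
... | tri> _ _ gt = contradiction (sym same) (<⇒≢ (pair-gap (m≤n+m y′ x′) gt))
... | tri≈ _ s≡s′ _ = +-cancelʳ-≡ y x x′ (trans s≡s′ (cong (x′ +_) (sym y≡y′))) , y≡y′
  where
  y≡y′ : y ≡ y′
  y≡y′ = +-cancelˡ-≡ ((x + y) * (x + y)) y y′
           (trans same (cong (λ s → s * s + y′) (sym s≡s′)))

≡ᵇ-refl : ∀ n → (n ≡ᵇ n) ≡ true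
≡ᵇ-refl zero    = refl
≡ᵇ-refl (suc n) = ≡ᵇ-refl n

≢⇒≡ᵇ : ∀ {m n} → m ≢ n → (m ≡ᵇ n) ≡ false
≢⇒≡ᵇ {m} {n} m≢n with m ≡ᵇ n in same
... | true  = contradiction (≡ᵇ⇒≡ m n (subst T (sym same) _)) m≢n
... | false = refl

-- A write to a concrete array of a memory reduces to this function by computation, so invariants
-- about single arrays apply to the new memory as they stand.
upd : (ℕ → ℕ) → ℕ → ℕ → ℕ → ℕ
upd f i x j = if i ≡ᵇ j then x else f j

upd-same : ∀ f i x → upd f i x i ≡ x
upd-same f i x rewrite ≡ᵇ-refl i = refl

upd-other : ∀ f {i j} x → i ≢ j → upd f i x j ≡ f j
upd-other f x i≢j rewrite ≢⇒≡ᵇ i≢j = refl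

bit : Bool → ℕ
bit b = if b then 1 else 0

bit≤1 : ∀ b → bit b ≤ 1
bit≤1 true  = ≤-refl
bit≤1 false = z≤n

count : ∀ {A : Set} → (A → Bool) → List A → ℕ
count p []       = 0
count p (x ∷ xs) = bit (p x) + count p xs

count≤length : ∀ {A : Set} (p : A → Bool) xs → count p xs ≤ length xs
count≤length p []       = z≤n
count≤length p (x ∷ xs) = +-mono-≤ (bit≤1 (p x)) (count≤length p xs)

count≡0 : ∀ {A : Set} (p : A → Bool) xs → (∀ {x} → x ∈ xs → p x ≡ false) → count p xs ≡ 0
count≡0 p []       none = refl
count≡0 p (x ∷ xs) none rewrite none (here refl) = count≡0 p xs (none ∘ there)

count≤1 : ∀ {A : Set} (p : A → Bool) y xs → Unique xs →
          (∀ {x} → x ∈ xs → p x ≡ true → x ≡ y) → count p xs ≤ 1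
count≤1 p y []       []       only = z≤n
count≤1 p y (x ∷ xs) (x∉ ∷ u) only with p x in same
... | false = count≤1 p y xs u (only ∘ there)
... | true  = ≤-reflexive (cong suc (count≡0 p xs none))
  where
  none : ∀ {z} → z ∈ xs → p z ≡ false
  none {z} z∈ with p z in same′
  ... | false = refl
  ... | true  = contradiction (trans (only (here refl) same) (sym (only (there z∈) same′))) (All.lookup x∉ z∈)

select : ∀ {A : Set} → (A → Bool) → List A → List A
select p []       = []
select p (x ∷ xs) = if p x then x ∷ select p xs else select p xs

length-select : ∀ {A : Set} (p : A → Bool) xs → length (select p xs) ≡ count p xs
length-select p []       = refl
length-select p (x ∷ xs) with p x
... | true  = cong suc (length-select p xs)
... | false = length-select p xs

∈-select⁺ : ∀ {A : Set} (p : A → Bool) {x} xs → x ∈ xs → p x ≡ true → x ∈ select p xs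
∈-select⁺ p (x ∷ xs) (here refl) px rewrite px = here refl
∈-select⁺ p (x ∷ xs) (there x∈)  px with p x
... | true  = there (∈-select⁺ p xs x∈ px)
... | false = ∈-select⁺ p xs x∈ px

∈-select⁻ : ∀ {A : Set} (p : A → Bool) {x} xs → x ∈ select p xs → x ∈ xs × p x ≡ true
∈-select⁻ p (y ∷ ys) x∈ with p y in same
∈-select⁻ p (y ∷ ys) (here refl) | true  = here refl , same
∈-select⁻ p (y ∷ ys) (there x∈)  | true  =
  let x∈ys , px = ∈-select⁻ p ys x∈ in there x∈ys , px
∈-select⁻ p (y ∷ ys) x∈          | false =
  let x∈ys , px = ∈-select⁻ p ys x∈ in there x∈ys , px

unique-select : ∀ {A : Set} (p : A → Bool) {xs} → Unique xs → Unique (select p xs)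
unique-select p {[]}     []      = []
unique-select p {x ∷ xs} (a ∷ u) with p x
... | true  = All.tabulate (λ y∈ → All.lookup a (proj₁ (∈-select⁻ p xs y∈))) ∷ unique-select p u
... | false = unique-select p u

-- Pigeonhole: removing the head of `xs` from `ys` leaves a list that still contains the tail, as
-- `xs` repeats nothing. The comparisons of coverages, degrees and set sizes below all rest on this.
unique-⊆⇒length≤ : ∀ {A : Set} {xs ys : List A} → Unique xs → (∀ {x} → x ∈ xs → x ∈ ys) →
                   length xs ≤ length ys
unique-⊆⇒length≤ [] _ = z≤n
unique-⊆⇒length≤ {xs = x ∷ xs} (x∉ ∷ u) incl with ∈-∃++ (incl (here refl))
... | as , bs , refl = begin
  suc (length xs)              ≤⟨ s≤s (unique-⊆⇒length≤ u incl′) ⟩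
  suc (length (as ++ bs))      ≡⟨ cong suc (length-++ as) ⟩
  suc (length as + length bs)  ≡⟨ +-suc (length as) (length bs) ⟨
  length as + suc (length bs)  ≡⟨ length-++ as ⟨
  length (as ++ x ∷ bs)        ∎
  where
  open ≤-Reasoning
  incl′ : ∀ {y} → y ∈ xs → y ∈ as ++ bs
  incl′ y∈ with ∈-++⁻ as (incl (there y∈))
  ... | inj₁ y∈as         = ∈-++⁺ˡ y∈as
  ... | inj₂ (here refl)  = contradiction refl (All.lookup x∉ y∈)
  ... | inj₂ (there y∈bs) = ∈-++⁺ʳ as y∈bs

-- Membership as the word 0 or 1 that the array of covered nodes stores.
mem : ℕ → List ℕ → ℕ
mem v []      = 0
mem v (c ∷ C) = if c ≡ᵇ v then 1 else mem v C

mem≢0⇒∈ : ∀ v C → mem v C ≢ 0 → v ∈ C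
mem≢0⇒∈ v []      ≢0 = contradiction refl ≢0
mem≢0⇒∈ v (c ∷ C) ≢0 with c ≡ᵇ v in same
... | true  = here (sym (≡ᵇ⇒≡ c v (subst T (sym same) _)))
... | false = there (mem≢0⇒∈ v C ≢0)

mem≡0⇒∉ : ∀ v C → mem v C ≡ 0 → v ∉ C
mem≡0⇒∉ v (c ∷ C) ≡0 (here refl) rewrite ≡ᵇ-refl c = case ≡0 of λ ()
mem≡0⇒∉ v (c ∷ C) ≡0 (there v∈) with c ≡ᵇ v
... | false = mem≡0⇒∉ v C ≡0 v∈
... | true  = case ≡0 of λ ()

-- Families of stacks

-- One list of (key, value) pairs represents a whole family of stacks: the values with key `k`, in
-- order, form stack `k`, top first, and `del` removes just its top.
sel : ℕ → List (ℕ × ℕ) → List ℕ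
sel k []             = []
sel k ((a , b) ∷ xs) = if a ≡ᵇ k then b ∷ sel k xs else sel k xs

del : ℕ → List (ℕ × ℕ) → List (ℕ × ℕ)
del k []             = []
del k ((a , b) ∷ xs) = if a ≡ᵇ k then xs else (a , b) ∷ del k xs

≡ᵇ-true : ∀ {m n} → (m ≡ᵇ n) ≡ true → m ≡ n
≡ᵇ-true {m} {n} same = ≡ᵇ⇒≡ m n (subst T (sym same) _)

sel-del-same : ∀ k xs {y ys} → sel k xs ≡ y ∷ ys → sel k (del k xs) ≡ ys
sel-del-same k ((a , b) ∷ xs) same with a ≡ᵇ k in e
... | true  = case same of λ { refl → refl }
... | false rewrite e = sel-del-same k xs same

sel-del-other : ∀ {j k} xs → j ≢ k → sel j (del k xs) ≡ sel j xs
sel-del-other         []             j≢k = refl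
sel-del-other {j} {k} ((a , b) ∷ xs) j≢k with a ≡ᵇ k in e
... | true  rewrite ≡ᵇ-true {a} {k} e | ≢⇒≡ᵇ (j≢k ∘ sym) = refl
... | false with a ≡ᵇ j
...   | true  = cong (b ∷_) (sel-del-other xs j≢k)
...   | false = sel-del-other xs j≢k

sel-∈ : ∀ k xs {y ys} → sel k xs ≡ y ∷ ys → (k , y) ∈ xs
sel-∈ k ((a , b) ∷ xs) same with a ≡ᵇ k in e
... | true  = here (case same of λ { refl → cong (_, b) (sym (≡ᵇ-true {a} {k} e)) })
... | false = there (sel-∈ k xs same)

sel≡[]⇒∉ : ∀ k xs {y} → sel k xs ≡ [] → (k , y) ∉ xs
sel≡[]⇒∉ k ((a , b) ∷ xs) same (here refl) rewrite ≡ᵇ-refl a = case same of λ ()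
sel≡[]⇒∉ k ((a , b) ∷ xs) same (there p) with a ≡ᵇ k
... | false = sel≡[]⇒∉ k xs same p
... | true  = case same of λ ()

del-⊆ : ∀ k xs {e} → e ∈ del k xs → e ∈ xs
del-⊆ k ((a , b) ∷ xs) p with a ≡ᵇ k
del-⊆ k ((a , b) ∷ xs) p         | true  = there p
del-⊆ k ((a , b) ∷ xs) (here e)  | false = here e
del-⊆ k ((a , b) ∷ xs) (there p) | false = there (del-⊆ k xs p)

del-split : ∀ k xs {y ys e} → sel k xs ≡ y ∷ ys → e ∈ xs → e ≡ (k , y) ⊎ e ∈ del k xs
del-split k ((a , b) ∷ xs) same p with a ≡ᵇ k in e
del-split k ((a , b) ∷ xs) refl (here refl) | true  = inj₁ (cong (_, b) (≡ᵇ-true {a} {k} e))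
del-split k ((a , b) ∷ xs) refl (there p)   | true  = inj₂ p
del-split k ((a , b) ∷ xs) same   (here refl) | false = inj₂ (here refl)
del-split k ((a , b) ∷ xs) same   (there p)   | false with del-split k xs same p
... | inj₁ q = inj₁ q
... | inj₂ q = inj₂ (there q)

count-del : ∀ p k xs {y ys} → sel k xs ≡ y ∷ ys →
            count p xs ≡ bit (p (k , y)) + count p (del k xs)
count-del p k ((a , b) ∷ xs) {y} same with a ≡ᵇ k in e
... | true  = case same of λ { refl →
                cong (λ z → bit (p (z , b)) + count p xs) (≡ᵇ-true {a} {k} e) }
... | false = trans (cong (bit (p (a , b)) +_) (count-del p k xs same))
                (swap (bit (p (a , b))) (bit (p (k , y))) _)
  where
  swap : ∀ x y z → x + (y + z) ≡ y + (x + z)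
  swap = solve-∀

length-del : ∀ k xs {y ys} → sel k xs ≡ y ∷ ys → length xs ≡ suc (length (del k xs))
length-del k ((a , b) ∷ xs) same with a ≡ᵇ k
... | true  = refl
... | false = cong suc (length-del k xs same)

unique-del : ∀ k {xs} → Unique xs → Unique (del k xs)
unique-del k {[]}           u       = u
unique-del k {(a , b) ∷ xs} (n ∷ u) with a ≡ᵇ k
... | true  = u
... | false = All.tabulate (λ e∈ → All.lookup n (del-⊆ k xs e∈)) ∷ unique-del k u

length-sel : ∀ k xs → length (sel k xs) ≤ length xs
length-sel k []             = z≤n
length-sel k ((a , b) ∷ xs) with a ≡ᵇ k
... | true  = s≤s (length-sel k xs)
... | false = m≤n⇒m≤1+n (length-sel k xs)

items : (ℕ → ℕ) → ℕ → ℕ → List ℕ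
items f key zero    = []
items f key (suc j) = f (pair key j) ∷ items f key j

items-cong : ∀ f f′ key n → (∀ j → j < n → f (pair key j) ≡ f′ (pair key j)) →
             items f key n ≡ items f′ key n
items-cong f f′ key zero    same = refl
items-cong f f′ key (suc n) same =
  cong₂ _∷_ (same n ≤-refl) (items-cong f f′ key n (λ j j<n → same j (m<n⇒m<1+n j<n)))

length-items : ∀ f key n → length (items f key n) ≡ n
length-items f key zero    = refl
length-items f key (suc n) = cong suc (length-items f key n)

-- Nested pairing gives each entry of each stack of each guess a cell of its own: `g` and `x` make
-- the key, the key and the height make the cell.
Stacks : (cnt item : ℕ → ℕ) → ℕ → List (ℕ × ℕ) → Set
Stacks cnt item g xs = ∀ x → items item (pair g x) (cnt (pair g x)) ≡ sel x xs

pair-≢ʳ : ∀ g {x y} → x ≢ y → pair g x ≢ pair g y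
pair-≢ʳ g {x} {y} x≢y same = x≢y (proj₂ (pair-injective g x g y same))

pair-≢ˡ : ∀ {g h} x y → g ≢ h → pair g x ≢ pair h y
pair-≢ˡ {g} {h} x y g≢h same = g≢h (proj₁ (pair-injective g x h y same))

-- The cell written differs from all occupied ones: by its height within the same stack, by its key
-- from those of the others.
Stacks-push : ∀ cnt item g xs x y {key} → pair g x ≡ key → Stacks cnt item g xs →
  Stacks (upd cnt key (suc (cnt key))) (upd item (pair key (cnt key)) y) g ((x , y) ∷ xs)
Stacks-push cnt item g xs x y refl st z with x ≟ z
... | yes refl rewrite ≡ᵇ-refl x | upd-same cnt (pair g x) (suc (cnt (pair g x))) =
  cong₂ _∷_ (upd-same item _ y)
    (trans (items-cong _ item _ _
             (λ j j<n → upd-other item y (pair-≢ʳ (pair g x) (>⇒≢ j<n))))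
           (st x))
... | no x≢z rewrite ≢⇒≡ᵇ x≢z | upd-other cnt (suc (cnt (pair g x))) (pair-≢ʳ g x≢z) =
  trans (items-cong _ item _ _
          (λ j _ → upd-other item y (pair-≢ˡ _ j (pair-≢ʳ g x≢z))))
        (st z)

Stacks-top : ∀ cnt item g xs x {key c y} → Stacks cnt item g xs → pair g x ≡ key → cnt key ≢ 0 →
  cnt key ∸ 1 ≡ c → item (pair key c) ≡ y → ∃[ ys ] sel x xs ≡ y ∷ ys
Stacks-top cnt item g xs x st refl ≢0 refl refl with cnt (pair g x) | st x
... | zero  | _  = contradiction refl ≢0
... | suc c | same = _ , sym same

Stacks-pop : ∀ cnt item g xs x {key c} → Stacks cnt item g xs → pair g x ≡ key → cnt key ≢ 0 →
  cnt key ∸ 1 ≡ c → Stacks (upd cnt key c) item g (del x xs)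
Stacks-pop cnt item g xs x st refl ≢0 refl z with x ≟ z
... | no x≢z rewrite upd-other cnt (cnt (pair g x) ∸ 1) (pair-≢ʳ g x≢z) =
  trans (st z) (sym (sel-del-other xs (x≢z ∘ sym)))
... | yes refl rewrite upd-same cnt (pair g x) (cnt (pair g x) ∸ 1)
  with cnt (pair g x) | st x
...   | zero  | _  = contradiction refl ≢0
...   | suc c | same = sym (sel-del-same x xs (sym same))

Stacks-empty : ∀ cnt item g xs x → Stacks cnt item g xs → cnt (pair g x) ≡ 0 → sel x xs ≡ []
Stacks-empty cnt item g xs x st ≡0 = trans (sym (st x)) (cong (items item (pair g x)) ≡0)

Stacks-size : ∀ cnt item g xs x → Stacks cnt item g xs → cnt (pair g x) ≤ length xs
Stacks-size cnt item g xs x st = begin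
  cnt (pair g x)                                       ≡⟨ length-items item (pair g x) _ ⟨
  length (items item (pair g x) (cnt (pair g x)))      ≡⟨ cong length (st x) ⟩
  length (sel x xs)                                    ≤⟨ length-sel x xs ⟩
  length xs                                            ∎
  where open ≤-Reasoning

Stacks-zero : ∀ cnt item g → (∀ x → cnt (pair g x) ≡ 0) → Stacks cnt item g []
Stacks-zero cnt item g z x = cong (items item (pair g x)) (z x)

-- Nothing is stored under the numbers of later guesses, so raising `g` by one empties every table
-- in constant time.
Fresh : (ℕ → ℕ) → ℕ → Set
Fresh f g = ∀ h x → g < h → f (pair h x) ≡ 0

Fresh-upd : ∀ f g x {key} y → pair g x ≡ key → Fresh f g → Fresh (upd f key y) g
Fresh-upd f g x y refl fr h z g<h = trans (upd-other f y (pair-≢ˡ x z (<⇒≢ g<h))) (fr h z g<h)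

Fresh-suc : ∀ f g → Fresh f g → Fresh f (suc g)
Fresh-suc f g fr h x below = fr h x (<-trans (n<1+n g) below)

-- The greedy process for one guess

-- For the current guess o of the optimum, P lists the edges processed so far, C the f covered nodes
-- and S the s picked nodes. R holds (v , u) for each live edge, one that still counts towards the
-- gain of u; L holds (u , v) for the edges at u to be scanned when u is picked; A holds (i , u) as a
-- reminder to check u once f reaches i, and q ≤ f is the index up to which reminders are served.
-- A node x - 1 is being picked if x ≠ 0; the edges at a node w - 1 are being removed if w ≠ 0.

pre : (ℕ → ℕ × ℕ) → ℕ → List (ℕ × ℕ)
pre ed zero    = []
pre ed (suc j) = ed j ∷ pre ed j

gain : ℕ → List (ℕ × ℕ) → ℕ
gain x R = count (λ e → suc (proj₂ e) ≡ᵇ x) R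

-- A live edge between the node being covered and the node being picked is counted in `f` and in the
-- gain at once; this is the correction.
both : ℕ → ℕ → List (ℕ × ℕ) → ℕ
both w x R = count (λ e → (suc (proj₁ e) ≡ᵇ w) ∧ (suc (proj₂ e) ≡ᵇ x)) R

-- The larger of `q` and `o - k * d`, in the operations of the machine. A gain `d` suffices once `f`
-- reaches `o - k * d`; an alarm already due goes to `q`, the index being served.
alarmAt : (q o k d : ℕ) → ℕ
alarmAt q o k d = q + ((o ∸ k * d) ∸ q)

-- This is `F ≥ (1 - (1 - 1/k)ˢ) o` without denominators and subtraction.
Greedy : (k o s F : ℕ) → Set
Greedy k o s F = k ^ s * o ≤ k ^ s * F + (k ∸ 1) ^ s * o

-- When `w - 1` has just been covered its edges still sit in `R`; `R∉C` excuses exactly these.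
-- `R⊆CL` guarantees that scanning `L` at a picked node meets all its live edges.
record Live (P : List (ℕ × ℕ)) (C : List ℕ) (L R : List (ℕ × ℕ)) (w : ℕ) : Set where
  field
    uniqC : Unique C
    uniqR : Unique R
    R⊆P   : ∀ {v u} → (v , u) ∈ R → (u , v) ∈ P
    L⊆P   : ∀ {e} → e ∈ L → e ∈ P
    R∉C   : ∀ {v u} → (v , u) ∈ R → v ∉ C ⊎ suc v ≡ w
    P⊆CR  : ∀ {v u} → (u , v) ∈ P → v ∈ C ⊎ (v , u) ∈ R
    R⊆CL  : ∀ {v u} → (v , u) ∈ R → v ∈ C ⊎ (u , v) ∈ L
    w∈C   : ∀ {v} → w ≡ suc v → v ∈ C

module _ {P : List (ℕ × ℕ)} {C : List ℕ} {L R : List (ℕ × ℕ)} where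
  open import Data.List.Membership.DecPropositional _≟_ using (_∈?_)

  -- The dropped edge ends at `v`, which is covered by `w∈C`, so `P⊆CR` survives the loss.
  Live-popR : ∀ {v u us} → Live P C L R (suc v) → sel v R ≡ u ∷ us → Live P C L (del v R) (suc v)
  Live-popR {v} lv top = record
    { uniqC = uniqC ; uniqR = unique-del v uniqR
    ; R⊆P = R⊆P ∘ del-⊆ v R ; L⊆P = L⊆P ; R∉C = R∉C ∘ del-⊆ v R
    ; P⊆CR = kept ; R⊆CL = R⊆CL ∘ del-⊆ v R ; w∈C = w∈C }
    where
    open Live lv
    kept : ∀ {v′ u′} → (u′ , v′) ∈ P → v′ ∈ C ⊎ (v′ , u′) ∈ del v R
    kept e with P⊆CR e
    ... | inj₁ c = inj₁ c
    ... | inj₂ r with del-split v R top r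
    ...   | inj₁ refl = inj₁ (w∈C refl)
    ...   | inj₂ d    = inj₂ d

  Live-endR : ∀ {v} → Live P C L R (suc v) → sel v R ≡ [] → Live P C L R 0
  Live-endR {v} lv none = record
    { uniqC = uniqC ; uniqR = uniqR ; R⊆P = R⊆P ; L⊆P = L⊆P ; R∉C = out
    ; P⊆CR = P⊆CR ; R⊆CL = R⊆CL ; w∈C = λ () }
    where
    open Live lv
    out : ∀ {v′ u′} → (v′ , u′) ∈ R → v′ ∉ C ⊎ suc v′ ≡ 0
    out r with R∉C r
    ... | inj₁ ∉C   = inj₁ ∉C
    ... | inj₂ refl = contradiction r (sel≡[]⇒∉ v R none)

  Live-popL : ∀ {u v vs} → Live P C L R 0 → sel u L ≡ v ∷ vs → v ∈ C → Live P C (del u L) R 0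
  Live-popL {u} lv top v∈C = record
    { uniqC = uniqC ; uniqR = uniqR ; R⊆P = R⊆P ; L⊆P = L⊆P ∘ del-⊆ u L ; R∉C = R∉C
    ; P⊆CR = P⊆CR ; R⊆CL = kept ; w∈C = w∈C }
    where
    open Live lv
    kept : ∀ {v′ u′} → (v′ , u′) ∈ R → v′ ∈ C ⊎ (u′ , v′) ∈ del u L
    kept r with R⊆CL r
    ... | inj₁ c = inj₁ c
    ... | inj₂ l with del-split u L top l
    ...   | inj₁ refl = inj₁ v∈C
    ...   | inj₂ d    = inj₂ d

  Live-cover : ∀ {u v vs} → Live P C L R 0 → sel u L ≡ v ∷ vs → v ∉ C →
               Live P (v ∷ C) (del u L) R (suc v)
  Live-cover {u} {v} lv top v∉C = record
    { uniqC = All.tabulate (λ {y} y∈ v≡y → v∉C (subst (_∈ C) (sym v≡y) y∈)) ∷ uniqC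
    ; uniqR = uniqR ; R⊆P = R⊆P ; L⊆P = L⊆P ∘ del-⊆ u L ; R∉C = out
    ; P⊆CR = λ e → [ inj₁ ∘ there , inj₂ ]′ (P⊆CR e) ; R⊆CL = kept
    ; w∈C = λ { refl → here refl } }
    where
    open Live lv
    out : ∀ {v′ u′} → (v′ , u′) ∈ R → v′ ∉ v ∷ C ⊎ suc v′ ≡ suc v
    out {v′} r with v′ ≟ v | R∉C r
    ... | yes refl | _       = inj₂ refl
    ... | no v′≢v  | inj₁ ∉C = inj₁ λ { (here same) → v′≢v same ; (there c) → ∉C c }
    kept : ∀ {v′ u′} → (v′ , u′) ∈ R → v′ ∈ v ∷ C ⊎ (u′ , v′) ∈ del u L
    kept r with R⊆CL r
    ... | inj₁ c = inj₁ (there c)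
    ... | inj₂ l with del-split u L top l
    ...   | inj₁ refl = inj₁ (here refl)
    ...   | inj₂ d    = inj₂ d

  Live-skip : ∀ {u v} → Live P C L R 0 → v ∈ C → Live ((u , v) ∷ P) C L R 0
  Live-skip lv v∈C = record
    { uniqC = uniqC ; uniqR = uniqR ; R⊆P = there ∘ R⊆P ; L⊆P = there ∘ L⊆P ; R∉C = R∉C
    ; P⊆CR = λ { (here refl) → inj₁ v∈C ; (there e) → P⊆CR e } ; R⊆CL = R⊆CL ; w∈C = w∈C }
    where open Live lv

  Live-add : ∀ {u v} → Live P C L R 0 → v ∉ C → (u , v) ∉ P →
             Live ((u , v) ∷ P) C ((u , v) ∷ L) ((v , u) ∷ R) 0
  Live-add {u} {v} lv v∉C new = record
    { uniqC = uniqC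
    ; uniqR = All.tabulate (λ r same → new (R⊆P (subst (_∈ R) (sym same) r))) ∷ uniqR
    ; R⊆P = λ { (here refl) → here refl ; (there r) → there (R⊆P r) }
    ; L⊆P = λ { (here refl) → here refl ; (there l) → there (L⊆P l) }
    ; R∉C = λ { (here refl) → inj₁ v∉C ; (there r) → R∉C r }
    ; P⊆CR = λ { (here refl) → inj₂ (here refl) ; (there e) → [ inj₁ , inj₂ ∘ there ]′ (P⊆CR e) }
    ; R⊆CL = λ { (here refl) → inj₂ (here refl) ; (there r) → [ inj₁ , inj₂ ∘ there ]′ (R⊆CL r) }
    ; w∈C = w∈C }
    where open Live lv

Live-new : Live [] [] [] [] 0
Live-new = record
  { uniqC = [] ; uniqR = [] ; R⊆P = λ () ; L⊆P = λ () ; R∉C = λ () ; P⊆CR = λ ()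
  ; R⊆CL = λ () ; w∈C = λ () }

alarmAt-early : ∀ q o k d → o ∸ k * d ≤ q → alarmAt q o k d ≡ q
alarmAt-early q o k d le = trans (cong (q +_) (m≤n⇒m∸n≡0 le)) (+-identityʳ q)

alarmAt-late : ∀ q o k d → q ≤ o ∸ k * d → alarmAt q o k d ≡ o ∸ k * d
alarmAt-late q o k d le = m+[n∸m]≡n le

quiet⇒late : ∀ o k d f → k * d + f < o → f < o ∸ k * d
quiet⇒late o k d f below = m+n≤o⇒m≤o∸n (suc f) (≤-trans (≤-reflexive (cong suc (+-comm f (k * d)))) below)

late⇒quiet : ∀ o k d f → f < o ∸ k * d → k * d + f < o
late⇒quiet o k d f below =
  ≤-trans (≤-reflexive (cong suc (+-comm (k * d) f))) (m<n∸o⇒m+o<n o below)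
  where
  m<n∸o⇒m+o<n : ∀ n → f < n ∸ k * d → f + k * d < n
  m<n∸o⇒m+o<n n below′ with k * d ≤? n
  ... | yes le = ≤-trans (+-monoˡ-≤ (k * d) below′) (≤-reflexive (m∸n+n≡m le))
  ... | no  nle = contradiction (subst (f <_) (m≤n⇒m∸n≡0 (<⇒≤ (≰⇒> nle))) below′) λ ()

-- A node with live edges rings once the coverage has grown enough for it to be picked; the node
-- being picked is exempt.
record Alarms (k o q x : ℕ) (P R A : List (ℕ × ℕ)) : Set where
  field
    set : ∀ {v u} → (v , u) ∈ R → suc u ≡ x ⊎ (alarmAt q o k (gain (suc u) R) , u) ∈ A
    A⊆P : ∀ {i u} → (i , u) ∈ A → ∃[ v ] (u , v) ∈ P

gain-del : ∀ x v R {u us} → sel v R ≡ u ∷ us → gain x R ≡ bit (suc u ≡ᵇ x) + gain x (del v R)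
gain-del x v R top = count-del _ v R top

gain-del-other : ∀ {u u′} v R {us} → sel v R ≡ u ∷ us → u ≢ u′ →
                 gain (suc u′) R ≡ gain (suc u′) (del v R)
gain-del-other {u} {u′} v R top u≢u′ =
  trans (gain-del (suc u′) v R top) (cong (λ b → bit b + gain (suc u′) (del v R)) (≢⇒≡ᵇ u≢u′))

gain-del-same : ∀ u v R {us} → sel v R ≡ u ∷ us → gain (suc u) R ≡ suc (gain (suc u) (del v R))
gain-del-same u v R top =
  trans (gain-del (suc u) v R top) (cong (λ b → bit b + gain (suc u) (del v R)) (≡ᵇ-refl u))

module _ {k o q x : ℕ} {P R A : List (ℕ × ℕ)} where

  -- Only the gain of `u` has changed, so only `u` needs a new reminder. Its old one stays in `A`;
  -- it is judged by the current gain when its index is served.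
  Alarms-popR : ∀ {v u us d e} → Alarms k o q x P R A → sel v R ≡ u ∷ us →
    d ≡ gain (suc u) (del v R) → (u , e) ∈ P →
    Alarms k o q x P (del v R) ((alarmAt q o k d , u) ∷ A)
  Alarms-popR {v} {u} al top refl uP = record
    { set = ring ; A⊆P = λ { (here refl) → _ , uP ; (there a) → A⊆P a } }
    where
    open Alarms al
    ring : ∀ {v′ u′} → (v′ , u′) ∈ del v R → suc u′ ≡ x ⊎
           (alarmAt q o k (gain (suc u′) (del v R)) , u′) ∈ (alarmAt q o k (gain (suc u) (del v R)) , u) ∷ A
    ring {v′} {u′} r with u ≟ u′
    ... | yes refl = inj₂ (here refl)
    ... | no u≢u′ with set (del-⊆ v R r)
    ...   | inj₁ same = inj₁ same
    ...   | inj₂ a  = inj₂ (there (subst (λ g → (alarmAt q o k g , u′) ∈ A) (gain-del-other v R top u≢u′) a))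

  Alarms-endL : ∀ {u} → Alarms k o q (suc u) P R A → (∀ {v} → (v , u) ∉ R) → Alarms k o q 0 P R A
  Alarms-endL {u} al none = record { set = ring ; A⊆P = A⊆P }
    where
    open Alarms al
    ring : ∀ {v′ u′} → (v′ , u′) ∈ R → suc u′ ≡ 0 ⊎ (alarmAt q o k (gain (suc u′) R) , u′) ∈ A
    ring r with set r
    ... | inj₁ refl = contradiction r none
    ... | inj₂ a    = inj₂ a

  -- The popped reminder cannot be the one that `set` demands: `u` is still too weak at `f ≥ q`, so
  -- the demanded index exceeds `q`.
  Alarms-ignore : ∀ {u us f} → Alarms k o q x P R A → sel q A ≡ u ∷ us → q ≤ f →
    k * gain (suc u) R + f < o → Alarms k o q x P R (del q A)
  Alarms-ignore {u} {us} {f} al top q≤f quiet = record { set = ring ; A⊆P = A⊆P ∘ del-⊆ q A }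
    where
    open Alarms al
    ring : ∀ {v′ u′} → (v′ , u′) ∈ R → suc u′ ≡ x ⊎ (alarmAt q o k (gain (suc u′) R) , u′) ∈ del q A
    ring {v′} {u′} r with set r
    ... | inj₁ same = inj₁ same
    ... | inj₂ a with del-split q A top a
    ...   | inj₂ d  = inj₂ d
    ...   | inj₁ same with cong proj₂ same
    ...     | refl = contradiction
                (trans (sym (alarmAt-late q o k (gain (suc u) R) (<⇒≤ late))) (cong proj₁ same)) (>⇒≢ late)
      where
      late : q < o ∸ k * gain (suc u) R
      late = ≤-<-trans q≤f (quiet⇒late o k _ f quiet)

  Alarms-pick : ∀ {u us} → Alarms k o q 0 P R A → sel q A ≡ u ∷ us →
    Alarms k o q (suc u) P R (del q A)
  Alarms-pick {u} al top = record { set = ring ; A⊆P = A⊆P ∘ del-⊆ q A }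
    where
    open Alarms al
    ring : ∀ {v′ u′} → (v′ , u′) ∈ R → suc u′ ≡ suc u ⊎ (alarmAt q o k (gain (suc u′) R) , u′) ∈ del q A
    ring r with set r
    ... | inj₂ a with del-split q A top a
    ...   | inj₂ d  = inj₂ d
    ...   | inj₁ same = inj₁ (cong (suc ∘ proj₂) same)

  -- With stack `q` empty every demanded index exceeds `q`, and such an index does not change when
  -- `q` becomes `suc q`.
  Alarms-advance : Alarms k o q x P R A → sel q A ≡ [] → Alarms k o (suc q) x P R A
  Alarms-advance al none = record { set = ring ; A⊆P = A⊆P }
    where
    open Alarms al
    ring : ∀ {v′ u′} → (v′ , u′) ∈ R → suc u′ ≡ x ⊎ (alarmAt (suc q) o k (gain (suc u′) R) , u′) ∈ A
    ring {v′} {u′} r with set r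
    ... | inj₁ same = inj₁ same
    ... | inj₂ a with o ∸ k * gain (suc u′) R ≤? q
    ...   | yes le = contradiction (subst (λ i → (i , u′) ∈ A) (alarmAt-early q o k _ le) a) (sel≡[]⇒∉ q A none)
    ...   | no nle = inj₂ (subst (λ i → (i , u′) ∈ A)
              (trans (alarmAt-late q o k _ (<⇒≤ (≰⇒> nle))) (sym (alarmAt-late (suc q) o k _ (≰⇒> nle)))) a)

  Alarms-skip : ∀ {e} → Alarms k o q x P R A → Alarms k o q x (e ∷ P) R A
  Alarms-skip al = record { set = set ; A⊆P = λ a → let v , e = A⊆P a in v , there e }
    where open Alarms al

  Alarms-add : ∀ {u v d} → Alarms k o q x P R A → d ≡ gain (suc u) ((v , u) ∷ R) →
    Alarms k o q x ((u , v) ∷ P) ((v , u) ∷ R) ((alarmAt q o k d , u) ∷ A)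
  Alarms-add {u} {v} al refl = record
    { set = ring
    ; A⊆P = λ { (here refl) → v , here refl ; (there a) → let v′ , e = A⊆P a in v′ , there e } }
    where
    open Alarms al
    ring : ∀ {v′ u′} → (v′ , u′) ∈ (v , u) ∷ R → suc u′ ≡ x ⊎
           (alarmAt q o k (gain (suc u′) ((v , u) ∷ R)) , u′)
             ∈ (alarmAt q o k (gain (suc u) ((v , u) ∷ R)) , u) ∷ A
    ring (here refl) = inj₂ (here refl)
    ring {v′} {u′} (there r) with u ≟ u′
    ... | yes refl = inj₂ (here refl)
    ... | no u≢u′ rewrite ≢⇒≡ᵇ u≢u′ with set r
    ...   | inj₁ same = inj₁ same
    ...   | inj₂ a  = inj₂ (there a)

Alarms-new : ∀ {k o q x} → Alarms k o q x [] [] []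
Alarms-new = record { set = λ () ; A⊆P = λ () }

-- `S⊆P` attaches an edge to each picked node, which is how the answer is known to consist of left
-- nodes.
record Picks (P : List (ℕ × ℕ)) (C S : List ℕ) (x : ℕ) : Set where
  field
    C⊆S : ∀ {v} → v ∈ C → ∃[ u ] (u ∈ S × (u , v) ∈ P)
    S⊆P : ∀ {u} → u ∈ S → ∃[ v ] (u , v) ∈ P
    x∈S : ∀ {u} → x ≡ suc u → u ∈ S

module _ {P : List (ℕ × ℕ)} {C S : List ℕ} where

  Picks-cover : ∀ {u v} → Picks P C S (suc u) → (u , v) ∈ P → Picks P (v ∷ C) S (suc u)
  Picks-cover pk e = record
    { C⊆S = λ { (here refl) → _ , x∈S refl , e ; (there c) → C⊆S c } ; S⊆P = S⊆P ; x∈S = x∈S }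
    where open Picks pk

  Picks-endL : ∀ {x} → Picks P C S x → Picks P C S 0
  Picks-endL pk = record { C⊆S = C⊆S ; S⊆P = S⊆P ; x∈S = λ () }
    where open Picks pk

  Picks-pick : ∀ {x u v} → Picks P C S x → (u , v) ∈ P → Picks P C (u ∷ S) (suc u)
  Picks-pick pk e = record
    { C⊆S = λ c → let u , s , e′ = C⊆S c in u , there s , e′
    ; S⊆P = λ { (here refl) → _ , e ; (there s) → S⊆P s } ; x∈S = λ { refl → here refl } }
    where open Picks pk

  Picks-grow : ∀ {x e} → Picks P C S x → Picks (e ∷ P) C S x
  Picks-grow pk = record
    { C⊆S = λ c → let u , s , e′ = C⊆S c in u , s , there e′
    ; S⊆P = λ s → let v , e′ = S⊆P s in v , there e′ ; x∈S = x∈S }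
    where open Picks pk

Picks-new : Picks [] [] [] 0
Picks-new = record { C⊆S = λ () ; S⊆P = λ () ; x∈S = λ () }

-- The coverage promised once the pending work of the pick of x is finished.
record Promise (k o f s w x : ℕ) (R : List (ℕ × ℕ)) : Set where
  field
    target : ℕ
    greedy : Greedy k o s target
    bound  : target + both w x R ≤ f + gain x R

both-0ˡ : ∀ x R → both 0 x R ≡ 0
both-0ˡ x R = count≡0 _ R (λ _ → refl)

both-0ʳ : ∀ w R → both w 0 R ≡ 0
both-0ʳ w []      = refl
both-0ʳ w ((v , u) ∷ R) with suc v ≡ᵇ w
... | true  = both-0ʳ w R
... | false = both-0ʳ w R

gain-0 : ∀ R → gain 0 R ≡ 0
gain-0 R = count≡0 _ R (λ _ → refl)

both≤1 : ∀ v u R → Unique R → both (suc v) (suc u) R ≤ 1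
both≤1 v u R uq = count≤1 _ (v , u) R uq only
  where
  only : ∀ {e} → e ∈ R → ((proj₁ e ≡ᵇ v) ∧ (proj₂ e ≡ᵇ u)) ≡ true → e ≡ (v , u)
  only {a , b} _ same with a ≡ᵇ v in e₁ | b ≡ᵇ u in e₂
  ... | true | true = cong₂ _,_ (≡ᵇ-true {a} {v} e₁) (≡ᵇ-true {b} {u} e₂)

module _ {k o f s : ℕ} {R : List (ℕ × ℕ)} where

  Promise-popR : ∀ {x v u us} → Promise k o f s (suc v) x R → sel v R ≡ u ∷ us →
                 Promise k o f s (suc v) x (del v R)
  Promise-popR {x} {v} {u} pr top = record { target = target ; greedy = greedy ; bound = bound′ }
    where
    open Promise pr
    open ≤-Reasoning
    cl : both (suc v) x R ≡ bit (suc u ≡ᵇ x) + both (suc v) x (del v R)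
    cl = trans (count-del _ v R top)
           (cong (λ b → bit (b ∧ (suc u ≡ᵇ x)) + both (suc v) x (del v R)) (≡ᵇ-refl v))
    move : ∀ a b c → b + (a + c) ≡ a + (b + c)
    move = solve-∀
    bound′ : target + both (suc v) x (del v R) ≤ f + gain x (del v R)
    bound′ = +-cancelˡ-≤ (bit (suc u ≡ᵇ x)) _ _ (begin
      bit (suc u ≡ᵇ x) + (target + both (suc v) x (del v R))  ≡⟨ move target (bit (suc u ≡ᵇ x)) _ ⟩
      target + (bit (suc u ≡ᵇ x) + both (suc v) x (del v R))  ≡⟨ cong (target +_) cl ⟨
      target + both (suc v) x R                                ≤⟨ bound ⟩
      f + gain x R                                             ≡⟨ cong (f +_) (gain-del x v R top) ⟩
      f + (bit (suc u ≡ᵇ x) + gain x (del v R))                ≡⟨ move f (bit (suc u ≡ᵇ x)) _ ⟨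
      bit (suc u ≡ᵇ x) + (f + gain x (del v R))                ∎)

  Promise-endR : ∀ {w x} → Promise k o f s w x R → Promise k o f s 0 x R
  Promise-endR {w} {x} pr = record
    { target = target ; greedy = greedy
    ; bound = ≤-trans (+-monoʳ-≤ target (≤-trans (≤-reflexive (both-0ˡ x R)) z≤n)) bound }
    where open Promise pr

  -- Covering `v` raises `f` while the edge between `u` and `v` is still live. As `R` repeats
  -- nothing, at most this one edge is counted twice.
  Promise-cover : ∀ {v u} → Unique R → Promise k o f s 0 (suc u) R →
                  Promise k o (suc f) s (suc v) (suc u) R
  Promise-cover {v} {u} uq pr = record { target = target ; greedy = greedy ; bound = bound′ }
    where
    open Promise pr
    open ≤-Reasoning
    bound′ : target + both (suc v) (suc u) R ≤ suc f + gain (suc u) R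
    bound′ = begin
      target + both (suc v) (suc u) R    ≤⟨ +-monoʳ-≤ target (both≤1 v u R uq) ⟩
      target + 1                         ≡⟨ +-comm target 1 ⟩
      suc target                         ≤⟨ s≤s (≤-trans (m≤m+n target _) bound) ⟩
      suc (f + gain (suc u) R)           ∎

  Promise-idle : ∀ {w} → (pr : Promise k o f s w 0 R) → Promise.target pr ≤ f
  Promise-idle {w} pr = begin
    target               ≤⟨ m≤m+n target _ ⟩
    target + both w 0 R  ≤⟨ bound ⟩
    f + gain 0 R         ≡⟨ cong (f +_) (gain-0 R) ⟩
    f + 0                ≡⟨ +-identityʳ f ⟩
    f                    ∎
    where
    open Promise pr
    open ≤-Reasoning

  Promise-endL : ∀ {w x} → Promise k o f s w x R → gain x R ≡ 0 → Promise k o f s w 0 R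
  Promise-endL {w} {x} pr ≡0 = record { target = target ; greedy = greedy ; bound = begin
    target + both w 0 R ≡⟨ cong (target +_) (both-0ʳ w R) ⟩
    target + 0          ≤⟨ +-monoʳ-≤ target z≤n ⟩
    target + both w x R ≤⟨ bound ⟩
    f + gain x R        ≡⟨ cong (f +_) (trans ≡0 (sym (gain-0 R))) ⟩
    f + gain 0 R        ∎ }
    where
    open Promise pr
    open ≤-Reasoning

Greedy-mono : ∀ {k o s F F′} → F ≤ F′ → Greedy k o s F → Greedy k o s F′
Greedy-mono {k} {o} {s} le gr = ≤-trans gr (+-monoˡ-≤ _ (*-monoʳ-≤ (k ^ s) le))

-- Each pick closes a 1/k fraction of the distance to o.
Greedy-step : ∀ j o s f d → Greedy (suc j) o s f → o ≤ suc j * d + f → Greedy (suc j) o (suc s) (f + d)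
Greedy-step j o s f d gr le = begin
  suc j * K * o                          ≡⟨ e₁ j K o ⟩
  j * (K * o) + K * o                    ≤⟨ +-mono-≤ (*-monoʳ-≤ j gr) (*-monoʳ-≤ K le) ⟩
  j * (K * f + H * o) + K * (suc j * d + f)  ≡⟨ e₂ j K f H o d ⟩
  suc j * K * (f + d) + j * H * o        ∎
  where
  open ≤-Reasoning
  K = suc j ^ s
  H = j ^ s
  e₁ : ∀ j K o → suc j * K * o ≡ j * (K * o) + K * o
  e₁ = solve-∀
  e₂ : ∀ j K f H o d → j * (K * f + H * o) + K * (suc j * d + f) ≡ suc j * K * (f + d) + j * H * o
  e₂ = solve-∀

Promise-pick : ∀ {k o f s R} u → 0 < k → Promise k o f s 0 0 R → o ≤ k * gain (suc u) R + f →
               Promise k o f (suc s) 0 (suc u) R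
Promise-pick {suc j} {o} {f} {s} {R} u _ pr le = record
  { target = f + gain (suc u) R
  ; greedy = Greedy-step j o s f (gain (suc u) R) (Greedy-mono {suc j} {o} {s} (Promise-idle pr) greedy) le
  ; bound  = ≤-reflexive (trans (cong (f + gain (suc u) R +_) (both-0ˡ (suc u) R)) (+-identityʳ _)) }
  where open Promise pr

Promise-add : ∀ {k o f s R e} → Promise k o f s 0 0 R → Promise k o f s 0 0 (e ∷ R)
Promise-add pr = record { Promise pr }

Promise-new : ∀ {k o} → Promise k o 0 0 0 0 []
Promise-new {k} {o} = record { target = 0 ; greedy = ≤-refl ; bound = z≤n }

-- Lists of the analysis that the program stores only indirectly, through its tables and its block
-- of the pool.
record Ghost : Set where
  constructor ghost
  field
    C S   : List ℕ
    L R A : List (ℕ × ℕ)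

record St : Set where
  constructor st
  field
    k M o f s q p x w : ℕ
    ed : ℕ → ℕ × ℕ
    gh : Ghost
  open Ghost gh public

sg : ℕ → ℕ
sg zero    = 0
sg (suc _) = 1

-- Each step lowers the energy: an edge brings 9, enough for its entries in L (3), R (3) and A (2),
-- where popping from L may advance f and set w, and popping from R pushes to A.
weight : St → ℕ
weight a = 3 * length L + 3 * length R + 2 * length A + sg x + sg w + (f ∸ q)
  where open St a

energy : St → ℕ
energy a = 9 * (M ∸ p) + weight a
  where open St a

-- `f+L≤p` bounds the coverage by the edges read, hence a complete guess by the edges; `weight≤`
-- bounds the stacks. Both also keep counters within a word.
record Inv (a : St) : Set where
  open St a
  field
    live    : Live (pre ed p) C L R w
    alarms  : Alarms k o q x (pre ed p) R A
    picks   : Picks (pre ed p) C S x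
    promise : Promise k o f s w x R
    f≡      : f ≡ length C
    s≡      : s ≡ length S
    p≤M     : p ≤ M
    q≤f     : q ≤ f
    s≤k     : s ≤ k
    f+L≤p   : f + length L ≤ p
    weight≤ : weight a ≤ 9 * p

Descends : St → St → Set
Descends a a′ = Inv a′ × energy a′ < energy a

module _ (k M o f s q p x w : ℕ) (ed : ℕ → ℕ × ℕ) (C S : List ℕ) (L R A : List (ℕ × ℕ)) where

  step-popR : ∀ v {u us d} → w ≡ suc v → Inv (st k M o f s q p x w ed (ghost C S L R A)) →
    sel v R ≡ u ∷ us → d ≡ gain (suc u) (del v R) →
    Descends (st k M o f s q p x w ed (ghost C S L R A))
             (st k M o f s q p x w ed (ghost C S L (del v R) ((alarmAt q o k d , u) ∷ A)))
  step-popR v {u} refl iv top d≡ = record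
    { live = Live-popR live top
    ; alarms = Alarms-popR alarms top d≡ (Live.R⊆P live (sel-∈ v R top))
    ; picks = picks ; promise = Promise-popR promise top
    ; f≡ = f≡ ; s≡ = s≡ ; p≤M = p≤M ; q≤f = q≤f ; s≤k = s≤k ; f+L≤p = f+L≤p
    ; weight≤ = ≤-trans (<⇒≤ below) weight≤ } , +-monoʳ-< (9 * (M ∸ p)) below
    where
    open Inv iv
    same : ∀ l r a t → suc (l + 3 * r + 2 * suc a + t + 1) ≡ l + 3 * suc r + 2 * a + t + 1
    same = solve-∀
    -- `weight` sees only the number of reminders, so an arbitrary alarm stands in for the pushed
    -- one.
    below : weight (st k M o f s q p x w ed (ghost C S L (del v R) ((alarmAt q o k 0 , u) ∷ A)))
         < weight (st k M o f s q p x w ed (ghost C S L R A))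
    below rewrite length-del v R top =
      ≤-reflexive (cong (_+ (f ∸ q)) (same (3 * length L) (length (del v R)) (length A) (sg x)))

  step-endR : ∀ v → w ≡ suc v → Inv (st k M o f s q p x w ed (ghost C S L R A)) → sel v R ≡ [] →
    Descends (st k M o f s q p x w ed (ghost C S L R A)) (st k M o f s q p x 0 ed (ghost C S L R A))
  step-endR v refl iv none = record
    { live = Live-endR live none ; alarms = alarms ; picks = picks ; promise = Promise-endR promise
    ; f≡ = f≡ ; s≡ = s≡ ; p≤M = p≤M ; q≤f = q≤f ; s≤k = s≤k ; f+L≤p = f+L≤p
    ; weight≤ = ≤-trans (<⇒≤ below) weight≤ } , +-monoʳ-< (9 * (M ∸ p)) below
    where
    open Inv iv
    same : ∀ n t → suc (n + 0 + t) ≡ n + 1 + t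
    same = solve-∀
    below : weight (st k M o f s q p x 0 ed (ghost C S L R A))
         < weight (st k M o f s q p x w ed (ghost C S L R A))
    below = ≤-reflexive (same (3 * length L + 3 * length R + 2 * length A + sg x) (f ∸ q))

  step-popL : ∀ u {v vs} → w ≡ 0 → x ≡ suc u → Inv (st k M o f s q p x w ed (ghost C S L R A)) →
    sel u L ≡ v ∷ vs → v ∈ C →
    Descends (st k M o f s q p x w ed (ghost C S L R A)) (st k M o f s q p x w ed (ghost C S (del u L) R A))
  step-popL u refl refl iv top v∈C = record
    { live = Live-popL live top v∈C ; alarms = alarms ; picks = picks ; promise = promise
    ; f≡ = f≡ ; s≡ = s≡ ; p≤M = p≤M ; q≤f = q≤f ; s≤k = s≤k
    ; f+L≤p = ≤-trans (+-monoʳ-≤ f (≤-trans (n≤1+n _) (≤-reflexive (sym (length-del u L top))))) f+L≤p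
    ; weight≤ = ≤-trans (<⇒≤ below) weight≤ } , +-monoʳ-< (9 * (M ∸ p)) below
    where
    open Inv iv
    same : ∀ l t r a → suc (3 * l + r + a + 1 + 0 + t) + 2 ≡ 3 * suc l + r + a + 1 + 0 + t
    same = solve-∀
    below : weight (st k M o f s q p x w ed (ghost C S (del u L) R A))
         < weight (st k M o f s q p x w ed (ghost C S L R A))
    below rewrite length-del u L top = ≤-trans (m≤m+n _ 2)
      (≤-reflexive (same (length (del u L)) (f ∸ q) (3 * length R) (2 * length A)))

  step-cover : ∀ u {v vs} → w ≡ 0 → x ≡ suc u → Inv (st k M o f s q p x w ed (ghost C S L R A)) →
    sel u L ≡ v ∷ vs → v ∉ C →
    Descends (st k M o f s q p x w ed (ghost C S L R A))
             (st k M o (suc f) s q p x (suc v) ed (ghost (v ∷ C) S (del u L) R A))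
  step-cover u {v} refl refl iv top v∉C = record
    { live = Live-cover live top v∉C ; alarms = alarms
    ; picks = Picks-cover picks (Live.L⊆P live (sel-∈ u L top))
    ; promise = Promise-cover (Live.uniqR live) promise
    ; f≡ = cong suc f≡ ; s≡ = s≡ ; p≤M = p≤M ; q≤f = m≤n⇒m≤1+n q≤f ; s≤k = s≤k
    ; f+L≤p = ≤-trans (≤-reflexive (trans (sym (+-suc f _)) (cong (f +_) (sym (length-del u L top))))) f+L≤p
    ; weight≤ = ≤-trans (<⇒≤ below) weight≤ } , +-monoʳ-< (9 * (M ∸ p)) below
    where
    open Inv iv
    same : ∀ l t r a → suc (3 * l + r + a + 1 + 1 + suc t) ≡ 3 * suc l + r + a + 1 + 0 + t
    same = solve-∀
    below : weight (st k M o (suc f) s q p x (suc v) ed (ghost (v ∷ C) S (del u L) R A))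
         < weight (st k M o f s q p x w ed (ghost C S L R A))
    below rewrite length-del u L top | +-∸-assoc 1 q≤f =
      ≤-reflexive (same (length (del u L)) (f ∸ q) (3 * length R) (2 * length A))

  step-endL : ∀ u → w ≡ 0 → x ≡ suc u → Inv (st k M o f s q p x w ed (ghost C S L R A)) → sel u L ≡ [] →
    Descends (st k M o f s q p x w ed (ghost C S L R A)) (st k M o f s q p 0 w ed (ghost C S L R A))
  step-endL u refl refl iv none = record
    { live = live ; alarms = Alarms-endL {x = 0} alarms dead ; picks = Picks-endL picks
    ; promise = Promise-endL promise (count≡0 _ R (λ {e} r → ≢⇒≡ᵇ {proj₂ e} {u} λ { refl → dead r }))
    ; f≡ = f≡ ; s≡ = s≡ ; p≤M = p≤M ; q≤f = q≤f ; s≤k = s≤k ; f+L≤p = f+L≤p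
    ; weight≤ = ≤-trans (<⇒≤ below) weight≤ } , +-monoʳ-< (9 * (M ∸ p)) below
    where
    open Inv iv
    -- A live edge at `u` would end at an uncovered node, as `w` is 0, and would thus still await
    -- scanning in the empty stack of `L`.
    dead : ∀ {v} → (v , u) ∉ R
    dead r with Live.R∉C live r | Live.R⊆CL live r
    ... | inj₁ ∉C | inj₁ c = ∉C c
    ... | inj₁ ∉C | inj₂ l = sel≡[]⇒∉ u L none l
    same : ∀ n t → suc (n + 0 + 0 + t) ≡ n + 1 + 0 + t
    same = solve-∀
    below : weight (st k M o f s q p 0 w ed (ghost C S L R A))
         < weight (st k M o f s q p x w ed (ghost C S L R A))
    below = ≤-reflexive (same (3 * length L + 3 * length R + 2 * length A) (f ∸ q))

  step-ignore : ∀ {u us} → w ≡ 0 → x ≡ 0 → Inv (st k M o f s q p x w ed (ghost C S L R A)) →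
    sel q A ≡ u ∷ us → k * gain (suc u) R + f < o →
    Descends (st k M o f s q p x w ed (ghost C S L R A)) (st k M o f s q p x w ed (ghost C S L R (del q A)))
  step-ignore refl refl iv top quiet = record
    { live = live ; alarms = Alarms-ignore alarms top q≤f quiet ; picks = picks ; promise = promise
    ; f≡ = f≡ ; s≡ = s≡ ; p≤M = p≤M ; q≤f = q≤f ; s≤k = s≤k ; f+L≤p = f+L≤p
    ; weight≤ = ≤-trans (<⇒≤ below) weight≤ } , +-monoʳ-< (9 * (M ∸ p)) below
    where
    open Inv iv
    same : ∀ l a t → suc (l + 2 * a + 0 + 0 + t) + 1 ≡ l + 2 * suc a + 0 + 0 + t
    same = solve-∀
    below : weight (st k M o f s q p x w ed (ghost C S L R (del q A)))
         < weight (st k M o f s q p x w ed (ghost C S L R A))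
    below rewrite length-del q A top = ≤-trans (m≤m+n _ 1)
      (≤-reflexive (same (3 * length L + 3 * length R) (length (del q A)) (f ∸ q)))

  step-pick : ∀ {u us} → w ≡ 0 → x ≡ 0 → s < k → Inv (st k M o f s q p x w ed (ghost C S L R A)) →
    sel q A ≡ u ∷ us → o ≤ k * gain (suc u) R + f →
    Descends (st k M o f s q p x w ed (ghost C S L R A))
             (st k M o f (suc s) q p (suc u) w ed (ghost C (u ∷ S) L R (del q A)))
  step-pick {u} refl refl s<k iv top loud = record
    { live = live ; alarms = Alarms-pick {x = 0} alarms top
    ; picks = Picks-pick picks (proj₂ (Alarms.A⊆P alarms (sel-∈ q A top)))
    ; promise = Promise-pick u (≤-<-trans z≤n s<k) promise loud
    ; f≡ = f≡ ; s≡ = cong suc s≡ ; p≤M = p≤M ; q≤f = q≤f ; s≤k = s<k ; f+L≤p = f+L≤p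
    ; weight≤ = ≤-trans (<⇒≤ below) weight≤ } , +-monoʳ-< (9 * (M ∸ p)) below
    where
    open Inv iv
    same : ∀ l a t → suc (l + 2 * a + 1 + 0 + t) ≡ l + 2 * suc a + 0 + 0 + t
    same = solve-∀
    below : weight (st k M o f (suc s) q p (suc u) w ed (ghost C (u ∷ S) L R (del q A)))
         < weight (st k M o f s q p x w ed (ghost C S L R A))
    below rewrite length-del q A top =
      ≤-reflexive (same (3 * length L + 3 * length R) (length (del q A)) (f ∸ q))

  step-advance : q < f → Inv (st k M o f s q p x w ed (ghost C S L R A)) → sel q A ≡ [] →
    Descends (st k M o f s q p x w ed (ghost C S L R A)) (st k M o f s (suc q) p x w ed (ghost C S L R A))
  step-advance q<f iv none = record
    { live = live ; alarms = Alarms-advance alarms none ; picks = picks ; promise = promise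
    ; f≡ = f≡ ; s≡ = s≡ ; p≤M = p≤M ; q≤f = q<f ; s≤k = s≤k ; f+L≤p = f+L≤p
    ; weight≤ = ≤-trans (<⇒≤ below) weight≤ } , +-monoʳ-< (9 * (M ∸ p)) below
    where
    open Inv iv
    below : weight (st k M o f s (suc q) p x w ed (ghost C S L R A))
         < weight (st k M o f s q p x w ed (ghost C S L R A))
    below = +-monoʳ-< (3 * length L + 3 * length R + 2 * length A + sg x + sg w) (∸-monoʳ-< (n<1+n q) q<f)

  step-skip : ∀ {u v} → w ≡ 0 → p < M → ed p ≡ (u , v) → Inv (st k M o f s q p x w ed (ghost C S L R A)) →
    v ∈ C →
    Descends (st k M o f s q p x w ed (ghost C S L R A)) (st k M o f s q (suc p) x w ed (ghost C S L R A))
  step-skip {u} {v} refl p<M ed≡ iv v∈C = record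
    { live = subst (λ e → Live (e ∷ pre ed p) C L R 0) (sym ed≡) (Live-skip live v∈C)
    ; alarms = Alarms-skip alarms ; picks = Picks-grow picks ; promise = promise
    ; f≡ = f≡ ; s≡ = s≡ ; p≤M = p<M ; q≤f = q≤f ; s≤k = s≤k ; f+L≤p = m≤n⇒m≤1+n f+L≤p
    ; weight≤ = ≤-trans weight≤ (*-monoʳ-≤ 9 (n≤1+n p)) }
    , +-monoˡ-< _ (*-monoʳ-< 9 (∸-monoʳ-< (n<1+n p) p<M))
    where open Inv iv

  step-add : ∀ {u v d} → w ≡ 0 → x ≡ 0 → p < M → ed p ≡ (u , v) → (u , v) ∉ pre ed p →
    Inv (st k M o f s q p x w ed (ghost C S L R A)) → v ∉ C → d ≡ gain (suc u) ((v , u) ∷ R) →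
    Descends (st k M o f s q p x w ed (ghost C S L R A))
             (st k M o f s q (suc p) x w ed
               (ghost C S ((u , v) ∷ L) ((v , u) ∷ R) ((alarmAt q o k d , u) ∷ A)))
  step-add {u} {v} refl refl p<M ed≡ new iv v∉C d≡ = record
    { live = subst (λ e → Live (e ∷ pre ed p) C ((u , v) ∷ L) ((v , u) ∷ R) 0) (sym ed≡) (Live-add live v∉C new)
    ; alarms = subst (λ e → Alarms k o q 0 (e ∷ pre ed p) ((v , u) ∷ R) (_ ∷ A)) (sym ed≡) (Alarms-add alarms d≡)
    ; picks = Picks-grow picks ; promise = Promise-add promise
    ; f≡ = f≡ ; s≡ = s≡ ; p≤M = p<M ; q≤f = q≤f ; s≤k = s≤k
    ; f+L≤p = ≤-trans (≤-reflexive (+-suc f (length L))) (s≤s f+L≤p)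
    ; weight≤ = ≤-trans (≤-trans (n≤1+n _) (≤-reflexive same′)) (≤-trans (+-monoʳ-≤ 9 weight≤) (≤-reflexive (sym (*-suc 9 p)))) }
    , ≤-reflexive (begin
        suc (9 * (M ∸ suc p) + weight a′)  ≡⟨ +-suc (9 * (M ∸ suc p)) (weight a′) ⟨
        9 * (M ∸ suc p) + suc (weight a′)  ≡⟨ cong (9 * (M ∸ suc p) +_) same′ ⟩
        9 * (M ∸ suc p) + (9 + weight a)   ≡⟨ move (M ∸ suc p) (weight a) ⟩
        9 * suc (M ∸ suc p) + weight a     ≡⟨ cong (λ n → 9 * n + weight a) (+-∸-assoc 1 p<M) ⟨
        9 * (M ∸ p) + weight a             ∎)
    where
    open Inv iv
    open ≡-Reasoning
    a a′ : St
    a  = st k M o f s q p x w ed (ghost C S L R A)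
    a′ = st k M o f s q (suc p) x w ed (ghost C S ((u , v) ∷ L) ((v , u) ∷ R) ((alarmAt q o k 0 , u) ∷ A))
    move : ∀ n m → 9 * n + (9 + m) ≡ 9 * suc n + m
    move = solve-∀
    same : ∀ l r a t → suc (3 * suc l + 3 * suc r + 2 * suc a + 0 + 0 + t) ≡ 9 + (3 * l + 3 * r + 2 * a + 0 + 0 + t)
    same = solve-∀
    same′ : suc (weight a′) ≡ 9 + weight a
    same′ = same (length L) (length R) (length A) (f ∸ q)

  -- No node can be picked, so the guess exceeds what any k nodes cover.
  quiet-gain : w ≡ 0 → x ≡ 0 → q ≡ f → f < o → Inv (st k M o f s q p x w ed (ghost C S L R A)) →
    sel q A ≡ [] → ∀ u → k * gain (suc u) R + f < o
  quiet-gain refl refl refl f<o iv none u with gain (suc u) R in g≡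
  ... | zero  = subst (λ n → n + f < o) (sym (*-zeroʳ k)) f<o
  ... | suc g with witness R g≡
    where
    witness : ∀ xs {n} → gain (suc u) xs ≡ suc n → ∃[ v ] (v , u) ∈ xs
    witness ((v , u′) ∷ xs) same with u′ ≡ᵇ u in e
    ... | true  = v , here (cong (v ,_) (sym (≡ᵇ-true {u′} {u} e)))
    ... | false = let v′ , r = witness xs same in v′ , there r
  ...   | v , r with Alarms.set (Inv.alarms iv) r
  ...     | inj₂ a rewrite g≡ with o ∸ k * suc g ≤? f
  ...       | yes le = contradiction (subst (λ i → (i , u) ∈ A) (alarmAt-early q o k _ le) a) (sel≡[]⇒∉ q A none)
  ...       | no nle = late⇒quiet o k _ f (≰⇒> nle)

Inv-new : ∀ k M o {x w} ed → x ≡ 0 → w ≡ 0 → Inv (st k M o 0 0 0 0 x w ed (ghost [] [] [] [] []))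
Inv-new k M o ed refl refl = record
  { live = Live-new ; alarms = Alarms-new ; picks = Picks-new ; promise = Promise-new {k} {o}
  ; f≡ = refl ; s≡ = refl ; p≤M = z≤n ; q≤f = z≤n ; s≤k = z≤n ; f+L≤p = z≤n ; weight≤ = z≤n }

pre-cong : ∀ {ed ed′ : ℕ → ℕ × ℕ} p → (∀ i → i < p → ed i ≡ ed′ i) → pre ed p ≡ pre ed′ p
pre-cong zero    same = refl
pre-cong (suc p) same = cong₂ _∷_ (same p ≤-refl) (pre-cong p (λ i i<p → same i (m<n⇒m<1+n i<p)))

-- The processed prefix lies within the old edges and does not see the new one; the 9 units pay for
-- processing that edge once.
Inv-insert : ∀ {k M o f s q p x w ed ed′ gh} → (∀ i → i < M → ed i ≡ ed′ i) →
  Inv (st k M o f s q p x w ed gh) →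
  Inv (st k (suc M) o f s q p x w ed′ gh) ×
  energy (st k (suc M) o f s q p x w ed′ gh) ≡ 9 + energy (st k M o f s q p x w ed gh)
Inv-insert {k} {M} {o} {f} {s} {q} {p} {x} {w} {ed} {ed′} {gh} same iv = record
  { live = subst (λ P → Live P C L R w) P≡ live
  ; alarms = subst (λ P → Alarms k o q x P R A) P≡ alarms
  ; picks = subst (λ P → Picks P C S x) P≡ picks
  ; promise = promise ; f≡ = f≡ ; s≡ = s≡ ; p≤M = m≤n⇒m≤1+n p≤M ; q≤f = q≤f ; s≤k = s≤k
  ; f+L≤p = f+L≤p ; weight≤ = weight≤ }
  , trans (cong (λ n → 9 * n + weight a) (+-∸-assoc 1 p≤M)) (move (M ∸ p) (weight a))
  where
  open Ghost gh
  open Inv iv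
  a = st k M o f s q p x w ed gh
  P≡ : pre ed p ≡ pre ed′ p
  P≡ = pre-cong p (λ i i<p → same i (≤-trans i<p p≤M))
  move : ∀ n m → 9 * suc n + m ≡ 9 + (9 * n + m)
  move = solve-∀

-- Powers

^-distribʳ-* : ∀ k m n → (m * n) ^ k ≡ m ^ k * n ^ k
^-distribʳ-* zero    m n = refl
^-distribʳ-* (suc k) m n = trans (cong (m * n *_) (^-distribʳ-* k m n)) (e₁ m n (m ^ k) (n ^ k))
  where
  e₁ : ∀ m n x y → m * n * (x * y) ≡ m * x * (n * y)
  e₁ = solve-∀

-- Bernoulli's inequality `(1 + y/x)ⁿ ≥ 1 + n y/x`, multiplied by `xⁿ⁺¹`.
bernoulli : ∀ x y n → x ^ n * (x + n * y) ≤ (x + y) ^ n * x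
bernoulli x y zero    = ≤-reflexive (cong (_+ 0) (+-identityʳ x))
bernoulli x y (suc n) = begin
  x * X * (x + (y + n * y))                  ≤⟨ m≤m+n _ (X * (n * y * y)) ⟩
  x * X * (x + (y + n * y)) + X * (n * y * y)  ≡⟨ e₁ x y X (n * y) ⟩
  (x + y) * (X * (x + n * y))                ≤⟨ *-monoʳ-≤ (x + y) (bernoulli x y n) ⟩
  (x + y) * ((x + y) ^ n * x)                ≡⟨ *-assoc (x + y) ((x + y) ^ n) x ⟨
  (x + y) * (x + y) ^ n * x                  ∎
  where
  open ≤-Reasoning
  X = x ^ n
  e₁ : ∀ x y X z → x * X * (x + (y + z)) + X * (z * y) ≡ (x + y) * (X * (x + z))
  e₁ = solve-∀

-- With `k = suc j` this is `(1 - 1/k)ᵏ ≤ 1/2`; Bernoulli gives `(1 + 1/j)ᵏ ≥ 1 + k/j ≥ 2`.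
half : ∀ j → 2 * j ^ suc j ≤ suc j ^ suc j
half zero      = z≤n
half j@(suc i) = *-cancelʳ-≤ _ _ j (begin
  2 * j ^ suc j * j            ≡⟨ e₁ (j ^ suc j) j ⟩
  j ^ suc j * (j + j)          ≤⟨ *-monoʳ-≤ (j ^ suc j) (+-monoʳ-≤ j (≤-trans (n≤1+n j) (≤-reflexive (sym (*-identityʳ (suc j)))))) ⟩
  j ^ suc j * (j + suc j * 1)  ≤⟨ bernoulli j 1 (suc j) ⟩
  (j + 1) ^ suc j * j          ≡⟨ cong (λ n → n ^ suc j * j) (+-comm j 1) ⟩
  suc j ^ suc j * j            ∎)
  where
  open ≤-Reasoning
  e₁ : ∀ X j → 2 * X * j ≡ X * (j + j)
  e₁ = solve-∀

-- By `half`, `k` picks reach at least half of the guess. Complete guesses thus stay below twice the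
-- number of edges, which limits how many there are.
Greedy⇒≤2* : ∀ {k o f} → 0 < k → Greedy k o k f → o ≤ 2 * f
Greedy⇒≤2* {k@(suc j)} {o} {f} _ gr = *-cancelˡ-≤ (k ^ k) {{m^n≢0 k k}} (+-cancelʳ-≤ (k ^ k * o) _ _ (begin
  k ^ k * o + k ^ k * o                    ≡⟨ e₁ (k ^ k) o ⟩
  2 * (k ^ k * o)                          ≤⟨ *-monoʳ-≤ 2 gr ⟩
  2 * (k ^ k * f + j ^ k * o)              ≡⟨ e₂ (k ^ k) f (j ^ k) o ⟩
  k ^ k * (2 * f) + 2 * j ^ k * o          ≤⟨ +-monoʳ-≤ _ (*-monoˡ-≤ o (half j)) ⟩
  k ^ k * (2 * f) + k ^ k * o              ∎))
  where
  open ≤-Reasoning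
  e₁ : ∀ K o → K * o + K * o ≡ 2 * (K * o)
  e₁ = solve-∀
  e₂ : ∀ K f H o → 2 * (K * f + H * o) ≡ K * (2 * f) + 2 * H * o
  e₂ = solve-∀

-- (1 - 1/k)ᵏ increases with k.
decay-step : ∀ j → j ^ suc j * (2 + j) ^ (2 + j) ≤ suc j ^ suc j * suc j ^ (2 + j)
decay-step zero      = z≤n
decay-step j@(suc i) = *-cancelʳ-≤ _ _ y (begin
  j ^ k * ((2 + j) * (2 + j) ^ k) * y       ≡⟨ e₁ (j ^ k) (2 + j) ((2 + j) ^ k) y ⟩
  j ^ k * (2 + j) ^ k * (y * (2 + j))       ≡⟨ cong (_* (y * (2 + j))) (^-distribʳ-* k j (2 + j)) ⟨
  -- Here `y = k² - 1`, and Bernoulli yields `(k² / (k² - 1))ᵏ ≥ 1 + k / (k² - 1) ≥ (k + 1) / k`.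
  y ^ k * (y * (2 + j))                     ≤⟨ *-monoʳ-≤ (y ^ k) (≤-trans (n≤1+n _) (≤-reflexive (e₂ j))) ⟩
  y ^ k * ((y + k * 1) * k)                 ≡⟨ *-assoc (y ^ k) (y + k * 1) k ⟨
  y ^ k * (y + k * 1) * k                   ≤⟨ *-monoˡ-≤ k (bernoulli y 1 k) ⟩
  (y + 1) ^ k * y * k                       ≡⟨ cong (λ n → n ^ k * y * k) (e₃ j) ⟩
  (k * k) ^ k * y * k                       ≡⟨ cong (λ n → n * y * k) (^-distribʳ-* k k k) ⟩
  k ^ k * k ^ k * y * k                     ≡⟨ e₄ (k ^ k) y k ⟩
  k ^ k * (k * k ^ k) * y                   ∎)
  where
  open ≤-Reasoning
  k = suc j
  y = j * (2 + j)
  e₁ : ∀ a b c y → a * (b * c) * y ≡ a * c * (y * b)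
  e₁ = solve-∀
  e₂ : ∀ j → suc (j * (2 + j) * (2 + j)) ≡ (j * (2 + j) + suc j * 1) * suc j
  e₂ = solve-∀
  e₃ : ∀ j → j * (2 + j) + 1 ≡ suc j * suc j
  e₃ = solve-∀
  e₄ : ∀ K y k → K * K * y * k ≡ K * (k * K) * y
  e₄ = solve-∀

decay : ∀ j m → j ≤ m → j ^ suc j * suc m ^ suc m ≤ suc j ^ suc j * m ^ suc m
decay j m le with m≤n⇒∃[o]m+o≡n le
... | i , refl = go i
  where
  open ≤-Reasoning
  go : ∀ i → j ^ suc j * suc (j + i) ^ suc (j + i) ≤ suc j ^ suc j * (j + i) ^ suc (j + i)
  go zero    rewrite +-identityʳ j = ≤-reflexive (*-comm (j ^ suc j) (suc j ^ suc j))
  go (suc i) rewrite +-suc j i = *-cancelˡ-≤ (suc n ^ suc n) {{m^n≢0 (suc n) (suc n)}} (begin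
    N * (a * B)          ≡⟨ e₁ N a B ⟩
    a * N * B            ≤⟨ *-monoˡ-≤ B (go i) ⟩
    c * n ^ suc n * B    ≡⟨ *-assoc c (n ^ suc n) B ⟩
    c * (n ^ suc n * B)  ≤⟨ *-monoʳ-≤ c (decay-step n) ⟩
    c * (N * G)          ≡⟨ e₂ c N G ⟩
    N * (c * G)          ∎)
    where
    n = j + i
    a = j ^ suc j
    c = suc j ^ suc j
    N = suc n ^ suc n
    B = (2 + n) ^ (2 + n)
    G = suc n ^ (2 + n)
    e₁ : ∀ N a B → N * (a * B) ≡ a * N * B
    e₁ = solve-∀
    e₂ : ∀ c N G → c * (N * G) ≡ N * (c * G)
    e₂ = solve-∀

-- Rests on (1 - 1/k)ᵏ ≤ (m / (m + 1))ᵐ for k ≤ m + 1.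
Greedy-limit : ∀ {k o F} m → 0 < k → k ≤ suc m → Greedy k o k F → suc m ^ m * o ≤ suc m ^ m * F + m ^ m * o
Greedy-limit {k@(suc j)} {o} {F} m _ (s≤s j≤m) gr =
  *-cancelˡ-≤ (suc m * K) {{m*n≢0 (suc m) K {{_}} {{m^n≢0 k k}}}} (begin
  suc m * K * (Y * o)                      ≡⟨ e₁ (suc m) K Y o ⟩
  suc m * Y * (K * o)                      ≤⟨ *-monoʳ-≤ (suc m * Y) gr ⟩
  suc m * Y * (K * F + j ^ k * o)          ≡⟨ e₂ (suc m) Y K F (j ^ k) o ⟩
  suc m * K * (Y * F) + j ^ k * (suc m * Y) * o  ≤⟨ +-monoʳ-≤ _ (*-monoˡ-≤ o (decay j m j≤m)) ⟩
  -- A factor `m / (m + 1)` is given away: `decay` has the exponent `m + 1`, the approximation of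
  -- `1/e` only `m`.
  suc m * K * (Y * F) + K * (m * X) * o    ≤⟨ +-monoʳ-≤ (suc m * K * (Y * F)) (*-monoˡ-≤ o (*-monoʳ-≤ K (*-monoˡ-≤ X (n≤1+n m)))) ⟩
  suc m * K * (Y * F) + K * (suc m * X) * o  ≡⟨ e₃ (suc m) K Y F X o ⟩
  suc m * K * (Y * F + X * o)              ∎)
  where
  open ≤-Reasoning
  K = k ^ k
  Y = suc m ^ m
  X = m ^ m
  e₁ : ∀ n K Y o → n * K * (Y * o) ≡ n * Y * (K * o)
  e₁ = solve-∀
  e₂ : ∀ n Y K F H o → n * Y * (K * F + H * o) ≡ n * K * (Y * F) + H * (n * Y) * o
  e₂ = solve-∀
  e₃ : ∀ n K Y F X o → n * K * (Y * F) + K * (n * X) * o ≡ n * K * (Y * F + X * o)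
  e₃ = solve-∀

-- The case Y = (m + 1)ᵐ, X = mᵐ and ε = a / b of (1 - X/Y - ε) v ≤ F, for v ≤ (1 + ε) o.
cover-ratio : ∀ a b X Y F o v → Y * o ≤ Y * F + X * o → b * v ≤ (a + b) * o → X ≤ Y →
          b * Y * v ≤ b * Y * F + (b * X + a * Y) * v
cover-ratio a b X Y F o v gr ap X≤Y with v ≤? o
... | yes v≤o with m≤n⇒∃[o]m+o≡n X≤Y
...   | Δ , refl = begin
  b * (X + Δ) * v                                  ≡⟨ e₁ b X Δ v ⟩
  b * (Δ * v) + b * X * v                          ≤⟨ +-monoˡ-≤ _ (*-monoʳ-≤ b (≤-trans (*-monoʳ-≤ Δ v≤o) gr′)) ⟩
  b * ((X + Δ) * F) + b * X * v                    ≤⟨ +-mono-≤ (≤-reflexive (sym (*-assoc b (X + Δ) F))) (*-monoˡ-≤ v (m≤m+n (b * X) _)) ⟩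
  b * (X + Δ) * F + (b * X + a * (X + Δ)) * v      ∎
  where
  open ≤-Reasoning
  e₁ : ∀ b X Δ v → b * (X + Δ) * v ≡ b * (Δ * v) + b * X * v
  e₁ = solve-∀
  e₂ : ∀ X Δ o → X * o + Δ * o ≡ (X + Δ) * o
  e₂ = solve-∀
  gr′ : Δ * o ≤ (X + Δ) * F
  gr′ = +-cancelˡ-≤ (X * o) _ _ (≤-trans (≤-reflexive (e₂ X Δ o)) (≤-trans gr (≤-reflexive (+-comm _ (X * o)))))
cover-ratio a b X Y F o v gr ap X≤Y | no v≰o = begin
  b * Y * v                                  ≡⟨ e₁ b Y v ⟩
  Y * (b * v)                                ≤⟨ *-monoʳ-≤ Y ap ⟩
  Y * ((a + b) * o)                          ≡⟨ e₂ a b Y o ⟩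
  b * (Y * o) + a * Y * o                    ≤⟨ +-monoˡ-≤ _ (*-monoʳ-≤ b gr) ⟩
  b * (Y * F + X * o) + a * Y * o            ≡⟨ e₃ a b X Y F o ⟩
  -- The error terms pass from `o` to `v`, which takes `o ≤ v`; this is the reason for the two
  -- cases.
  b * Y * F + (b * X + a * Y) * o            ≤⟨ +-monoʳ-≤ (b * Y * F) (*-monoʳ-≤ (b * X + a * Y) (<⇒≤ (≰⇒> v≰o))) ⟩
  b * Y * F + (b * X + a * Y) * v            ∎
  where
  open ≤-Reasoning
  e₁ : ∀ b Y v → b * Y * v ≡ Y * (b * v)
  e₁ = solve-∀
  e₂ : ∀ a b Y o → Y * ((a + b) * o) ≡ b * (Y * o) + a * Y * o
  e₂ = solve-∀
  e₃ : ∀ a b X Y F o → b * (Y * F + X * o) + a * Y * o ≡ b * Y * F + (b * X + a * Y) * o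
  e₃ = solve-∀

-- The total work of all guesses

-- Here `ε = a / b`, `D` is an integer at least `1/ε`, and `n` and `e` exceed the numbers of left
-- nodes and of edges. Growing by `1 + ε` for `W` guesses gains a factor beyond `2 * n`.
module Amortise (a b n e D ℓ : ℕ) {{_ : NonZero a}} {{_ : NonZero b}} {{_ : NonZero e}}
                (b≤Da : b ≤ D * a) (2n<2^ℓ : 2 * n < 2 ^ ℓ) where

  W bound : ℕ
  W     = D * ℓ
  bound = (D + W + 2) * e

  -- `(1 + ε)ᴰ ≥ 1 + D ε ≥ 2`, by Bernoulli.
  doubling : 2 * b ^ D ≤ (a + b) ^ D
  doubling = *-cancelʳ-≤ _ _ b (begin
    2 * b ^ D * b        ≡⟨ e₁ (b ^ D) b ⟩
    b ^ D * (b + b)      ≤⟨ *-monoʳ-≤ (b ^ D) (+-monoʳ-≤ b b≤Da) ⟩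
    b ^ D * (b + D * a)  ≤⟨ bernoulli b a D ⟩
    (b + a) ^ D * b      ≡⟨ cong (λ c → c ^ D * b) (+-comm b a) ⟩
    (a + b) ^ D * b      ∎)
    where
    open ≤-Reasoning
    e₁ : ∀ X j → 2 * X * j ≡ X * (j + j)
    e₁ = solve-∀

  growth : 2 ^ ℓ * b ^ W ≤ (a + b) ^ W
  growth = begin
    2 ^ ℓ * b ^ (D * ℓ)     ≡⟨ cong (2 ^ ℓ *_) (^-*-assoc b D ℓ) ⟨
    2 ^ ℓ * (b ^ D) ^ ℓ     ≡⟨ ^-distribʳ-* ℓ 2 (b ^ D) ⟨
    (2 * b ^ D) ^ ℓ         ≤⟨ ^-monoˡ-≤ ℓ doubling ⟩
    ((a + b) ^ D) ^ ℓ       ≡⟨ ^-*-assoc (a + b) D ℓ ⟩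
    (a + b) ^ (D * ℓ)       ∎
    where open ≤-Reasoning

  -- From `c ≥ W` on, `(1 + ε)ᶜ` is at least `2 ^ ℓ`, which exceeds `2 * n`.
  few : ∀ c → (a + b) ^ c ≤ b ^ c * (2 * n) → c < W
  few c le with c <? W
  ... | yes c<W = c<W
  ... | no  c≮W with m≤n⇒∃[o]m+o≡n (≮⇒≥ c≮W)
  ...   | r , refl = contradiction le (<⇒≱ (begin-strict
    b ^ (W + r) * (2 * n)        <⟨ *-monoʳ-< (b ^ (W + r)) {{m^n≢0 b (W + r)}} 2n<2^ℓ ⟩
    b ^ (W + r) * 2 ^ ℓ          ≡⟨ cong (_* 2 ^ ℓ) (^-distribˡ-+-* b W r) ⟩
    b ^ W * b ^ r * 2 ^ ℓ        ≡⟨ e₁ (b ^ W) (b ^ r) (2 ^ ℓ) ⟩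
    2 ^ ℓ * b ^ W * b ^ r        ≤⟨ *-mono-≤ growth (^-monoˡ-≤ r (m≤n+m b a)) ⟩
    (a + b) ^ W * (a + b) ^ r    ≡⟨ ^-distribˡ-+-* (a + b) W r ⟨
    (a + b) ^ (W + r)            ∎))
    where
    open ≤-Reasoning
    e₁ : ∀ x y z → x * y * z ≡ z * x * y
    e₁ = solve-∀

  -- t is the work done before guess o. As long as n o ≤ e it is dominated by a geometric
  -- series; afterwards at most W guesses follow.
  record Work (o t : ℕ) : Set where
    constructor work
    field
      series : a * t ≤ (a + b) * (n * o)
      phase  : n * o ≤ e ⊎
               ∃[ c ] (c ≤ W × a * t ≤ (a + b) * e + a * (suc c * e) × (a + b) ^ c * e ≤ b ^ c * (n * o))

  Work-start : Work 0 0
  Work-start = work (≤-trans (≤-reflexive (*-zeroʳ a)) z≤n) (inj₁ (≤-trans (≤-reflexive (*-zeroʳ n)) z≤n))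

  Work-bound : ∀ {o t} → Work o t → t ≤ bound
  Work-bound {o} {t} (work ser ph) = *-cancelˡ-≤ a (begin
    a * t                                    ≤⟨ main ph ⟩
    (a + b) * e + a * (suc W * e)            ≤⟨ +-monoˡ-≤ _ (*-monoˡ-≤ e (+-monoʳ-≤ a b≤Da)) ⟩
    (a + D * a) * e + a * (suc W * e)        ≡⟨ e₁ a D e W ⟩
    a * bound                                ∎)
    where
    open ≤-Reasoning
    e₁ : ∀ a D e W → (a + D * a) * e + a * (suc W * e) ≡ a * ((D + W + 2) * e)
    e₁ = solve-∀
    main : _ → a * t ≤ (a + b) * e + a * (suc W * e)
    main (inj₁ le) = ≤-trans ser (≤-trans (*-monoʳ-≤ (a + b) le) (m≤m+n _ _))
    main (inj₂ (c , c≤W , le , _)) = ≤-trans le (+-monoʳ-≤ _ (*-monoʳ-≤ a (*-monoˡ-≤ e (s≤s c≤W))))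

  -- Completing `o` costs `m`. The bound `m ≤ n * o′` feeds the series, `m ≤ e` the later guesses,
  -- and `o ≤ 2 * e` ends them.
  Work-step : ∀ {o o′ t m} → Work o t → o ≤ 2 * e → (a + b) * o ≤ b * o′ → m ≤ n * o′ → m ≤ e →
              Work o′ (t + m)
  Work-step {o} {o′} {t} {m} (work ser ph) o≤2e grow m≤no m≤e = work ser′ (ph′ ph)
    where
    open ≤-Reasoning
    scaled : (a + b) * (n * o) ≤ b * (n * o′)
    scaled = begin
      (a + b) * (n * o)    ≡⟨ e₁ (a + b) n o ⟩
      n * ((a + b) * o)    ≤⟨ *-monoʳ-≤ n grow ⟩
      n * (b * o′)         ≡⟨ e₁ n b o′ ⟩
      b * (n * o′)         ∎
      where
      e₁ : ∀ x y z → x * (y * z) ≡ y * (x * z)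
      e₁ = solve-∀
    ser′ : a * (t + m) ≤ (a + b) * (n * o′)
    ser′ = begin
      a * (t + m)                      ≡⟨ *-distribˡ-+ a t m ⟩
      a * t + a * m                    ≤⟨ +-mono-≤ (≤-trans ser scaled) (*-monoʳ-≤ a m≤no) ⟩
      b * (n * o′) + a * (n * o′)      ≡⟨ e₂ b a (n * o′) ⟩
      (a + b) * (n * o′)               ∎
      where
      e₂ : ∀ b a x → b * x + a * x ≡ (a + b) * x
      e₂ = solve-∀
    one-more : ∀ {X c} → a * t ≤ X + a * (c * e) → a * (t + m) ≤ X + a * (suc c * e)
    one-more {X} {c} le = begin
      a * (t + m)                ≡⟨ *-distribˡ-+ a t m ⟩
      a * t + a * m              ≤⟨ +-mono-≤ le (*-monoʳ-≤ a m≤e) ⟩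
      X + a * (c * e) + a * e    ≡⟨ e₃ X a c e ⟩
      X + a * (suc c * e)        ∎
      where
      e₃ : ∀ X a c e → X + a * (c * e) + a * e ≡ X + a * (suc c * e)
      e₃ = solve-∀
    ph′ : _ → _
    ph′ (inj₁ le) with n * o′ ≤? e
    ... | yes le′ = inj₁ le′
    -- The first guess beyond `e / n` starts the count at 0; all earlier work is covered by the
    -- series.
    ... | no  nle = inj₂ (0 , z≤n , one-more {c = 0} first , ≤-trans (≤-reflexive (*-identityˡ e))
                      (≤-trans (<⇒≤ (≰⇒> nle)) (≤-reflexive (sym (*-identityˡ _)))))
      where
      first : a * t ≤ (a + b) * e + a * 0
      first = ≤-trans ser (≤-trans (*-monoʳ-≤ (a + b) le) (m≤m+n _ _))
    ph′ (inj₂ (c , c≤W , le , big)) = inj₂ (suc c , few c short , one-more {c = suc c} le , (begin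
      (a + b) * (a + b) ^ c * e      ≡⟨ *-assoc (a + b) ((a + b) ^ c) e ⟩
      (a + b) * ((a + b) ^ c * e)    ≤⟨ *-monoʳ-≤ (a + b) big ⟩
      (a + b) * (b ^ c * (n * o))    ≡⟨ e₄ (a + b) (b ^ c) (n * o) ⟩
      b ^ c * ((a + b) * (n * o))    ≤⟨ *-monoʳ-≤ (b ^ c) scaled ⟩
      b ^ c * (b * (n * o′))         ≡⟨ e₅ b (b ^ c) (n * o′) ⟩
      b * b ^ c * (n * o′)           ∎))
      where
      e₄ : ∀ x y z → x * (y * z) ≡ y * (x * z)
      e₄ = solve-∀
      e₅ : ∀ b B z → B * (b * z) ≡ b * B * z
      e₅ = solve-∀
      e₆ : ∀ B n e → B * (n * (2 * e)) ≡ B * (2 * n) * e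
      e₆ = solve-∀
      -- The count began with `n * o` above `e`, and now `n * o ≤ 2 * n * e`, so the growth since
      -- then is at most `2 * n`.
      short : (a + b) ^ c ≤ b ^ c * (2 * n)
      short = *-cancelʳ-≤ _ _ e (begin
        (a + b) ^ c * e              ≤⟨ big ⟩
        b ^ c * (n * o)              ≤⟨ *-monoʳ-≤ (b ^ c) (*-monoʳ-≤ n o≤2e) ⟩
        b ^ c * (n * (2 * e))        ≡⟨ e₆ (b ^ c) n e ⟩
        b ^ c * (2 * n) * e          ∎)

-- The program

pattern _⊕_ x y = op add x y
pattern _⊖_ x y = op sub x y
pattern _⊛_ x y = op mul x y
infixl 6 _⊕_ _⊖_
infixl 7 _⊛_

reg : ℕ → Expr
reg a = read a (lit 0)

pairᵉ : Expr → Expr → Expr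
pairᵉ x y = (x ⊕ y) ⊛ (x ⊕ y) ⊕ y

-- 0: parameters N, k, a, b with ε = a / b      1: request      2: answer      3: pool
-- 4: number of edges      5, 6: their ends      7: degrees of the left nodes      8: their maximum
-- 9: number g of the current guess      10: the guess o      11: f      12: s      13: q
-- 14: p      15: x      16: w      17: live degrees      18: covered nodes
-- 19, 20: stacks L      21, 22: stacks R      23, 24: stacks A      25-31: temporaries
-- Arrays 17 to 24 are addressed through pair g, so that each guess starts on zeros.
kᵉ : Expr
kᵉ = read 0 (lit 1)

push : (cnt item : ℕ) (key value : Expr) → Cmd
push cnt item key value =
  write 27 (lit 0) (pairᵉ (reg 9) key) ⨾
  write item (pairᵉ (reg 27) (read cnt (reg 27))) value ⨾
  write cnt (reg 27) (lit 1 ⊕ read cnt (reg 27))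

pop : (cnt item : ℕ) (key : Expr) (target : ℕ) → Cmd
pop cnt item key target =
  write 27 (lit 0) (pairᵉ (reg 9) key) ⨾
  write 31 (lit 0) (read cnt (reg 27) ⊖ lit 1) ⨾
  write cnt (reg 27) (reg 31) ⨾
  write target (lit 0) (read item (pairᵉ (reg 27) (reg 31)))

setAlarm : Cmd
setAlarm = push 23 24 (reg 13 ⊕ ((reg 10 ⊖ kᵉ ⊛ reg 28) ⊖ reg 13)) (reg 25)

setDegree : Expr → Cmd
setDegree d =
  write 27 (lit 0) (pairᵉ (reg 9) (reg 25)) ⨾
  write 28 (lit 0) d ⨾
  write 17 (reg 27) (reg 28) ⨾
  setAlarm

popR endR popL cover endL finish popA pick advance load insertLive halt insertEdge : Cmd
popR       = pop 21 22 (reg 16 ⊖ lit 1) 25 ⨾ setDegree (read 17 (reg 27) ⊖ lit 1)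
endR       = write 16 (lit 0) (lit 0)
popL       = pop 19 20 (reg 15 ⊖ lit 1) 26 ⨾ write 27 (lit 0) (pairᵉ (reg 9) (reg 26))
cover      = write 18 (reg 27) (lit 1) ⨾
             write 11 (lit 0) (lit 1 ⊕ reg 11) ⨾
             write 16 (lit 0) (lit 1 ⊕ reg 26)
endL       = write 15 (lit 0) (lit 0)
finish     = write 2 (lit 0) (reg 12) ⨾
             -- Guess `g` owns the `k` pool cells from `g * k` on, so the answer is handed over by
             -- its address, without copying.
             write 2 (lit 1) (reg 9 ⊛ kᵉ) ⨾
             -- The quotient plus 1 strictly exceeds `(1 + ε) o`; the following write takes the
             -- maximum with the largest degree.
             write 29 (lit 0) (lit 1 ⊕ op div ((read 0 (lit 2) ⊕ read 0 (lit 3)) ⊛ reg 10) (read 0 (lit 3))) ⨾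
             write 10 (lit 0) (reg 29 ⊕ (reg 8 ⊖ reg 29)) ⨾
             write 9 (lit 0) (lit 1 ⊕ reg 9) ⨾
             write 11 (lit 0) (lit 0) ⨾
             write 12 (lit 0) (lit 0) ⨾
             write 13 (lit 0) (lit 0) ⨾
             write 14 (lit 0) (lit 0)
popA       = pop 23 24 (reg 13) 25
pick       = write 3 (reg 9 ⊛ kᵉ ⊕ reg 12) (reg 25) ⨾
             write 12 (lit 0) (lit 1 ⊕ reg 12) ⨾
             write 15 (lit 0) (lit 1 ⊕ reg 25)
advance    = write 13 (lit 0) (lit 1 ⊕ reg 13)
load       = write 25 (lit 0) (read 5 (reg 14)) ⨾
             write 26 (lit 0) (read 6 (reg 14)) ⨾
             write 14 (lit 0) (lit 1 ⊕ reg 14) ⨾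
             write 27 (lit 0) (pairᵉ (reg 9) (reg 26))
insertLive = push 19 20 (reg 25) (reg 26) ⨾
             push 21 22 (reg 26) (reg 25) ⨾
             setDegree (lit 1 ⊕ read 17 (reg 27))
halt       = write 30 (lit 0) (lit 0)
insertEdge = write 5 (reg 4) (read 1 (lit 1)) ⨾
             write 6 (reg 4) (read 1 (lit 2)) ⨾
             write 28 (lit 0) (lit 1 ⊕ read 7 (read 1 (lit 1))) ⨾
             write 7 (read 1 (lit 1)) (reg 28) ⨾
             write 8 (lit 0) (reg 8 ⊕ (reg 28 ⊖ reg 8)) ⨾
             write 4 (lit 0) (lit 1 ⊕ reg 4)

-- The nesting of the tests is a priority: removals at `w`, scans at `x`, completion, reminders,
-- advancing `q`, and only then a new edge. Hence at `halt` nothing is pending and no node can be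
-- picked.
process search guess round insertion program : Cmd
process =
  cond (op lt (reg 13) (reg 11)) advance
  (cond (op lt (reg 14) (reg 4)) (load ⨾ cond (read 18 (reg 27)) skip insertLive)
  halt)
search =
  cond (read 23 (pairᵉ (reg 9) (reg 13)))
    (popA ⨾ cond (op lt (kᵉ ⊛ read 17 (pairᵉ (reg 9) (reg 25)) ⊕ reg 11) (reg 10)) skip pick)
  process
guess = cond (op lt (reg 11) (reg 10) ⊛ op lt (reg 12) kᵉ) search finish
round =
  cond (reg 16) (cond (read 21 (pairᵉ (reg 9) (reg 16 ⊖ lit 1))) popR endR)
  (cond (reg 15) (cond (read 19 (pairᵉ (reg 9) (reg 15 ⊖ lit 1)))
                   (popL ⨾ cond (read 18 (reg 27)) skip cover) endL)
  guess)
insertion = cond (op eq (reg 1) (lit 2)) insertEdge skip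
program = cond kᵉ
  (insertion ⨾
   write 30 (lit 0) (lit 1) ⨾
   while (reg 30) round)
  skip

-- Word sizes: every entry of array a is at most Z ^ width a.

nth : List ℕ → ℕ → ℕ
nth []       _       = 5
nth (x ∷ _)  zero    = x
nth (_ ∷ xs) (suc n) = nth xs n

-- Node names get exponent 1 and counters 5; the answer's offset is a product of two such words,
-- hence 10. Array 27 holds values of `pair`, array 29 the rounded quotient for the next guess.
width : ℕ → ℕ
width = nth (5 ∷ 1 ∷ 10 ∷ 1 ∷ 5 ∷ 1 ∷ 1 ∷ 5 ∷ 5 ∷ 5 ∷ 5 ∷ 5 ∷ 5 ∷ 5 ∷ 5 ∷ 2 ∷ 2 ∷ 5 ∷ 5 ∷ 5 ∷ 1 ∷ 5 ∷ 1 ∷ 5 ∷ 1 ∷ 1 ∷ 1 ∷ 20 ∷ 5 ∷ 12 ∷ [])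

-- An exponent for each value, based on `Z ≥ 2`: a sum costs one more factor `Z`, a product adds
-- exponents, and a comparison is at most `Z ^ 0`.
est : Expr → ℕ
est (lit n)    = n
est (read a i) = width a
est (x ⊕ y)    = suc (est x ⊔ est y)
est (x ⊖ y)    = est x
est (x ⊛ y)    = est x + est y
est (op div x y) = est x
est (op lt x y)  = 0
est (op eq x y)  = 0

peak : Expr → ℕ
peak (lit n)       = n
peak (read a i)    = width a ⊔ peak i
peak e@(op o x y)  = est e ⊔ (peak x ⊔ peak y)

-- A bound for loop-free commands; the number of rounds of the loop is bounded separately, through
-- `total`.
maxCost : Cmd → ℕ
maxCost skip          = 1
maxCost (write a i e) = 1 + exprCost i + exprCost e
maxCost (c ⨾ d)       = maxCost c + maxCost d
maxCost (cond b c d)  = 1 + exprCost b + (maxCost c ⊔ maxCost d)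
maxCost (while b c)   = 0

-- Abstract, since unfolding these numerals makes conversion checking expensive.
abstract
  κ : ℕ
  κ = 3 + maxCost round

  round-cost : 3 + maxCost round ≤ κ
  round-cost = ≤-refl

  insertion-cost : ∃[ c ] maxCost insertion ≤ c
  insertion-cost = maxCost insertion , ≤-refl

  degree : ℕ
  -- Large enough for the longest addresses, those of stack entries, which are a `pair` of a `pair`.
  degree = 50

  50≤degree : 50 ≤ degree
  50≤degree = ≤-refl

-- The cost of an update beyond the stored potential: the test of `k`, the insertion, raising the
-- flag, the 9 units that an edge brings, and the halting round with its exit test.
κ₀ κ′ : ℕ
κ₀ = proj₁ insertion-cost
κ′ = 3 + (κ₀ + 3) + (9 * κ + (κ + 3))

-- Array, index and value of each write, latest first.
Writes : Set
Writes = List (ℕ × ℕ × ℕ)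

infixl 5 _◂_
_◂_ : Memory → Writes → Memory
m ◂ []               = m
m ◂ ((a , i , x) ∷ ws) = (m ◂ ws) [ a at i ≔ x ]

pushed : (cnt item key c v : ℕ) → Writes → Writes
pushed cnt item key c v ws = (cnt , key , suc c) ∷ (item , pair key c , v) ∷ (27 , 0 , key) ∷ ws

popped : (cnt target key c v : ℕ) → Writes → Writes
popped cnt target key c v ws = (target , 0 , v) ∷ (cnt , key , c) ∷ (31 , 0 , c) ∷ (27 , 0 , key) ∷ ws

degreeSet : (key d alarm n u : ℕ) → Writes → Writes
degreeSet key d alarm n u ws =
  pushed 23 24 alarm n u ((17 , key , d) ∷ (28 , 0 , d) ∷ (27 , 0 , key) ∷ ws)

div-≤ : ∀ x y → ⟦ div ⟧ x y ≤ x
div-≤ x zero    = z≤n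
div-≤ x (suc y) = m/n≤m x (suc y)

module Words (Z : ℕ) (2≤Z : 2 ≤ Z) where

  instance
    Z≢0 : NonZero Z
    Z≢0 = >-nonZero (≤-trans (s≤s z≤n) 2≤Z)

  B : ℕ
  B = Z ^ degree

  Small : Memory → Set
  Small m = ∀ a i → m a i ≤ Z ^ width a

  n≤Z^n : ∀ n → n ≤ Z ^ n
  n≤Z^n zero    = z≤n
  n≤Z^n (suc n) = begin
    1 + n              ≤⟨ +-mono-≤ (m^n>0 Z n) (n≤Z^n n) ⟩
    Z ^ n + Z ^ n      ≡⟨ cong (Z ^ n +_) (+-identityʳ (Z ^ n)) ⟨
    2 * Z ^ n          ≤⟨ *-monoˡ-≤ (Z ^ n) 2≤Z ⟩
    Z * Z ^ n          ∎
    where open ≤-Reasoning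

  ^-add : ∀ {x y i j} → x ≤ Z ^ i → y ≤ Z ^ j → x + y ≤ Z ^ suc (i ⊔ j)
  ^-add {x} {y} {i} {j} hx hy = begin
    x + y                          ≤⟨ +-mono-≤ (≤-trans hx (^-monoʳ-≤ Z (m≤m⊔n i j))) (≤-trans hy (^-monoʳ-≤ Z (m≤n⊔m i j))) ⟩
    Z ^ (i ⊔ j) + Z ^ (i ⊔ j)      ≡⟨ cong (Z ^ (i ⊔ j) +_) (+-identityʳ _) ⟨
    2 * Z ^ (i ⊔ j)                ≤⟨ *-monoˡ-≤ (Z ^ (i ⊔ j)) 2≤Z ⟩
    Z * Z ^ (i ⊔ j)                ∎
    where open ≤-Reasoning

  eval≤ : ∀ {m} → Small m → ∀ e → eval m e ≤ Z ^ est e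
  eval≤ sm (lit n)    = n≤Z^n n
  eval≤ {m} sm (read a i) = sm a (eval m i)
  eval≤ sm (x ⊕ y)    = ^-add {i = est x} {est y} (eval≤ sm x) (eval≤ sm y)
  eval≤ {m} sm (x ⊖ y) = ≤-trans (m∸n≤m (eval m x) (eval m y)) (eval≤ sm x)
  eval≤ sm (x ⊛ y)    = ≤-trans (*-mono-≤ (eval≤ sm x) (eval≤ sm y)) (≤-reflexive (sym (^-distribˡ-+-* Z (est x) (est y))))
  eval≤ {m} sm (op div x y) = ≤-trans (div-≤ (eval m x) (eval m y)) (eval≤ sm x)
  eval≤ sm (op lt x y)  = bit≤1 _
  eval≤ sm (op eq x y)  = bit≤1 _

  fits : ∀ {m} → Small m → ∀ e → peak e ≤ 50 → Fits B m e
  fits sm (lit n)    pk = ≤-trans (eval≤ sm (lit n)) (^-monoʳ-≤ Z (≤-trans pk 50≤degree))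
  fits sm (read a i) pk = ≤-trans (eval≤ sm (read a i)) (^-monoʳ-≤ Z (≤-trans (m⊔n≤o⇒m≤o (width a) (peak i) pk) 50≤degree))
                        , fits sm i (m⊔n≤o⇒n≤o (width a) (peak i) pk)
  fits sm e@(op o x y) pk =
      ≤-trans (eval≤ sm e) (^-monoʳ-≤ Z (≤-trans (m⊔n≤o⇒m≤o (est e) (peak x ⊔ peak y) pk) 50≤degree))
    , fits sm x (m⊔n≤o⇒m≤o (peak x) (peak y) pk′) , fits sm y (m⊔n≤o⇒n≤o (peak x) (peak y) pk′)
    where
    pk′ : peak x ⊔ peak y ≤ 50
    pk′ = m⊔n≤o⇒n≤o (est e) (peak x ⊔ peak y) pk

  checked : ∀ {m} → Small m → ∀ e {pk : True (peak e ≤? 50)} → Fits B m e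
  checked sm e {pk} = fits sm e (toWitness pk)

  -- Symbolic execution of loop-free commands

  Runs : Cmd → Memory → Memory → Set
  Runs c m m′ = ∃[ t ] (Run B c m m′ t × t ≤ maxCost c)

  Small-write : ∀ {m} a i {x} → Small m → x ≤ Z ^ width a → Small (m [ a at i ≔ x ])
  Small-write {m} a i {x} sm hx a′ j with a ≡ᵇ a′ in same
  ... | false = sm a′ j
  ... | true  with i ≡ᵇ j
  ...   | false = sm a′ j
  ...   | true  = subst (λ b → x ≤ Z ^ width b) (≡ᵇ-true {a} {a′} same) hx

  module Executions (m : Memory) where

    -- Logs of writes over a fixed memory `m` stand for the memories reached, so every value read
    -- reduces to an expression in `m`.
    record Exec (c : Cmd) (ws ws′ : Writes) : Set where
      field
        run : Small (m ◂ ws) → Runs c (m ◂ ws) (m ◂ ws′) × Small (m ◂ ws′)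
    open Exec public

    do-skip : ∀ {ws} → Exec skip ws ws
    do-skip .run sm = (1 , run-skip , ≤-refl) , sm

    -- For writes such as increments, whose estimate would exceed the width; their bound comes from
    -- the invariant. In `set` the bound is decided by computation.
    put : ∀ {a i e I X ws} {pi : True (peak i ≤? 50)} {pe : True (peak e ≤? 50)} →
          eval (m ◂ ws) i ≡ I → eval (m ◂ ws) e ≡ X → X ≤ Z ^ width a → Exec (write a i e) ws ((a , I , X) ∷ ws)
    put {a} {i} {e} {ws = ws} {pi} {pe} refl refl hx .run sm =
      (_ , run-write (checked sm i {pi}) (checked sm e {pe}) , ≤-refl)
      , Small-write a (eval (m ◂ ws) i) sm hx

    set : ∀ {a i e I X ws} {pi : True (peak i ≤? 50)} {pe : True (peak e ≤? 50)} {le : True (est e ≤? width a)} →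
          eval (m ◂ ws) i ≡ I → eval (m ◂ ws) e ≡ X → Exec (write a i e) ws ((a , I , X) ∷ ws)
    set {a} {i} {e} {ws = ws} {pi} {pe} {le} refl refl .run sm =
      put {a} {i} {e} {ws = ws} {pi} {pe} refl refl (≤-trans (eval≤ sm e) (^-monoʳ-≤ Z (toWitness le))) .run sm

    -- Arguments in reverse, for inference to proceed from the last write.
    infixr 4 seq
    seq : ∀ {c d ws ws₁ ws₂} → Exec d ws₁ ws₂ → Exec c ws ws₁ → Exec (c ⨾ d) ws ws₂
    seq y x .run sm with x .run sm
    ... | (t , r , le) , sm₁ with y .run sm₁
    ...   | (t′ , r′ , le′) , sm₂ = (t + t′ , run-seq r r′ , +-mono-≤ le le′) , sm₂

    syntax seq y x = x ▸ y

    on-then : ∀ {b c d ws ws′} {pb : True (peak b ≤? 50)} → eval (m ◂ ws) b ≢ 0 → Exec c ws ws′ →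
              Exec (cond b c d) ws ws′
    on-then {b} {c} {d} {pb = pb} h x .run sm with x .run sm
    ... | (t , r , le) , sm′ =
      (_ , run-then (checked sm b {pb}) h r , +-monoʳ-≤ (1 + exprCost b) (≤-trans le (m≤m⊔n _ (maxCost d)))) , sm′

    on-else : ∀ {b c d ws ws′} {pb : True (peak b ≤? 50)} → eval (m ◂ ws) b ≡ 0 → Exec d ws ws′ →
              Exec (cond b c d) ws ws′
    on-else {b} {c} {d} {pb = pb} h x .run sm with x .run sm
    ... | (t , r , le) , sm′ =
      (_ , run-else (checked sm b {pb}) h r , +-monoʳ-≤ (1 + exprCost b) (≤-trans le (m≤n⊔m (maxCost c) _))) , sm′

    exec-popR : ∀ {kv c u ku d ka} → let g = m 9 0 in suc (m 23 ka) ≤ Z ^ 5 →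
      pair g (m 16 0 ∸ 1) ≡ kv → m 21 kv ∸ 1 ≡ c → m 22 (pair kv c) ≡ u → pair g u ≡ ku →
      m 17 ku ∸ 1 ≡ d → pair g (alarmAt (m 13 0) (m 10 0) (m 0 1) d) ≡ ka →
      Exec popR [] (degreeSet ku d ka (m 23 ka) u (popped 21 25 kv c u []))
    exec-popR h e₁ e₂ e₃ e₄ e₅ e₆ =
      (set refl e₁ ▸ set refl e₂ ▸ set refl refl ▸ set refl e₃) ▸
      set refl e₄ ▸ set refl e₅ ▸ set refl refl ▸ set refl e₆ ▸ set refl refl ▸ put refl refl h

    exec-popL : ∀ {ku c v kv} → let g = m 9 0 in
      pair g (m 15 0 ∸ 1) ≡ ku → m 19 ku ∸ 1 ≡ c → m 20 (pair ku c) ≡ v → pair g v ≡ kv →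
      Exec popL [] ((27 , 0 , kv) ∷ popped 19 26 ku c v [])
    exec-popL e₁ e₂ e₃ e₄ = (set refl e₁ ▸ set refl e₂ ▸ set refl refl ▸ set refl e₃) ▸ set refl e₄

    exec-cover : ∀ {ku c v kv} → suc (m 11 0) ≤ Z ^ 5 →
      Exec cover ((27 , 0 , kv) ∷ popped 19 26 ku c v [])
                 ((16 , 0 , suc v) ∷ (11 , 0 , suc (m 11 0)) ∷ (18 , kv , 1) ∷ (27 , 0 , kv) ∷ popped 19 26 ku c v [])
    exec-cover h = set refl refl ▸ put refl refl h ▸ set refl refl

    exec-finish : ∀ {r o} → suc (m 9 0) ≤ Z ^ 5 → o ≤ Z ^ 5 →
      suc (⟦ div ⟧ ((m 0 2 + m 0 3) * m 10 0) (m 0 3)) ≡ r → r + (m 8 0 ∸ r) ≡ o →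
      Exec finish [] ((14 , 0 , 0) ∷ (13 , 0 , 0) ∷ (12 , 0 , 0) ∷ (11 , 0 , 0) ∷ (9 , 0 , suc (m 9 0)) ∷
                      (10 , 0 , o) ∷ (29 , 0 , r) ∷ (2 , 1 , m 9 0 * m 0 1) ∷ (2 , 0 , m 12 0) ∷ [])
    exec-finish h h′ e₁ e₂ =
      set refl refl ▸ set refl refl ▸ set refl e₁ ▸ put refl e₂ h′ ▸ put refl refl h ▸
      set refl refl ▸ set refl refl ▸ set refl refl ▸ set refl refl

    exec-popA : ∀ {ka c u} → pair (m 9 0) (m 13 0) ≡ ka → m 23 ka ∸ 1 ≡ c → m 24 (pair ka c) ≡ u →
      Exec popA [] (popped 23 25 ka c u [])
    exec-popA e₁ e₂ e₃ = set refl e₁ ▸ set refl e₂ ▸ set refl refl ▸ set refl e₃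

    exec-pick : ∀ {ka c u} → suc (m 12 0) ≤ Z ^ 5 →
      Exec pick (popped 23 25 ka c u [])
                ((15 , 0 , suc u) ∷ (12 , 0 , suc (m 12 0)) ∷ (3 , m 9 0 * m 0 1 + m 12 0 , u) ∷ popped 23 25 ka c u [])
    exec-pick h = set refl refl ▸ put refl refl h ▸ set refl refl

    loaded : (u v kv : ℕ) → Writes
    loaded u v kv = (27 , 0 , kv) ∷ (14 , 0 , suc (m 14 0)) ∷ (26 , 0 , v) ∷ (25 , 0 , u) ∷ []

    exec-load : ∀ {u v kv} → suc (m 14 0) ≤ Z ^ 5 → m 5 (m 14 0) ≡ u → m 6 (m 14 0) ≡ v → pair (m 9 0) v ≡ kv →
      Exec load [] (loaded u v kv)
    exec-load h e₁ e₂ e₃ = set refl e₁ ▸ set refl e₂ ▸ put refl refl h ▸ set refl e₃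

    exec-insertLive : ∀ {u v ku kv d ka} → let g = m 9 0 in
      suc (m 19 ku) ≤ Z ^ 5 → suc (m 21 kv) ≤ Z ^ 5 → d ≤ Z ^ 5 → suc (m 23 ka) ≤ Z ^ 5 →
      pair g u ≡ ku → pair g v ≡ kv → suc (m 17 ku) ≡ d →
      pair g (alarmAt (m 13 0) (m 10 0) (m 0 1) d) ≡ ka →
      Exec insertLive (loaded u v kv)
        (degreeSet ku d ka (m 23 ka) u (pushed 21 22 kv (m 21 kv) u (pushed 19 20 ku (m 19 ku) v (loaded u v kv))))
    exec-insertLive h₁ h₂ h₃ h₄ e₁ e₂ e₃ e₄ =
      (set refl e₁ ▸ set refl refl ▸ put refl refl h₁) ▸ (set refl e₂ ▸ set refl refl ▸ put refl refl h₂) ▸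
      set refl e₁ ▸ put refl e₃ h₃ ▸ set refl refl ▸ set refl e₄ ▸ set refl refl ▸ put refl refl h₄

    exec-insertEdge : ∀ {M u v d x} → d ≤ Z ^ 5 → x ≤ Z ^ 5 → suc M ≤ Z ^ 5 →
      m 4 0 ≡ M → m 1 1 ≡ u → m 1 2 ≡ v → suc (m 7 u) ≡ d → m 8 0 + (d ∸ m 8 0) ≡ x →
      Exec insertEdge []
        ((4 , 0 , suc M) ∷ (8 , 0 , x) ∷ (7 , u , d) ∷ (28 , 0 , d) ∷ (6 , M , v) ∷ (5 , M , u) ∷ [])
    exec-insertEdge h₁ h₂ h₃ refl refl refl e₁ e₂ =
      set refl refl ▸ set refl refl ▸ put refl e₁ h₁ ▸ set refl refl ▸ put refl e₂ h₂ ▸ put refl refl h₃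

-- Memory contents

Degrees : ℕ → (ℕ → ℕ) → List (ℕ × ℕ) → Set
Degrees g deg R = ∀ u → deg (pair g u) ≡ gain (suc u) R

Covers : ℕ → (ℕ → ℕ) → List ℕ → Set
Covers g cov C = ∀ v → cov (pair g v) ≡ mem v C

Degrees-dec : ∀ {g deg R v u us ku d} → Degrees g deg R → sel v R ≡ u ∷ us → pair g u ≡ ku →
              deg ku ∸ 1 ≡ d → Degrees g (upd deg ku d) (del v R) × d ≡ gain (suc u) (del v R)
Degrees-dec {g} {deg} {R} {v} {u} dg top refl refl = main , at-u
  where
  at-u : deg (pair g u) ∸ 1 ≡ gain (suc u) (del v R)
  at-u = cong (_∸ 1) (trans (dg u) (gain-del-same u v R top))
  main : Degrees g (upd deg (pair g u) (deg (pair g u) ∸ 1)) (del v R)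
  main z with u ≟ z
  ... | yes refl = trans (upd-same deg _ _) at-u
  ... | no u≢z   = trans (upd-other deg _ (pair-≢ʳ g u≢z)) (trans (dg z) (gain-del-other v R top u≢z))

Degrees-inc : ∀ {g deg R v u ku d} → Degrees g deg R → pair g u ≡ ku → suc (deg ku) ≡ d →
              Degrees g (upd deg ku d) ((v , u) ∷ R) × d ≡ gain (suc u) ((v , u) ∷ R)
Degrees-inc {g} {deg} {R} {v} {u} dg refl refl = main , at-u
  where
  at-u : suc (deg (pair g u)) ≡ gain (suc u) ((v , u) ∷ R)
  at-u rewrite ≡ᵇ-refl u = cong suc (dg u)
  main : Degrees g (upd deg (pair g u) (suc (deg (pair g u)))) ((v , u) ∷ R)
  main z with u ≟ z
  ... | yes refl = trans (upd-same deg _ _) at-u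
  ... | no u≢z rewrite ≢⇒≡ᵇ u≢z = trans (upd-other deg _ (pair-≢ʳ g u≢z)) (dg z)

Covers-add : ∀ {g cov C v kv} → Covers g cov C → pair g v ≡ kv → Covers g (upd cov kv 1) (v ∷ C)
Covers-add {g} {cov} {C} {v} cv refl z with v ≟ z
... | yes refl rewrite ≡ᵇ-refl v = upd-same cov _ 1
... | no v≢z rewrite ≢⇒≡ᵇ v≢z = trans (upd-other cov 1 (pair-≢ʳ g v≢z)) (cv z)

-- The last cell comes first, which agrees with `S`, where a pick is put in front.
block : (ℕ → ℕ) → ℕ → ℕ → List ℕ
block f base zero    = []
block f base (suc j) = f (base + j) ∷ block f base j

block-upd : ∀ f base n {i} x → base + n ≤ i → block (upd f i x) base n ≡ block f base n
block-upd f base zero    x le = refl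
block-upd f base (suc n) x le = cong₂ _∷_
  (upd-other f x (>⇒≢ below))
  (block-upd f base n x (<⇒≤ below))
  where
  below : base + n < _
  below = ≤-trans (≤-reflexive (sym (+-suc base n))) le

outdegree : ℕ → List (ℕ × ℕ) → ℕ
outdegree u = count (λ e → proj₁ e ≡ᵇ u)

record Edges (G : Graph) (M : ℕ) (eu ev fd : ℕ → ℕ) (md : ℕ) : Set where
  field
    edges≡ : pre (λ i → eu i , ev i) M ≡ edges G
    range  : ∀ {u v} → (u , v) ∈ edges G → u < left G × v < right G
    unique : Unique (edges G)
    out≡   : ∀ u → fd u ≡ outdegree u (edges G)
    out≤   : ∀ u → fd u ≤ md
    out∃   : ∃[ u ] md ≤ fd u

record Params (k a b : ℕ) (par : ℕ → ℕ) : Set where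
  field
    k≡ : par 1 ≡ k
    a≡ : par 2 ≡ a
    b≡ : par 3 ≡ b

record Tables (g : ℕ) (deg cov nL iL nR iR nA iA : ℕ → ℕ) (C : List ℕ) (L R A : List (ℕ × ℕ)) : Set where
  field
    degrees : Degrees g deg R
    covers  : Covers g cov C
    stL     : Stacks nL iL g L
    stR     : Stacks nR iR g R
    stA     : Stacks nA iA g A
    frD     : Fresh deg g
    frC     : Fresh cov g
    frL     : Fresh nL g
    frR     : Fresh nR g
    frA     : Fresh nA g

-- The answer held in memory, with the guess o′ it completes; the current guess o is close to
-- o′ or at most the largest degree.
record Answer (G : Graph) (k a b : ℕ) (ans pool : ℕ → ℕ) (o : ℕ) : Set where
  field
    o′     : ℕ
    C′     : List ℕ
    greedy : Greedy k o′ k (length C′)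
    uniq   : Unique C′
    C⊆     : ∀ {v} → v ∈ C′ → ∃[ u ] (u ∈ block pool (ans 1) (ans 0) × (u , v) ∈ edges G)
    nodes  : ∀ {u} → u ∈ block pool (ans 1) (ans 0) → ∃[ v ] (u , v) ∈ edges G
    size≤k : ans 0 ≤ k
    close  : b * o ≤ (a + b) * o′ + b ⊎ ∃[ u ] o ≤ outdegree u (edges G)

abs : Memory → Ghost → St
abs m gh = st (m 0 1) (m 4 0) (m 10 0) (m 11 0) (m 12 0) (m 13 0) (m 14 0) (m 15 0) (m 16 0)
              (λ i → m 5 i , m 6 i) gh

-- Prefixes of the edge list and degrees

pre-⊆ : ∀ ed {p M} → p ≤ M → ∀ {e} → e ∈ pre ed p → e ∈ pre ed M
pre-⊆ ed {p} {M} p≤M {e} e∈ with m≤n⇒∃[o]m+o≡n p≤M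
... | i , refl = go i
  where
  go : ∀ i → e ∈ pre ed (p + i)
  go zero    = subst (λ n → e ∈ pre ed n) (sym (+-identityʳ p)) e∈
  go (suc i) = subst (λ n → e ∈ pre ed n) (sym (+-suc p i)) (there (go i))

pre-new : ∀ ed {p M} → p < M → Unique (pre ed M) → ed p ∉ pre ed p
pre-new ed {p} {suc M} (s≤s p≤M) (n ∷ u) with m≤n⇒m<n∨m≡n p≤M
... | inj₁ p<M  = pre-new ed p<M u
... | inj₂ refl = λ e → All.lookup n e refl

length-pre : ∀ ed M → length (pre ed M) ≡ M
length-pre ed zero    = refl
length-pre ed (suc M) = cong suc (length-pre ed M)

<ᵇ-suc : ∀ i n → bit (i <ᵇ suc n) ≤ bit (i <ᵇ n) + bit (i ≡ᵇ n)
<ᵇ-suc zero    zero    = ≤-refl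
<ᵇ-suc zero    (suc n) = s≤s z≤n
<ᵇ-suc (suc i) zero    = z≤n
<ᵇ-suc (suc i) (suc n) = <ᵇ-suc i n

outdegree-sum : ∀ n d (E : List (ℕ × ℕ)) → (∀ u → outdegree u E ≤ d) →
                count (λ e → proj₁ e <ᵇ n) E ≤ n * d
outdegree-sum zero    d E le = ≤-reflexive (count≡0 _ E (λ _ → refl))
outdegree-sum (suc n) d E le = begin
  count (λ e → proj₁ e <ᵇ suc n) E                ≤⟨ split E ⟩
  count (λ e → proj₁ e <ᵇ n) E + outdegree n E    ≤⟨ +-mono-≤ (outdegree-sum n d E le) (le n) ⟩
  n * d + d                                       ≡⟨ +-comm (n * d) d ⟩
  d + n * d                                       ∎
  where
  open ≤-Reasoning
  swap : ∀ a b c d → (a + b) + (c + d) ≡ (a + c) + (b + d)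
  swap = solve-∀
  split : ∀ xs → count (λ e → proj₁ e <ᵇ suc n) xs ≤ count (λ e → proj₁ e <ᵇ n) xs + outdegree n xs
  split []             = z≤n
  split ((u , v) ∷ xs) = ≤-trans (+-mono-≤ (<ᵇ-suc u n) (split xs))
    (≤-reflexive (swap (bit (u <ᵇ n)) (bit (u ≡ᵇ n)) (count (λ e → proj₁ e <ᵇ n) xs) (outdegree n xs)))

-- The largest degree is at least the average. For a guess not below the largest degree this bounds
-- the edges, hence its cost.
length≤left*d : ∀ n d (E : List (ℕ × ℕ)) → (∀ {u v} → (u , v) ∈ E → u < n) → (∀ u → outdegree u E ≤ d) →
                length E ≤ n * d
length≤left*d n d E below le = ≤-trans (≤-reflexive (sym (all E below))) (outdegree-sum n d E le)
  where
  <ᵇ-true : ∀ {i j} → i < j → (i <ᵇ j) ≡ true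
  <ᵇ-true {zero}  {suc j} _         = refl
  <ᵇ-true {suc i} {suc j} (s≤s i<j) = <ᵇ-true i<j
  all : ∀ xs → (∀ {u v} → (u , v) ∈ xs → u < n) → count (λ e → proj₁ e <ᵇ n) xs ≡ length xs
  all []             below = refl
  all ((u , v) ∷ xs) below rewrite <ᵇ-true (below (here refl)) = cong suc (all xs (below ∘ there))

lt⇒< : ∀ x y → ⟦ lt ⟧ x y ≢ 0 → x < y
lt⇒< x y h with x <ᵇ y in e
... | true  = <ᵇ⇒< x y (subst T (sym e) _)
... | false = contradiction refl h

lt⇒≥ : ∀ x y → ⟦ lt ⟧ x y ≡ 0 → y ≤ x
lt⇒≥ x y h with x <ᵇ y in e
... | true  = case h of λ ()
... | false = ≮⇒≥ λ x<y → subst T e (<⇒<ᵇ x<y)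

div-eval : ∀ x y .{{_ : NonZero y}} → ⟦ div ⟧ x y ≡ x / y
div-eval x (suc y) = refl

nonZero⇒suc : ∀ {n} → n ≢ 0 → n ≡ suc (n ∸ 1)
nonZero⇒suc {zero}  h = contradiction refl h
nonZero⇒suc {suc n} h = refl

-- Coverage

_∈ᵇ_ : ℕ → List ℕ → Bool
u ∈ᵇ []       = false
u ∈ᵇ (x ∷ xs) = (u ≡ᵇ x) ∨ (u ∈ᵇ xs)

∈⇒∈ᵇ : ∀ {u xs} → u ∈ xs → (u ∈ᵇ xs) ≡ true
∈⇒∈ᵇ {u} (here refl) rewrite ≡ᵇ-refl u = refl
∈⇒∈ᵇ {u} {x ∷ xs} (there u∈) rewrite ∈⇒∈ᵇ u∈ = ∨-zeroʳ (u ≡ᵇ x)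

elements : ∀ {n} → Subset n → List ℕ
elements Vec.[]            = []
elements (outside Vec.∷ p) = map suc (elements p)
elements (inside  Vec.∷ p) = 0 ∷ map suc (elements p)

length-elements : ∀ {n} (p : Subset n) → length (elements p) ≡ ∣ p ∣
length-elements Vec.[]            = refl
length-elements (outside Vec.∷ p) = trans (length-map suc (elements p)) (length-elements p)
length-elements (inside  Vec.∷ p) = cong suc (trans (length-map suc (elements p)) (length-elements p))

∈-elements⁺ : ∀ {n} {x : Fin n} {p} → x ∈ₛ p → toℕ x ∈ elements p
∈-elements⁺ Vec.here = here refl
∈-elements⁺ {p = outside Vec.∷ p} (Vec.there x∈) = ∈-map⁺ suc (∈-elements⁺ x∈)
∈-elements⁺ {p = inside  Vec.∷ p} (Vec.there x∈) = there (∈-map⁺ suc (∈-elements⁺ x∈))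

∈-elements⁻ : ∀ {n i} (p : Subset n) → i ∈ elements p → ∃[ x ] (toℕ x ≡ i × x ∈ₛ p)
∈-elements⁻ (outside Vec.∷ p) i∈ with ∈-map⁻ suc i∈
... | j , j∈ , refl with ∈-elements⁻ p j∈
...   | x , refl , x∈ = Fin.suc x , refl , Vec.there x∈
∈-elements⁻ (inside Vec.∷ p) (here refl) = Fin.zero , refl , Vec.here
∈-elements⁻ (inside Vec.∷ p) (there i∈) with ∈-map⁻ suc i∈
... | j , j∈ , refl with ∈-elements⁻ p j∈
...   | x , refl , x∈ = Fin.suc x , refl , Vec.there x∈

unique-elements : ∀ {n} (p : Subset n) → Unique (elements p)
unique-elements Vec.[]            = []
unique-elements (outside Vec.∷ p) = Unique-map⁺ suc-injective (unique-elements p)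
unique-elements (inside  Vec.∷ p) =
  All-map⁺ (All.tabulate (λ _ ())) ∷ Unique-map⁺ suc-injective (unique-elements p)

module _ (n : ℕ) (xs : List ℕ) where
  open DecMembership _≟_ using (_∈?_)

  ∈-fromList⁺ : ∀ {x : Fin n} → toℕ x ∈ xs → x ∈ₛ fromList n xs
  ∈-fromList⁺ {x} x∈ = lookup⇒[]= x _ (trans (lookup∘tabulate _ x) (dec-true (toℕ x ∈? xs) x∈))

  ∈-fromList⁻ : ∀ {x : Fin n} → x ∈ₛ fromList n xs → toℕ x ∈ xs
  ∈-fromList⁻ {x} x∈ with toℕ x ∈? xs | trans (sym (lookup∘tabulate (λ u → does (toℕ u ∈? xs)) x)) ([]=⇒lookup x∈)
  ... | yes p | _ = p
  ... | no  _ | ()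

  ∣fromList∣≤length : ∣ fromList n xs ∣ ≤ length xs
  ∣fromList∣≤length = ≤-trans (≤-reflexive (sym (length-elements S)))
    (unique-⊆⇒length≤ (unique-elements S) incl)
    where
    S = fromList n xs
    incl : ∀ {i} → i ∈ elements S → i ∈ xs
    incl i∈ with ∈-elements⁻ S i∈
    ... | x , refl , x∈ = ∈-fromList⁻ x∈

coverage-≥ : ∀ G (C xs : List ℕ) → Unique C →
  (∀ {v} → v ∈ C → v < right G × ∃[ u ] (u ∈ xs × u < left G × (u , v) ∈ edges G)) →
  length C ≤ coverage G (fromList (left G) xs)
coverage-≥ G C xs uq h = unique-⊆⇒length≤ uq incl
  where
  S = fromList (left G) xs
  incl : ∀ {v} → v ∈ C → v ∈ filter (covered? G S) (upTo (right G))
  incl {v} v∈ with h v∈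
  ... | v<r , u , u∈ , u<l , e = ∈-filter⁺ (covered? G S) (∈-upTo⁺ v<r)
    ( fromℕ< u<l
    , ∈-fromList⁺ (left G) xs (subst (_∈ xs) (sym (toℕ-fromℕ< u<l)) u∈)
    , subst (λ i → (i , v) ∈ edges G) (sym (toℕ-fromℕ< u<l)) e)

-- Each node covered by `T` is in `C` or is the end of a live edge at a node of `T`.
coverage-≤ : ∀ G (T : Subset (left G)) (C : List ℕ) (R : List (ℕ × ℕ)) →
  (∀ {u v} → (u , v) ∈ edges G → v ∈ C ⊎ (v , u) ∈ R) →
  coverage G T ≤ length C + count (λ e → proj₂ e ∈ᵇ elements T) R
coverage-≤ G T C R h = begin
  coverage G T                               ≤⟨ unique-⊆⇒length≤ (filter⁺ (covered? G T) (upTo⁺ (right G))) incl ⟩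
  length (C ++ map proj₁ (select q R))       ≡⟨ length-++ C ⟩
  length C + length (map proj₁ (select q R)) ≡⟨ cong (length C +_) (trans (length-map proj₁ (select q R)) (length-select q R)) ⟩
  length C + count q R                       ∎
  where
  open ≤-Reasoning
  q : ℕ × ℕ → Bool
  q e = proj₂ e ∈ᵇ elements T
  incl : ∀ {v} → v ∈ filter (covered? G T) (upTo (right G)) → v ∈ C ++ map proj₁ (select q R)
  incl v∈ with proj₂ (∈-filter⁻ (covered? G T) {xs = upTo (right G)} v∈)
  ... | u , u∈ , e with h e
  ...   | inj₁ c = ∈-++⁺ˡ c
  ...   | inj₂ r = ∈-++⁺ʳ C (∈-map⁺ proj₁ (∈-select⁺ q R r (∈⇒∈ᵇ (∈-elements⁺ u∈))))

outdegree-≤ : ∀ u (E : List (ℕ × ℕ)) (C : List ℕ) (R : List (ℕ × ℕ)) → Unique E →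
  (∀ {v} → (u , v) ∈ E → v ∈ C ⊎ (v , u) ∈ R) → outdegree u E ≤ length C + gain (suc u) R
outdegree-≤ u E C R uq h = begin
  outdegree u E                                   ≡⟨ length-select p E ⟨
  length (select p E)                             ≤⟨ unique-⊆⇒length≤ (unique-select p uq) incl ⟩
  length (map (u ,_) C ++ map swap (select q R))  ≡⟨ length-++ (map (u ,_) C) ⟩
  length (map (u ,_) C) + length (map swap (select q R))
                                                  ≡⟨ cong₂ _+_ (length-map (u ,_) C) (trans (length-map swap (select q R)) (length-select q R)) ⟩
  length C + gain (suc u) R                       ∎
  where
  open ≤-Reasoning
  open import Data.Product.Base using (swap)
  p q : ℕ × ℕ → Bool
  p e = proj₁ e ≡ᵇ u
  q e = proj₂ e ≡ᵇ u
  incl : ∀ {e} → e ∈ select p E → e ∈ map (u ,_) C ++ map swap (select q R)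
  incl {u′ , v} e∈ with ∈-select⁻ p E e∈
  ... | e∈E , same with ≡ᵇ-true {u′} {u} same
  ...   | refl with h e∈E
  ...     | inj₁ c = ∈-++⁺ˡ (∈-map⁺ (u ,_) c)
  ...     | inj₂ r = ∈-++⁺ʳ (map (u ,_) C) (∈-map⁺ swap (∈-select⁺ q R r (≡ᵇ-refl u)))

-- A union bound: live edges at `ts` are counted node by node.
gains : ∀ k b R ts → (∀ u → k * gain (suc u) R ≤ b) → k * count (λ e → proj₂ e ∈ᵇ ts) R ≤ length ts * b
gains k b R []       h = ≤-reflexive (trans (cong (k *_) (count≡0 _ R (λ _ → refl))) (*-zeroʳ k))
gains k b R (x ∷ ts) h = begin
  k * count (λ e → proj₂ e ∈ᵇ (x ∷ ts)) R                  ≤⟨ *-monoʳ-≤ k (split R) ⟩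
  k * (gain (suc x) R + count (λ e → proj₂ e ∈ᵇ ts) R)     ≡⟨ *-distribˡ-+ k (gain (suc x) R) _ ⟩
  k * gain (suc x) R + k * count (λ e → proj₂ e ∈ᵇ ts) R   ≤⟨ +-mono-≤ (h x) (gains k b R ts h) ⟩
  b + length ts * b                                         ∎
  where
  open ≤-Reasoning
  bit-∨ : ∀ c d → bit (c ∨ d) ≤ bit c + bit d
  bit-∨ true  d = s≤s z≤n
  bit-∨ false d = ≤-refl
  interchange : ∀ a b c d → (a + b) + (c + d) ≡ (a + c) + (b + d)
  interchange = solve-∀
  split : ∀ xs → count (λ e → proj₂ e ∈ᵇ (x ∷ ts)) xs ≤ gain (suc x) xs + count (λ e → proj₂ e ∈ᵇ ts) xs
  split []             = z≤n
  split ((v , u) ∷ xs) = ≤-trans (+-mono-≤ (bit-∨ (u ≡ᵇ x) (u ∈ᵇ ts)) (split xs))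
    (≤-reflexive (interchange (bit (u ≡ᵇ x)) (bit (u ∈ᵇ ts)) (gain (suc x) xs) _))

opt-< : ∀ k G {o} → 0 < o → (∀ T → ∣ T ∣ ≤ k → coverage G T < o) → opt k G < o
opt-< k G 0<o h = max<v⁺ 0<o (All-map⁺ (All.map (λ {T} → h T) (all-filter (λ S → ∣ S ∣ ≤? k) (subsets (left G)))))

-- k nodes cover at most f nodes and k times the largest gain.
quiet⇒opt< : ∀ k G C R {o} → 0 < k → (∀ {u v} → (u , v) ∈ edges G → v ∈ C ⊎ (v , u) ∈ R) →
  (∀ u → k * gain (suc u) R + length C < o) → opt k G < o
quiet⇒opt< k@(suc _) G C R {o} _ h quiet with m≤n⇒∃[o]m+o≡n (≤-trans (s≤s (m≤n+m (length C) _)) (quiet 0))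
... | r , refl = opt-< k G (s≤s z≤n) bound
  where
  small : ∀ u → k * gain (suc u) R ≤ r
  small u = +-cancelʳ-≤ (suc (length C)) _ _ (≤-trans (≤-reflexive (+-suc _ (length C)))
              (≤-trans (quiet u) (≤-reflexive (+-comm (suc (length C)) r))))
  bound : ∀ T → ∣ T ∣ ≤ k → coverage G T < suc (length C) + r
  bound T T≤k = s≤s (≤-trans (coverage-≤ G T C R h) (+-monoʳ-≤ (length C) (*-cancelˡ-≤ k
    (≤-trans (gains k r R (elements T) small) (*-monoˡ-≤ r (≤-trans (≤-reflexive (length-elements T)) T≤k))))))

-- A single node covers at most `f` plus its gain, and `k ≥ 1`; a node of degree `o` would therefore
-- be loud enough to be picked.
quiet⇒outdegree< : ∀ k G C R {o} u → 0 < k → Unique (edges G) →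
  (∀ {u v} → (u , v) ∈ edges G → v ∈ C ⊎ (v , u) ∈ R) →
  k * gain (suc u) R + length C < o → outdegree u (edges G) < o
quiet⇒outdegree< k@(suc _) G C R u _ uq h quiet = ≤-<-trans (begin
  outdegree u (edges G)            ≤⟨ outdegree-≤ u (edges G) C R uq h ⟩
  length C + gain (suc u) R        ≤⟨ +-monoʳ-≤ (length C) (m≤m+n (gain (suc u) R) _) ⟩
  length C + k * gain (suc u) R    ≡⟨ +-comm (length C) _ ⟩
  k * gain (suc u) R + length C    ∎) quiet
  where open ≤-Reasoning

-- `held` lists the cells upwards and `block` downwards, so they agree only as sets.
∈-block⇒∈-held : ∀ m {u} → u ∈ block (m pool) (m answer 1) (m answer 0) → u ∈ held m
∈-block⇒∈-held m u∈ with index (m answer 0) u∈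
  where
  index : ∀ n {u} → u ∈ block (m pool) (m answer 1) n → ∃[ i ] (i < n × u ≡ m pool (m answer 1 + i))
  index (suc n) (here refl) = n , ≤-refl , refl
  index (suc n) (there u∈)  = let i , i<n , same = index n u∈ in i , m<n⇒m<1+n i<n , same
... | i , i<n , refl = ∈-map⁺ _ (∈-upTo⁺ i<n)

∈-held⇒∈-block : ∀ m {u} → u ∈ held m → u ∈ block (m pool) (m answer 1) (m answer 0)
∈-held⇒∈-block m u∈ with ∈-map⁻ _ u∈
... | i , i∈ , refl = at (m answer 0) (∈-upTo⁻ i∈)
  where
  at : ∀ n {i} → i < n → m pool (m answer 1 + i) ∈ block (m pool) (m answer 1) n
  at (suc n) (s≤s i≤n) with m≤n⇒m<n∨m≡n i≤n
  ... | inj₁ i<n  = there (at n i<n)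
  ... | inj₂ refl = here refl

length-held : ∀ m → length (held m) ≡ m answer 0
length-held m = trans (length-map _ (upTo (m answer 0))) (length-upTo (m answer 0))

-- Rational arithmetic

ℕ→ℚᵘ : ∀ n → toℚᵘ (ℕ→ℚ n) ≃ᵘ mkℚᵘ (ℤ.+ n) 0
ℕ→ℚᵘ n = ℚₚ.toℚᵘ-fromℚᵘ (mkℚᵘ (ℤ.+ n) 0)

ℕ→ℚ-+ : ∀ m n → ℕ→ℚ (m + n) ≡ ℕ→ℚ m ℚ.+ ℕ→ℚ n
ℕ→ℚ-+ m n = ℚₚ.toℚᵘ-injective (begin
  toℚᵘ (ℕ→ℚ (m + n))                        ≈⟨ ℕ→ℚᵘ (m + n) ⟩
  mkℚᵘ (ℤ.+ (m + n)) 0                      ≈⟨ *≡* (cong (ℤ._* ℤ.+ 1) (sym (cong₂ ℤ._+_ (ℤₚ.*-identityʳ (ℤ.+ m)) (ℤₚ.*-identityʳ (ℤ.+ n))))) ⟩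
  mkℚᵘ (ℤ.+ m) 0 ℚᵘ.+ mkℚᵘ (ℤ.+ n) 0        ≈⟨ ℚᵘₚ.+-cong (ℕ→ℚᵘ m) (ℕ→ℚᵘ n) ⟨
  toℚᵘ (ℕ→ℚ m) ℚᵘ.+ toℚᵘ (ℕ→ℚ n)            ≈⟨ ℚₚ.toℚᵘ-homo-+ (ℕ→ℚ m) (ℕ→ℚ n) ⟨
  toℚᵘ (ℕ→ℚ m ℚ.+ ℕ→ℚ n)                    ∎)
  where open import Relation.Binary.Reasoning.Setoid ℚᵘₚ.≃-setoid

ℕ→ℚ-* : ∀ m n → ℕ→ℚ (m * n) ≡ ℕ→ℚ m ℚ.* ℕ→ℚ n
ℕ→ℚ-* m n = ℚₚ.toℚᵘ-injective (begin
  toℚᵘ (ℕ→ℚ (m * n))                        ≈⟨ ℕ→ℚᵘ (m * n) ⟩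
  mkℚᵘ (ℤ.+ (m * n)) 0                      ≈⟨ *≡* (cong (ℤ._* ℤ.+ 1) (ℤₚ.pos-* m n)) ⟩
  mkℚᵘ (ℤ.+ m) 0 ℚᵘ.* mkℚᵘ (ℤ.+ n) 0        ≈⟨ ℚᵘₚ.*-cong (ℕ→ℚᵘ m) (ℕ→ℚᵘ n) ⟨
  toℚᵘ (ℕ→ℚ m) ℚᵘ.* toℚᵘ (ℕ→ℚ n)            ≈⟨ ℚₚ.toℚᵘ-homo-* (ℕ→ℚ m) (ℕ→ℚ n) ⟨
  toℚᵘ (ℕ→ℚ m ℚ.* ℕ→ℚ n)                    ∎)
  where open import Relation.Binary.Reasoning.Setoid ℚᵘₚ.≃-setoid

ℕ→ℚ-mono : ∀ {m n} → m ≤ n → ℕ→ℚ m ℚ.≤ ℕ→ℚ n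
ℕ→ℚ-mono {m} {n} m≤n = ℚₚ.toℚᵘ-cancel-≤
  (ℚᵘₚ.≤-trans (ℚᵘₚ.≤-reflexive (ℕ→ℚᵘ m))
  (ℚᵘₚ.≤-trans (*≤* (ℤₚ.*-monoʳ-≤-nonNeg (ℤ.+ 1) (ℤ.+≤+ m≤n))) (ℚᵘₚ.≤-reflexive (ℚᵘₚ.≃-sym (ℕ→ℚᵘ n)))))

/-*-cancel : ∀ m n .{{_ : NonZero n}} → (ℤ.+ m ℚ./ n) ℚ.* ℕ→ℚ n ≡ ℕ→ℚ m
/-*-cancel m n@(suc n-1) = ℚₚ.toℚᵘ-injective (begin
  toℚᵘ ((ℤ.+ m ℚ./ n) ℚ.* ℕ→ℚ n)             ≈⟨ ℚₚ.toℚᵘ-homo-* (ℤ.+ m ℚ./ n) (ℕ→ℚ n) ⟩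
  toℚᵘ (ℤ.+ m ℚ./ n) ℚᵘ.* toℚᵘ (ℕ→ℚ n)       ≈⟨ ℚᵘₚ.*-cong (ℚₚ.toℚᵘ-fromℚᵘ (mkℚᵘ (ℤ.+ m) n-1)) (ℕ→ℚᵘ n) ⟩
  mkℚᵘ (ℤ.+ m) n-1 ℚᵘ.* mkℚᵘ (ℤ.+ n) 0       ≈⟨ *≡* (trans (ℤₚ.*-identityʳ _) (cong (ℤ.+ m ℤ.*_) (cong ℤ.+_ (sym (*-identityʳ n))))) ⟩
  mkℚᵘ (ℤ.+ m) 0                             ≈⟨ ℕ→ℚᵘ m ⟨
  toℚᵘ (ℕ→ℚ m)                               ∎)
  where open import Relation.Binary.Reasoning.Setoid ℚᵘₚ.≃-setoid

numerator : ℚ → ℕ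
numerator ε = ℤ.∣ ↥ ε ∣

numerator≢0 : ∀ ε .{{_ : Positive ε}} → NonZero (numerator ε)
numerator≢0 (mkℚ ℤ.+[1+ a ] b c) = _

ε*↧≡↥ : ∀ ε .{{_ : Positive ε}} → ε ℚ.* ℕ→ℚ (↧ₙ ε) ≡ ℕ→ℚ (numerator ε)
ε*↧≡↥ ε@(mkℚ ℤ.+[1+ a ] b c) =
  trans (cong (ℚ._* ℕ→ℚ (suc b)) (sym (ℚₚ.↥p/↧p≡p ε))) (/-*-cancel (suc a) (suc b))

ℕ→ℚ-pos : ∀ n .{{_ : NonZero n}} → Positive (ℕ→ℚ n)
ℕ→ℚ-pos n = ℚₚ.normalize-pos n 1

p≤s+t⇒p-t≤s : ∀ {p s t} → p ℚ.≤ s ℚ.+ t → p ℚ.- t ℚ.≤ s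
p≤s+t⇒p-t≤s {p} {s} {t} le = begin
  p ℚ.- t            ≤⟨ ℚₚ.+-monoˡ-≤ (ℚ.- t) le ⟩
  s ℚ.+ t ℚ.- t      ≡⟨ solve 2 (λ s t → s :+ t :- t := s) refl s t ⟩
  s                  ∎
  where
  open ℚₚ.≤-Reasoning
  open +-*-Solver

-- From `m = k` on the inequality holds even without `δ`, since `(1 - 1/k)ᵏ` is at most the `m`-th
-- approximation of `1/e`.
Greedy⇒AtLeast : ∀ {k o F x v} ε .{{_ : Positive ε}} → 0 < k → Greedy k o k F → F ≤ x →
  ↧ₙ ε * v ≤ (numerator ε + ↧ₙ ε) * o → AtLeast[1-1/e- ε ] x v
Greedy⇒AtLeast {k} {o} {F} {x} {v} ε 0<k gr F≤x near δ = k , approx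
  where
  a b : ℕ
  a = numerator ε
  b = ↧ₙ ε
  approx : ∀ m → k ≤ m → (1ℚ ℚ.- 1/e≈ m ℚ.- ε) ℚ.* ℕ→ℚ v ℚ.≤ ℕ→ℚ x ℚ.+ δ
  approx m k≤m = begin
    (1ℚ ℚ.- q ℚ.- ε) ℚ.* V    ≤⟨ ℚₚ.*-cancelʳ-≤-pos (ℕ→ℚ (b * Y)) {{ℕ→ℚ-pos (b * Y)}} scaled ⟩
    ℕ→ℚ x                      ≡⟨ ℚₚ.+-identityʳ (ℕ→ℚ x) ⟨
    ℕ→ℚ x ℚ.+ 0ℚ               ≤⟨ ℚₚ.+-monoʳ-≤ (ℕ→ℚ x) (ℚₚ.nonNegative⁻¹ δ {{ℚₚ.pos⇒nonNeg δ}}) ⟩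
    ℕ→ℚ x ℚ.+ δ                ∎
    where
    open ℚₚ.≤-Reasoning
    open +-*-Solver
    X Y : ℕ
    X = m ^ m
    Y = suc m ^ m
    instance
      Y≢0 : NonZero Y
      Y≢0 = m^n≢0 (suc m) m
      bY≢0 : NonZero (b * Y)
      bY≢0 = m*n≢0 b Y
    q V : ℚ
    q = 1/e≈ m
    V = ℕ→ℚ v
    whole : b * Y * v ≤ b * Y * x + (b * X + a * Y) * v
    whole = ≤-trans
      (cover-ratio a b X Y F o v (Greedy-limit m 0<k (m≤n⇒m≤1+n k≤m) gr) near (^-monoˡ-≤ m (n≤1+n m)))
      (+-monoˡ-≤ _ (*-monoʳ-≤ (b * Y) F≤x))
    ℚ-whole : ℕ→ℚ b ℚ.* ℕ→ℚ Y ℚ.* V ℚ.≤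
              ℕ→ℚ b ℚ.* ℕ→ℚ Y ℚ.* ℕ→ℚ x ℚ.+ (ℕ→ℚ b ℚ.* ℕ→ℚ X ℚ.+ ℕ→ℚ a ℚ.* ℕ→ℚ Y) ℚ.* V
    ℚ-whole = subst₂ ℚ._≤_
      (trans (ℕ→ℚ-* (b * Y) v) (cong (ℚ._* V) (ℕ→ℚ-* b Y)))
      (trans (ℕ→ℚ-+ (b * Y * x) _) (cong₂ ℚ._+_
        (trans (ℕ→ℚ-* (b * Y) x) (cong (ℚ._* ℕ→ℚ x) (ℕ→ℚ-* b Y)))
        (trans (ℕ→ℚ-* (b * X + a * Y) v) (cong (ℚ._* V)
          (trans (ℕ→ℚ-+ (b * X) (a * Y)) (cong₂ ℚ._+_ (ℕ→ℚ-* b X) (ℕ→ℚ-* a Y)))))))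
      (ℕ→ℚ-mono whole)
    scaled : (1ℚ ℚ.- q ℚ.- ε) ℚ.* V ℚ.* ℕ→ℚ (b * Y) ℚ.≤ ℕ→ℚ x ℚ.* ℕ→ℚ (b * Y)
    scaled = begin
      (1ℚ ℚ.- q ℚ.- ε) ℚ.* V ℚ.* ℕ→ℚ (b * Y)
        ≡⟨ cong ((1ℚ ℚ.- q ℚ.- ε) ℚ.* V ℚ.*_) (ℕ→ℚ-* b Y) ⟩
      (1ℚ ℚ.- q ℚ.- ε) ℚ.* V ℚ.* (ℕ→ℚ b ℚ.* ℕ→ℚ Y)
        ≡⟨ solve 5 (λ q ε V b Y → (con 1ℚ :- q :- ε) :* V :* (b :* Y)
                      := b :* Y :* V :- (b :* (q :* Y) :+ ε :* b :* Y) :* V) refl q ε V (ℕ→ℚ b) (ℕ→ℚ Y) ⟩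
      ℕ→ℚ b ℚ.* ℕ→ℚ Y ℚ.* V ℚ.- (ℕ→ℚ b ℚ.* (q ℚ.* ℕ→ℚ Y) ℚ.+ ε ℚ.* ℕ→ℚ b ℚ.* ℕ→ℚ Y) ℚ.* V
        ≡⟨ cong₂ (λ i j → ℕ→ℚ b ℚ.* ℕ→ℚ Y ℚ.* V ℚ.- (ℕ→ℚ b ℚ.* i ℚ.+ j ℚ.* ℕ→ℚ Y) ℚ.* V)
                 (/-*-cancel X Y) (ε*↧≡↥ ε) ⟩
      ℕ→ℚ b ℚ.* ℕ→ℚ Y ℚ.* V ℚ.- (ℕ→ℚ b ℚ.* ℕ→ℚ X ℚ.+ ℕ→ℚ a ℚ.* ℕ→ℚ Y) ℚ.* V
        ≤⟨ p≤s+t⇒p-t≤s ℚ-whole ⟩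
      ℕ→ℚ b ℚ.* ℕ→ℚ Y ℚ.* ℕ→ℚ x
        ≡⟨ cong (ℚ._* ℕ→ℚ x) (ℕ→ℚ-* b Y) ⟨
      ℕ→ℚ (b * Y) ℚ.* ℕ→ℚ x
        ≡⟨ ℚₚ.*-comm (ℕ→ℚ (b * Y)) (ℕ→ℚ x) ⟩
      ℕ→ℚ x ℚ.* ℕ→ℚ (b * Y)  ∎

AtLeast-0 : ∀ ε x → AtLeast[1-1/e- ε ] x 0
AtLeast-0 ε x δ = 0 , λ m _ → begin
  (1ℚ ℚ.- 1/e≈ m ℚ.- ε) ℚ.* 0ℚ    ≡⟨ ℚₚ.*-zeroʳ (1ℚ ℚ.- 1/e≈ m ℚ.- ε) ⟩
  0ℚ                               ≤⟨ ℚₚ.+-mono-≤ (ℕ→ℚ-mono {0} {x} z≤n) (ℚₚ.nonNegative⁻¹ δ {{ℚₚ.pos⇒nonNeg δ}}) ⟩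
  ℕ→ℚ x ℚ.+ δ                      ∎
  where open ℚₚ.≤-Reasoning

-- An integer between 1/ε and 1/ε + 1.
recip⁺ : ℚ → ℕ
recip⁺ ε@(mkℚ ℤ.+[1+ a ] b c) = suc (suc b / suc a)
recip⁺ _                      = 1

↧≤recip⁺*↥ : ∀ ε .{{_ : Positive ε}} → ↧ₙ ε ≤ recip⁺ ε * numerator ε
↧≤recip⁺*↥ ε@(mkℚ ℤ.+[1+ a ] b c) = begin
  suc b                                  ≡⟨ m≡m%n+[m/n]*n (suc b) (suc a) ⟩
  suc b % suc a + suc b / suc a * suc a  ≤⟨ +-monoˡ-≤ (suc b / suc a * suc a) (<⇒≤ (m%n<n (suc b) (suc a))) ⟩
  suc a + suc b / suc a * suc a          ∎
  where
  open ≤-Reasoning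

recip⁺*↥≤ : ∀ ε .{{_ : Positive ε}} → recip⁺ ε * numerator ε ≤ numerator ε + ↧ₙ ε
recip⁺*↥≤ ε@(mkℚ ℤ.+[1+ a ] b c) = +-monoʳ-≤ (suc a) (m/n*n≤m (suc b) (suc a))

-- `recip⁺ ε ≤ 1/ε + 1`, and both summands are at most the maximum of 1 and `1/ε`.
recip⁺≤ : ∀ ε .{{_ : Positive ε}} → ℕ→ℚ (recip⁺ ε) ℚ.≤ ℕ→ℚ 2 ℚ.* (1ℚ ℚ.⊔ (ℚ.1/ ε) {{ℚₚ.pos⇒nonZero ε}})
recip⁺≤ ε = begin
  d                          ≡⟨ solve 1 (λ d → d := con 1ℚ :* d) refl d ⟩
  1ℚ ℚ.* d                   ≡⟨ cong (ℚ._* d) (ℚₚ.*-inverseˡ ε) ⟨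
  i ℚ.* ε ℚ.* d              ≡⟨ ℚₚ.*-assoc i ε d ⟩
  i ℚ.* (ε ℚ.* d)            ≤⟨ ℚₚ.*-monoˡ-≤-nonNeg i {{ℚₚ.pos⇒nonNeg i {{i-pos}}}} εd≤ ⟩
  i ℚ.* (ε ℚ.+ 1ℚ)           ≡⟨ solve 2 (λ i ε → i :* (ε :+ con 1ℚ) := i :* ε :+ i) refl i ε ⟩
  i ℚ.* ε ℚ.+ i              ≡⟨ cong (ℚ._+ i) (ℚₚ.*-inverseˡ ε) ⟩
  1ℚ ℚ.+ i                   ≤⟨ ℚₚ.+-mono-≤ (ℚₚ.p≤p⊔q 1ℚ i) (ℚₚ.p≤q⊔p 1ℚ i) ⟩
  u ℚ.+ u                    ≡⟨ solve 1 (λ u → u :+ u := (con 1ℚ :+ con 1ℚ) :* u) refl u ⟩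
  ℕ→ℚ 2 ℚ.* u                ∎
  where
  open ℚₚ.≤-Reasoning
  open +-*-Solver
  instance
    ε≢0 = ℚₚ.pos⇒nonZero ε
  d i u : ℚ
  d = ℕ→ℚ (recip⁺ ε)
  i = ℚ.1/ ε
  u = 1ℚ ℚ.⊔ i
  i-pos : Positive i
  i-pos = ℚₚ.1/pos⇒pos ε
  εd≤ : ε ℚ.* d ℚ.≤ ε ℚ.+ 1ℚ
  εd≤ = ℚₚ.*-cancelʳ-≤-pos (ℕ→ℚ (↧ₙ ε)) {{ℕ→ℚ-pos (↧ₙ ε)}} (begin
    ε ℚ.* d ℚ.* b                   ≡⟨ solve 3 (λ ε d b → ε :* d :* b := d :* (ε :* b)) refl ε d b ⟩
    d ℚ.* (ε ℚ.* b)                 ≡⟨ cong (d ℚ.*_) (ε*↧≡↥ ε) ⟩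
    d ℚ.* ℕ→ℚ (numerator ε)         ≡⟨ ℕ→ℚ-* (recip⁺ ε) (numerator ε) ⟨
    ℕ→ℚ (recip⁺ ε * numerator ε)      ≤⟨ ℕ→ℚ-mono (recip⁺*↥≤ ε) ⟩
    ℕ→ℚ (numerator ε + ↧ₙ ε)        ≡⟨ ℕ→ℚ-+ (numerator ε) (↧ₙ ε) ⟩
    ℕ→ℚ (numerator ε) ℚ.+ b         ≡⟨ cong (ℚ._+ b) (ε*↧≡↥ ε) ⟨
    ε ℚ.* b ℚ.+ b                   ≡⟨ solve 2 (λ ε b → ε :* b :+ b := (ε :+ con 1ℚ) :* b) refl ε b ⟩
    (ε ℚ.+ 1ℚ) ℚ.* b                ∎)
    where
    b : ℚ
    b = ℕ→ℚ (↧ₙ ε)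

-- Executions of the loop body

m+[n∸m]≡m⊔n : ∀ m n → m + (n ∸ m) ≡ m ⊔ n
m+[n∸m]≡m⊔n zero    n       = refl
m+[n∸m]≡m⊔n (suc m) zero    = cong suc (+-identityʳ m)
m+[n∸m]≡m⊔n (suc m) (suc n) = cong suc (m+[n∸m]≡m⊔n m n)

m<n*[1+m/n] : ∀ m n .{{_ : NonZero n}} → m < n * suc (m / n)
m<n*[1+m/n] m n = begin-strict
  m                    ≡⟨ m≡m%n+[m/n]*n m n ⟩
  m % n + m / n * n    <⟨ +-monoˡ-< (m / n * n) (m%n<n m n) ⟩
  n + m / n * n        ≡⟨ *-comm (suc (m / n)) n ⟩
  n * suc (m / n)      ∎
  where open ≤-Reasoning

module Machine (k a b Z n e D ℓ : ℕ) {{_ : NonZero k}} {{_ : NonZero a}} {{_ : NonZero b}} {{_ : NonZero e}}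
               (b≤Da : b ≤ D * a) (2n<2^ℓ : 2 * n < 2 ^ ℓ)
               (2≤Z : 2 ≤ Z) (k≤Z : k ≤ Z) (a+b≤Z : a + b ≤ Z) where

  open Words Z 2≤Z public
  open Amortise a b n e D ℓ b≤Da 2n<2^ℓ public

  -- `region` keeps the answer clear of the block being filled. `g≤o` bounds the number of guesses
  -- by their value, as each guess exceeds the last; it keeps `g` within a word.
  record Good (G : Graph) (m : Memory) (gh : Ghost) (t : ℕ) : Set where
    open Ghost gh
    field
      paramsᵐ  : Params k a b (m 0)
      edgesᵐ  : Edges G (m 4 0) (m 5) (m 6) (m 7) (m 8 0)
      inv     : Inv (abs m gh)
      tables  : Tables (m 9 0) (m 17) (m 18) (m 19) (m 20) (m 21) (m 22) (m 23) (m 24) C L R A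
      block≡  : block (m 3) (m 9 0 * m 0 1) (m 12 0) ≡ S
      region  : m 2 1 + m 2 0 ≤ m 9 0 * m 0 1
      ansᵐ    : Answer G k a b (m 2) (m 3) (m 10 0)
      g≤o     : m 9 0 ≤ m 10 0
      workᵐ   : Work (m 10 0) t

  -- The second summand pays for processing all edges again whenever the guess changes.
  total : Memory → Ghost → ℕ → ℕ
  total m gh t = energy (abs m gh) + 9 * (bound ∸ t)

  -- The 16 is `2 ^ 4`, absorbed by four factors `Z`; it leaves room for one more than the bound
  -- `9 * Z` on the stacks.
  small5 : ∀ {x} → x ≤ 16 * Z → x ≤ Z ^ 5
  small5 {x} le = begin
    x            ≤⟨ le ⟩
    16 * Z       ≤⟨ *-monoˡ-≤ Z (^-monoˡ-≤ 4 2≤Z) ⟩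
    Z ^ 4 * Z    ≡⟨ *-comm (Z ^ 4) Z ⟩
    Z ^ 5        ∎
    where open ≤-Reasoning

  1≤Z : 1 ≤ Z
  1≤Z = ≤-trans (s≤s z≤n) 2≤Z

  grow5 : ∀ {x} → x ≤ 9 * Z → suc x ≤ Z ^ 5
  grow5 {x} le = small5 (begin
    1 + x             ≤⟨ +-mono-≤ 1≤Z le ⟩
    Z + 9 * Z         ≤⟨ m≤m+n _ (6 * Z) ⟩
    Z + 9 * Z + 6 * Z ≡⟨ e₁ Z ⟩
    16 * Z            ∎)
    where
    open ≤-Reasoning
    e₁ : ∀ z → z + 9 * z + 6 * z ≡ 16 * z
    e₁ = solve-∀

  record Quiet (m : Memory) (A : List (ℕ × ℕ)) : Set where
    field
      w≡0 : m 16 0 ≡ 0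
      x≡0 : m 15 0 ≡ 0
      f<o : m 11 0 < m 10 0
      q≡f : m 13 0 ≡ m 11 0
      p≡M : m 14 0 ≡ m 4 0
      A∅  : sel (m 13 0) A ≡ []

  module Step (G : Graph) (G<n : left G < n) (E<e : length (edges G) < e) (E≤Z : length (edges G) ≤ Z)
              (m : Memory) (C S : List ℕ) (L R A : List (ℕ × ℕ)) (t : ℕ)
              (good : Good G m (ghost C S L R A) t) (small : Small m) where

    open Executions m
    open Good good
    open Inv inv
    open Tables tables

    gh : Ghost
    gh = ghost C S L R A

    g : ℕ
    g = m 9 0

    record Adv (c : Cmd) : Set where
      constructor adv
      field
        ws    : Writes
        gh′   : Ghost
        t′    : ℕ
        exec  : Exec c [] ws
        good′ : Good G (m ◂ ws) gh′ t′
        flag  : (m ◂ ws) 30 0 ≡ m 30 0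
        below : total (m ◂ ws) gh′ t′ < total m gh t

    via : ∀ {c d} → (∀ {ws} → Exec c [] ws → Exec d [] ws) → Adv c → Adv d
    via f (adv ws gh′ t′ x gd fl be) = adv ws gh′ t′ (f x) gd fl be

    M≡ : m 4 0 ≡ length (edges G)
    M≡ = trans (sym (length-pre _ (m 4 0))) (cong length (Edges.edges≡ edgesᵐ))

    M≤Z : m 4 0 ≤ Z
    M≤Z = ≤-trans (≤-reflexive M≡) E≤Z

    p≤Z : m 14 0 ≤ Z
    p≤Z = ≤-trans p≤M M≤Z

    weight≤9Z : weight (abs m gh) ≤ 9 * Z
    weight≤9Z = ≤-trans weight≤ (*-monoʳ-≤ 9 p≤Z)

    L≤ : length L ≤ 9 * Z
    L≤ = ≤-trans (≤-trans (m≤n+m (length L) (m 11 0)) f+L≤p) (≤-trans p≤Z (m≤m+n Z _))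

    R≤ : length R ≤ 9 * Z
    R≤ = begin
      length R                                                  ≤⟨ m≤m+n (length R) _ ⟩
      3 * length R                                              ≤⟨ m≤n+m (3 * length R) (3 * length L) ⟩
      3 * length L + 3 * length R                               ≤⟨ m≤m+n _ (2 * length A) ⟩
      3 * length L + 3 * length R + 2 * length A                ≤⟨ m≤m+n _ (sg (m 15 0)) ⟩
      3 * length L + 3 * length R + 2 * length A + sg (m 15 0)  ≤⟨ m≤m+n _ (sg (m 16 0)) ⟩
      _                                                         ≤⟨ m≤m+n _ (m 11 0 ∸ m 13 0) ⟩
      weight (abs m gh)                                         ≤⟨ weight≤9Z ⟩
      9 * Z                                                     ∎
      where open ≤-Reasoning

    A≤ : length A ≤ 9 * Z
    A≤ = begin
      length A                                                  ≤⟨ m≤m+n (length A) _ ⟩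
      2 * length A                                              ≤⟨ m≤n+m (2 * length A) (3 * length L + 3 * length R) ⟩
      3 * length L + 3 * length R + 2 * length A                ≤⟨ m≤m+n _ (sg (m 15 0)) ⟩
      3 * length L + 3 * length R + 2 * length A + sg (m 15 0)  ≤⟨ m≤m+n _ (sg (m 16 0)) ⟩
      _                                                         ≤⟨ m≤m+n _ (m 11 0 ∸ m 13 0) ⟩
      weight (abs m gh)                                         ≤⟨ weight≤9Z ⟩
      9 * Z                                                     ∎
      where open ≤-Reasoning

    f≤Z : m 11 0 ≤ Z
    f≤Z = ≤-trans (≤-trans (m≤m+n (m 11 0) (length L)) f+L≤p) p≤Z

    Z≤9Z : ∀ {x} → x ≤ Z → x ≤ 9 * Z
    Z≤9Z le = ≤-trans le (m≤m+n Z _)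

    roomL : ∀ {x key} → pair g x ≡ key → suc (m 19 key) ≤ Z ^ 5
    roomL {x} refl = grow5 (≤-trans (Stacks-size (m 19) (m 20) g L x stL) L≤)

    roomR : ∀ {x key} → pair g x ≡ key → suc (m 21 key) ≤ Z ^ 5
    roomR {x} refl = grow5 (≤-trans (Stacks-size (m 21) (m 22) g R x stR) R≤)

    roomA : ∀ {x key} → pair g x ≡ key → suc (m 23 key) ≤ Z ^ 5
    roomA {x} refl = grow5 (≤-trans (Stacks-size (m 23) (m 24) g A x stA) A≤)

    roomD : ∀ {u key d} → pair g u ≡ key → suc (m 17 key) ≡ d → d ≤ Z ^ 5
    roomD {u} refl refl = grow5 (≤-trans (≤-reflexive (degrees u)) (≤-trans (count≤length _ R) R≤))

    adv-popR : m 16 0 ≢ 0 → m 21 (pair g (m 16 0 ∸ 1)) ≢ 0 → Adv popR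
    -- Addresses and values read become variables tied by equations, which keeps the log of writes
    -- readable to unification.
    adv-popR w≢0 n≢0 = go refl refl refl refl refl refl
      where
      v : ℕ
      v = m 16 0 ∸ 1
      go : ∀ {kv c u ku d ka} → pair g v ≡ kv → m 21 kv ∸ 1 ≡ c → m 22 (pair kv c) ≡ u → pair g u ≡ ku →
           m 17 ku ∸ 1 ≡ d → pair g (alarmAt (m 13 0) (m 10 0) (m 0 1) d) ≡ ka → Adv popR
      go {kv} {c} {u} {ku} {d} {ka} e₁ e₂ e₃ e₄ e₅ e₆ = adv _
        (ghost C S L (del v R) ((alarmAt (m 13 0) (m 10 0) (m 0 1) d , u) ∷ A)) t
        (exec-popR (roomA e₆) e₁ e₂ e₃ e₄ e₅ e₆)
        (record
          { paramsᵐ = paramsᵐ ; edgesᵐ = edgesᵐ ; inv = proj₁ step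
          ; tables = record
            { degrees = proj₁ dec ; covers = covers ; stL = stL
            ; stR = Stacks-pop (m 21) (m 22) g R v stR e₁ n≢0′ e₂
            ; stA = Stacks-push (m 23) (m 24) g A _ u e₆ stA
            ; frD = Fresh-upd (m 17) g u d e₄ frD ; frC = frC ; frL = frL
            ; frR = Fresh-upd (m 21) g v c e₁ frR ; frA = Fresh-upd (m 23) g _ _ e₆ frA }
          ; block≡ = block≡ ; region = region ; ansᵐ = ansᵐ ; g≤o = g≤o ; workᵐ = workᵐ })
        refl (+-monoˡ-< _ (proj₂ step))
        where
        n≢0′ : m 21 kv ≢ 0
        n≢0′ = subst (λ i → m 21 i ≢ 0) e₁ n≢0
        top = Stacks-top (m 21) (m 22) g R v stR e₁ n≢0′ e₂ e₃
        dec = Degrees-dec {g} {m 17} {R} {v} degrees (proj₂ top) e₄ e₅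
        step = step-popR _ _ _ _ _ _ _ _ _ _ C S L R A v (nonZero⇒suc w≢0) inv (proj₂ top) (proj₂ dec)

    adv-endR : m 16 0 ≢ 0 → m 21 (pair g (m 16 0 ∸ 1)) ≡ 0 → Adv endR
    adv-endR w≢0 n≡0 = adv ((16 , 0 , 0) ∷ []) gh t (set refl refl)
      (record { paramsᵐ = paramsᵐ ; edgesᵐ = edgesᵐ ; inv = proj₁ step ; tables = record { Tables tables }
              ; block≡ = block≡ ; region = region ; ansᵐ = ansᵐ ; g≤o = g≤o ; workᵐ = workᵐ })
      refl (+-monoˡ-< _ (proj₂ step))
      where
      step = step-endR _ _ _ _ _ _ _ _ _ _ C S L R A (m 16 0 ∸ 1) (nonZero⇒suc w≢0) inv
               (Stacks-empty (m 21) (m 22) g R _ stR n≡0)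

    adv-popL : m 16 0 ≡ 0 → m 15 0 ≢ 0 → m 19 (pair g (m 15 0 ∸ 1)) ≢ 0 →
               Adv (popL ⨾ cond (read 18 (reg 27)) skip cover)
    adv-popL w≡0 x≢0 n≢0 = go refl refl refl refl
      where
      u : ℕ
      u = m 15 0 ∸ 1
      go : ∀ {ku c v kv} → pair g u ≡ ku → m 19 ku ∸ 1 ≡ c → m 20 (pair ku c) ≡ v → pair g v ≡ kv →
           Adv (popL ⨾ cond (read 18 (reg 27)) skip cover)
      go {ku} {c} {v} {kv} e₁ e₂ e₃ e₄ with m 18 kv ≟ 0
      ... | no c≢0 = adv _ (ghost C S (del u L) R A) t
        (exec-popL e₁ e₂ e₃ e₄ ▸ on-then c≢0 do-skip)
        (record
          { paramsᵐ = paramsᵐ ; edgesᵐ = edgesᵐ ; inv = proj₁ step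
          ; tables = record
            { degrees = degrees ; covers = covers ; stL = Stacks-pop (m 19) (m 20) g L u stL e₁ n≢0′ e₂
            ; stR = stR ; stA = stA ; frD = frD ; frC = frC
            ; frL = Fresh-upd (m 19) g u c e₁ frL ; frR = frR ; frA = frA }
          ; block≡ = block≡ ; region = region ; ansᵐ = ansᵐ ; g≤o = g≤o ; workᵐ = workᵐ })
        refl (+-monoˡ-< _ (proj₂ step))
        where
        n≢0′ : m 19 ku ≢ 0
        n≢0′ = subst (λ i → m 19 i ≢ 0) e₁ n≢0
        v∈C : v ∈ C
        v∈C = mem≢0⇒∈ v C λ z → c≢0 (trans (cong (m 18) (sym e₄)) (trans (covers v) z))
        top = Stacks-top (m 19) (m 20) g L u stL e₁ n≢0′ e₂ e₃
        step = step-popL _ _ _ _ _ _ _ _ _ _ C S L R A u w≡0 (nonZero⇒suc x≢0) inv (proj₂ top) v∈C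
      ... | yes c≡0 = adv _ (ghost (v ∷ C) S (del u L) R A) t
        (exec-popL e₁ e₂ e₃ e₄ ▸ on-else c≡0 (exec-cover (grow5 (Z≤9Z f≤Z))))
        (record
          { paramsᵐ = paramsᵐ ; edgesᵐ = edgesᵐ ; inv = proj₁ step
          ; tables = record
            { degrees = degrees ; covers = Covers-add {g} {m 18} {C} {v} covers e₄
            ; stL = Stacks-pop (m 19) (m 20) g L u stL e₁ n≢0′ e₂
            ; stR = stR ; stA = stA ; frD = frD ; frC = Fresh-upd (m 18) g v 1 e₄ frC
            ; frL = Fresh-upd (m 19) g u c e₁ frL ; frR = frR ; frA = frA }
          ; block≡ = block≡ ; region = region ; ansᵐ = ansᵐ ; g≤o = g≤o ; workᵐ = workᵐ })
        refl (+-monoˡ-< _ (proj₂ step))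
        where
        n≢0′ : m 19 ku ≢ 0
        n≢0′ = subst (λ i → m 19 i ≢ 0) e₁ n≢0
        v∉C : v ∉ C
        v∉C = mem≡0⇒∉ v C (trans (sym (covers v)) (trans (cong (m 18) e₄) c≡0))
        top = Stacks-top (m 19) (m 20) g L u stL e₁ n≢0′ e₂ e₃
        step = step-cover _ _ _ _ _ _ _ _ _ _ C S L R A u w≡0 (nonZero⇒suc x≢0) inv (proj₂ top) v∉C

    adv-endL : m 16 0 ≡ 0 → m 15 0 ≢ 0 → m 19 (pair g (m 15 0 ∸ 1)) ≡ 0 → Adv endL
    adv-endL w≡0 x≢0 n≡0 = adv ((15 , 0 , 0) ∷ []) gh t (set refl refl)
      (record { paramsᵐ = paramsᵐ ; edgesᵐ = edgesᵐ ; inv = proj₁ step ; tables = record { Tables tables }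
              ; block≡ = block≡ ; region = region ; ansᵐ = ansᵐ ; g≤o = g≤o ; workᵐ = workᵐ })
      refl (+-monoˡ-< _ (proj₂ step))
      where
      step = step-endL _ _ _ _ _ _ _ _ _ _ C S L R A (m 15 0 ∸ 1) w≡0 (nonZero⇒suc x≢0) inv
               (Stacks-empty (m 19) (m 20) g L _ stL n≡0)

    adv-popA : m 16 0 ≡ 0 → m 15 0 ≡ 0 → m 12 0 < m 0 1 → m 23 (pair g (m 13 0)) ≢ 0 →
      Adv (popA ⨾ cond (op lt (kᵉ ⊛ read 17 (pairᵉ (reg 9) (reg 25)) ⊕ reg 11) (reg 10)) skip pick)
    adv-popA w≡0 x≡0 s<k n≢0 = go refl refl refl
      where
      go : ∀ {ka c u} → pair g (m 13 0) ≡ ka → m 23 ka ∸ 1 ≡ c → m 24 (pair ka c) ≡ u →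
        Adv (popA ⨾ cond (op lt (kᵉ ⊛ read 17 (pairᵉ (reg 9) (reg 25)) ⊕ reg 11) (reg 10)) skip pick)
      go {ka} {c} {u} e₁ e₂ e₃ with ⟦ lt ⟧ (m 0 1 * m 17 (pair g u) + m 11 0) (m 10 0) ≟ 0
      ... | no quiet = adv _ (ghost C S L R (del (m 13 0) A)) t
        (exec-popA e₁ e₂ e₃ ▸ on-then quiet do-skip)
        (record
          { paramsᵐ = paramsᵐ ; edgesᵐ = edgesᵐ ; inv = proj₁ step
          ; tables = record
            { degrees = degrees ; covers = covers ; stL = stL ; stR = stR
            ; stA = Stacks-pop (m 23) (m 24) g A (m 13 0) stA e₁ n≢0′ e₂
            ; frD = frD ; frC = frC ; frL = frL ; frR = frR
            ; frA = Fresh-upd (m 23) g (m 13 0) c e₁ frA }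
          ; block≡ = block≡ ; region = region ; ansᵐ = ansᵐ ; g≤o = g≤o ; workᵐ = workᵐ })
        refl (+-monoˡ-< _ (proj₂ step))
        where
        n≢0′ : m 23 ka ≢ 0
        n≢0′ = subst (λ i → m 23 i ≢ 0) e₁ n≢0
        top = Stacks-top (m 23) (m 24) g A (m 13 0) stA e₁ n≢0′ e₂ e₃
        step = step-ignore _ _ _ _ _ _ _ _ _ _ C S L R A w≡0 x≡0 inv (proj₂ top)
                 (subst (λ d → m 0 1 * d + m 11 0 < m 10 0) (degrees u) (lt⇒< _ (m 10 0) quiet))
      ... | yes loud = adv _ (ghost C (u ∷ S) L R (del (m 13 0) A)) t
        (exec-popA e₁ e₂ e₃ ▸ on-else loud (exec-pick (grow5 (Z≤9Z (≤-trans (<⇒≤ s<k) k≤Z′)))))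
        (record
          { paramsᵐ = paramsᵐ ; edgesᵐ = edgesᵐ ; inv = proj₁ step
          ; tables = record
            { degrees = degrees ; covers = covers ; stL = stL ; stR = stR
            ; stA = Stacks-pop (m 23) (m 24) g A (m 13 0) stA e₁ n≢0′ e₂
            ; frD = frD ; frC = frC ; frL = frL ; frR = frR
            ; frA = Fresh-upd (m 23) g (m 13 0) c e₁ frA }
          ; block≡ = cong₂ _∷_ (upd-same (m 3) (g * m 0 1 + m 12 0) u)
                       (trans (block-upd (m 3) (g * m 0 1) (m 12 0) u ≤-refl) block≡)
          ; region = region ; ansᵐ = record
            { o′ = o′ ; C′ = C′ ; greedy = greedy ; uniq = uniq
            ; C⊆ = λ c → subst (λ xs → ∃[ u ] (u ∈ xs × (u , _) ∈ edges G)) (sym same) (C⊆ c)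
            ; nodes = λ s → nodes (subst (_ ∈_) same s)
            ; size≤k = size≤k ; close = close }
          ; g≤o = g≤o ; workᵐ = workᵐ })
        refl (+-monoˡ-< _ (proj₂ step))
        where
        open Answer ansᵐ
        k≤Z′ : m 0 1 ≤ Z
        k≤Z′ = ≤-trans (≤-reflexive (Params.k≡ paramsᵐ)) k≤Z
        -- By `region` the cell of the new pick lies beyond the answer's block.
        same : block (upd (m 3) (g * m 0 1 + m 12 0) u) (m 2 1) (m 2 0) ≡ block (m 3) (m 2 1) (m 2 0)
        same = block-upd (m 3) (m 2 1) (m 2 0) u (≤-trans region (m≤m+n _ _))
        n≢0′ : m 23 ka ≢ 0
        n≢0′ = subst (λ i → m 23 i ≢ 0) e₁ n≢0
        top = Stacks-top (m 23) (m 24) g A (m 13 0) stA e₁ n≢0′ e₂ e₃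
        step = step-pick _ _ _ _ _ _ _ _ _ _ C S L R A w≡0 x≡0 s<k inv (proj₂ top)
                 (subst (λ d → m 10 0 ≤ m 0 1 * d + m 11 0) (degrees u) (lt⇒≥ _ (m 10 0) loud))

    adv-advance : m 23 (pair g (m 13 0)) ≡ 0 → m 13 0 < m 11 0 → Adv advance
    adv-advance n≡0 q<f = adv ((13 , 0 , suc (m 13 0)) ∷ []) gh t
      (put refl refl (grow5 (Z≤9Z (≤-trans (<⇒≤ q<f) f≤Z))))
      (record { paramsᵐ = paramsᵐ ; edgesᵐ = edgesᵐ ; inv = proj₁ step ; tables = record { Tables tables }
              ; block≡ = block≡ ; region = region ; ansᵐ = ansᵐ ; g≤o = g≤o ; workᵐ = workᵐ })
      refl (+-monoˡ-< _ (proj₂ step))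
      where
      step = step-advance _ _ _ _ _ _ _ _ _ _ C S L R A q<f inv
               (Stacks-empty (m 23) (m 24) g A _ stA n≡0)

    adv-load : m 16 0 ≡ 0 → m 15 0 ≡ 0 → m 14 0 < m 4 0 →
               Adv (load ⨾ cond (read 18 (reg 27)) skip insertLive)
    adv-load w≡0 x≡0 p<M = go refl refl refl refl refl
      where
      go : ∀ {u v ku kv d} → m 5 (m 14 0) ≡ u → m 6 (m 14 0) ≡ v → pair g u ≡ ku → pair g v ≡ kv →
           suc (m 17 ku) ≡ d → Adv (load ⨾ cond (read 18 (reg 27)) skip insertLive)
      go {u} {v} {ku} {kv} {d} e₁ e₂ e₃ e₄ e₅ with m 18 kv ≟ 0
      ... | no c≢0 = adv _ gh t
        (exec-load (grow5 (Z≤9Z p≤Z)) e₁ e₂ e₄ ▸ on-then c≢0 do-skip)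
        (record { paramsᵐ = paramsᵐ ; edgesᵐ = edgesᵐ ; inv = proj₁ step ; tables = record { Tables tables }
                ; block≡ = block≡ ; region = region ; ansᵐ = ansᵐ ; g≤o = g≤o ; workᵐ = workᵐ })
        refl (+-monoˡ-< _ (proj₂ step))
        where
        v∈C : v ∈ C
        v∈C = mem≢0⇒∈ v C λ z → c≢0 (trans (cong (m 18) (sym e₄)) (trans (covers v) z))
        step = step-skip _ _ _ _ _ _ _ _ _ _ C S L R A w≡0 p<M (cong₂ _,_ e₁ e₂) inv v∈C
      ... | yes c≡0 = place refl
        where
        v∉C : v ∉ C
        v∉C = mem≡0⇒∉ v C (trans (sym (covers v)) (trans (cong (m 18) e₄) c≡0))
        inc = Degrees-inc {g} {m 17} {R} {v} {u} degrees e₃ e₅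
        ed : ℕ → ℕ × ℕ
        ed i = m 5 i , m 6 i
        new : (u , v) ∉ pre ed (m 14 0)
        new = subst (_∉ pre ed (m 14 0)) (cong₂ _,_ e₁ e₂)
                (pre-new ed p<M (subst Unique (sym (Edges.edges≡ edgesᵐ)) (Edges.unique edgesᵐ)))
        step = step-add _ _ _ _ _ _ _ _ _ _ C S L R A w≡0 x≡0 p<M (cong₂ _,_ e₁ e₂) new inv v∉C (proj₂ inc)
        place : ∀ {ka} → pair g (alarmAt (m 13 0) (m 10 0) (m 0 1) d) ≡ ka →
                Adv (load ⨾ cond (read 18 (reg 27)) skip insertLive)
        place {ka} e₆ = adv _
          (ghost C S ((u , v) ∷ L) ((v , u) ∷ R) ((alarmAt (m 13 0) (m 10 0) (m 0 1) d , u) ∷ A)) t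
          (exec-load (grow5 (Z≤9Z p≤Z)) e₁ e₂ e₄ ▸
           on-else c≡0 (exec-insertLive (roomL e₃) (roomR e₄) (roomD e₃ e₅) (roomA e₆) e₃ e₄ e₅ e₆))
          (record
            { paramsᵐ = paramsᵐ ; edgesᵐ = edgesᵐ ; inv = proj₁ step
            ; tables = record
              { degrees = proj₁ inc ; covers = covers
              ; stL = Stacks-push (m 19) (m 20) g L u v e₃ stL
              ; stR = Stacks-push (m 21) (m 22) g R v u e₄ stR
              ; stA = Stacks-push (m 23) (m 24) g A _ u e₆ stA
              ; frD = Fresh-upd (m 17) g u d e₃ frD ; frC = frC
              ; frL = Fresh-upd (m 19) g u _ e₃ frL
              ; frR = Fresh-upd (m 21) g v _ e₄ frR ; frA = Fresh-upd (m 23) g _ _ e₆ frA }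
            ; block≡ = block≡ ; region = region ; ansᵐ = ansᵐ ; g≤o = g≤o ; workᵐ = workᵐ })
          refl (+-monoˡ-< _ (proj₂ step))

    k≡ : m 0 1 ≡ k
    k≡ = Params.k≡ paramsᵐ

    adv-finish : m 16 0 ≡ 0 → m 15 0 ≡ 0 → ⟦ lt ⟧ (m 11 0) (m 10 0) * ⟦ lt ⟧ (m 12 0) (m 0 1) ≡ 0 → Adv finish
    adv-finish w≡0 x≡0 complete = go refl refl
      where
      o f s M : ℕ
      o = m 10 0
      f = m 11 0
      s = m 12 0
      M = m 4 0

      greedy-f : Greedy (m 0 1) o s f
      greedy-f = Greedy-mono {m 0 1} {o} {s} (Promise-idle {k = m 0 1} {o} (subst (λ x → Promise (m 0 1) o f s (m 16 0) x R) x≡0 promise))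
                   (Promise.greedy (subst (λ x → Promise (m 0 1) o f s (m 16 0) x R) x≡0 promise))

      -- A guess completes either with `f ≥ o`, where the bound for `k` picks is immediate, or with
      -- exactly `k` picks.
      greedy-k : Greedy k o k f
      greedy-k with m*n≡0⇒m≡0∨n≡0 (⟦ lt ⟧ f o) complete
      ... | inj₁ f≥o = ≤-trans (*-monoʳ-≤ (k ^ k) (lt⇒≥ f o f≥o)) (m≤m+n _ _)
      ... | inj₂ s≥k = subst₂ (λ i j → Greedy i o j f) k≡ (trans (≤-antisym s≤k (lt⇒≥ s (m 0 1) s≥k)) k≡) greedy-f

      f≤M : f ≤ M
      f≤M = ≤-trans (m≤m+n f (length L)) (≤-trans f+L≤p p≤M)

      o≤2M : o ≤ 2 * M
      o≤2M = ≤-trans (Greedy⇒≤2* {k} (>-nonZero⁻¹ k) greedy-k) (*-monoʳ-≤ 2 f≤M)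

      y : ℕ
      y = (a + b) * o

      covered : ∀ {v} → v ∈ C → ∃[ u ] (u ∈ block (m 3) (g * m 0 1) s × (u , v) ∈ edges G)
      covered c with Picks.C⊆S picks c
      ... | u , u∈S , e = u , subst (u ∈_) (sym block≡) u∈S
                        , subst (_ ∈_) (Edges.edges≡ edgesᵐ) (pre-⊆ _ p≤M e)

      nodes : ∀ {u} → u ∈ block (m 3) (g * m 0 1) s → ∃[ v ] (u , v) ∈ edges G
      nodes u∈ with Picks.S⊆P picks (subst (_ ∈_) block≡ u∈)
      ... | v , e = v , subst (_ ∈_) (Edges.edges≡ edgesᵐ) (pre-⊆ _ p≤M e)

      go : ∀ {r o″} → suc (⟦ div ⟧ ((m 0 2 + m 0 3) * o) (m 0 3)) ≡ r → r + (m 8 0 ∸ r) ≡ o″ → Adv finish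
      -- The restart is charged `suc M`, not `M`: the spare unit makes `total` drop although all `M`
      -- edges return to the queue.
      go {r} {o″} e₁ e₂ = adv _ (ghost [] [] [] [] []) (t + suc M)
        (exec-finish (small5 (≤-trans (s≤s (≤-trans g≤o o≤2Z)) 2Z+1)) o″≤ e₁ e₂)
        (record
          { paramsᵐ = paramsᵐ ; edgesᵐ = edgesᵐ ; inv = Inv-new (m 0 1) M o″ _ x≡0 w≡0
          ; tables = record
            { degrees = λ u → frD (suc g) u (n<1+n g) ; covers = λ v → frC (suc g) v (n<1+n g)
            ; stL = Stacks-zero (m 19) (m 20) (suc g) (λ u → frL (suc g) u (n<1+n g))
            ; stR = Stacks-zero (m 21) (m 22) (suc g) (λ u → frR (suc g) u (n<1+n g))
            ; stA = Stacks-zero (m 23) (m 24) (suc g) (λ u → frA (suc g) u (n<1+n g))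
            ; frD = Fresh-suc (m 17) g frD ; frC = Fresh-suc (m 18) g frC ; frL = Fresh-suc (m 19) g frL
            ; frR = Fresh-suc (m 21) g frR ; frA = Fresh-suc (m 23) g frA }
          ; block≡ = refl
          ; region = ≤-trans (+-monoʳ-≤ (g * m 0 1) s≤k) (≤-reflexive (+-comm (g * m 0 1) (m 0 1)))
          ; ansᵐ = record
            { o′ = o ; C′ = C ; greedy = subst (Greedy k o k) f≡ greedy-k ; uniq = Live.uniqC live
            ; C⊆ = covered ; nodes = nodes ; size≤k = ≤-trans s≤k (≤-reflexive k≡) ; close = near }
          ; g≤o = ≤-trans (s≤s g≤o) (≤-trans o<r r≤o″)
          ; workᵐ = work′ })
        refl below
        where
        r≡ : r ≡ suc (y / b)
        r≡ = trans (sym e₁) (cong suc (trans (cong₂ (λ i j → ⟦ div ⟧ ((i + j) * o) j) (Params.a≡ paramsᵐ) (Params.b≡ paramsᵐ))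
                                             (div-eval y b)))
        o″≡ : o″ ≡ r ⊔ m 8 0
        o″≡ = trans (sym e₂) (m+[n∸m]≡m⊔n r (m 8 0))
        r≤o″ : r ≤ o″
        r≤o″ = ≤-trans (m≤m⊔n r (m 8 0)) (≤-reflexive (sym o″≡))
        md≤o″ : m 8 0 ≤ o″
        md≤o″ = ≤-trans (m≤n⊔m r (m 8 0)) (≤-reflexive (sym o″≡))
        y<br : y < b * r
        y<br = subst (λ i → y < b * i) (sym r≡) (m<n*[1+m/n] y b)
        o<r : o < r
        o<r = *-cancelˡ-< b o r (≤-<-trans (*-monoˡ-≤ o (m≤n+m b a)) y<br)
        o≤2Z : o ≤ 2 * Z
        o≤2Z = ≤-trans o≤2M (*-monoʳ-≤ 2 M≤Z)
        2Z+1 : suc (2 * Z) ≤ 16 * Z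
        2Z+1 = ≤-trans (+-monoˡ-≤ (2 * Z) 1≤Z) (≤-trans (m≤m+n (Z + 2 * Z) (13 * Z)) (≤-reflexive (e₃ Z)))
          where
          e₃ : ∀ z → z + 2 * z + 13 * z ≡ 16 * z
          e₃ = solve-∀
        r≤ : r ≤ Z ^ 5
        r≤ = begin
          r                                ≡⟨ r≡ ⟩
          suc (y / b)                      ≤⟨ s≤s (m/n≤m y b) ⟩
          suc ((a + b) * o)                ≤⟨ s≤s (*-mono-≤ a+b≤Z o≤2Z) ⟩
          1 + Z * (2 * Z)                  ≤⟨ ^-add {i = 0} {3} ≤-refl (≤-trans (≤-reflexive (e₄ Z)) (*-monoˡ-≤ (Z ^ 2) 2≤Z)) ⟩
          Z ^ 4                            ≤⟨ ^-monoʳ-≤ Z (n≤1+n 4) ⟩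
          Z ^ 5                            ∎
          where
          open ≤-Reasoning
          e₄ : ∀ z → z * (2 * z) ≡ 2 * (z * (z * 1))
          e₄ = solve-∀
        o″≤ : o″ ≤ Z ^ 5
        o″≤ = ≤-trans (≤-reflexive o″≡) (⊔-lub r≤ (small 8 0))
        near : b * o″ ≤ (a + b) * o + b ⊎ ∃[ u ] o″ ≤ outdegree u (edges G)
        near with ≤-total (m 8 0) r
        ... | inj₁ md≤r = inj₁ (begin
          b * o″           ≡⟨ cong (b *_) (trans o″≡ (trans (m≥n⇒m⊔n≡m md≤r) r≡)) ⟩
          b * suc (y / b)  ≡⟨ *-suc b (y / b) ⟩
          b + b * (y / b)  ≡⟨ cong (b +_) (*-comm b (y / b)) ⟩
          b + y / b * b    ≤⟨ +-monoʳ-≤ b (m/n*n≤m y b) ⟩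
          b + y            ≡⟨ +-comm b y ⟩
          y + b            ∎)
          where open ≤-Reasoning
        ... | inj₂ r≤md = inj₂ (u , ≤-trans (≤-reflexive (trans o″≡ (m≤n⇒m⊔n≡n r≤md)))
                                      (≤-trans md≤ (≤-reflexive (Edges.out≡ edgesᵐ u))))
          where
          u   = proj₁ (Edges.out∃ edgesᵐ)
          md≤ = proj₂ (Edges.out∃ edgesᵐ)
        -- All degrees are at most `o″`, so `M ≤ left G * o″`; the strictness of `left G < n` yields
        -- another `o″ ≥ 1` for the successor.
        sM≤ : suc M ≤ n * o″
        sM≤ = begin
          1 + M                    ≤⟨ +-mono-≤ (≤-trans (≤-trans (s≤s z≤n) o<r) r≤o″)
                                       (≤-trans (≤-reflexive M≡) (length≤left*d (left G) o″ (edges G)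
                                         (λ e → proj₁ (Edges.range edgesᵐ e))
                                         (λ u → ≤-trans (≤-reflexive (sym (Edges.out≡ edgesᵐ u)))
                                                  (≤-trans (Edges.out≤ edgesᵐ u) md≤o″)))) ⟩
          o″ + left G * o″         ≤⟨ *-monoˡ-≤ o″ G<n ⟩
          n * o″                   ∎
          where open ≤-Reasoning
        sM≤e : suc M ≤ e
        sM≤e = ≤-trans (s≤s (≤-reflexive M≡)) E<e
        work′ : Work o″ (t + suc M)
        work′ = Work-step workᵐ (≤-trans o≤2M (*-monoʳ-≤ 2 (<⇒≤ sM≤e)))
                  (≤-trans (<⇒≤ y<br) (*-monoʳ-≤ b r≤o″)) sM≤ sM≤e
        below : 9 * M + weight (st (m 0 1) M o″ 0 0 0 0 (m 15 0) (m 16 0) (λ i → m 5 i , m 6 i) (ghost [] [] [] [] []))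
                  + 9 * (bound ∸ (t + suc M)) < total m gh t
        below rewrite x≡0 | w≡0 = begin-strict
          9 * M + 0 + 9 * rest       ≡⟨ cong (_+ 9 * rest) (+-identityʳ (9 * M)) ⟩
          9 * M + 9 * rest           <⟨ +-monoˡ-< (9 * rest) (*-monoʳ-< 9 (n<1+n M)) ⟩
          9 * suc M + 9 * rest       ≡⟨ *-distribˡ-+ 9 (suc M) rest ⟨
          9 * (suc M + rest)         ≡⟨ cong (9 *_) split ⟨
          9 * (bound ∸ t)            ≤⟨ m≤n+m (9 * (bound ∸ t)) old ⟩
          old + 9 * (bound ∸ t)      ∎
          where
          open ≤-Reasoning
          old : ℕ
          old = 9 * (M ∸ m 14 0) + (3 * length L + 3 * length R + 2 * length A + 0 + 0 + (f ∸ m 13 0))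
          rest : ℕ
          rest = bound ∸ (t + suc M)
          split : bound ∸ t ≡ suc M + rest
          split = trans (sym (m+[n∸m]≡n (m+n≤o⇒m≤o∸n (suc M) (≤-trans (≤-reflexive (+-comm (suc M) t)) (Work-bound work′)))))
                        (cong (suc M +_) (∸-+-assoc bound t (suc M)))

    advance-or-halt : Adv round ⊎ (Exec round [] ((30 , 0 , 0) ∷ []) × Quiet m A)
    advance-or-halt with m 16 0 ≟ 0
    ... | no w≢0 with m 21 (pair g (m 16 0 ∸ 1)) ≟ 0
    ...   | no n≢0  = inj₁ (via (λ x → on-then w≢0 (on-then n≢0 x)) (adv-popR w≢0 n≢0))
    ...   | yes n≡0 = inj₁ (via (λ x → on-then w≢0 (on-else n≡0 x)) (adv-endR w≢0 n≡0))
    advance-or-halt | yes w≡0 with m 15 0 ≟ 0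
    ... | no x≢0 with m 19 (pair g (m 15 0 ∸ 1)) ≟ 0
    ...   | no n≢0  = inj₁ (via (λ x → on-else w≡0 (on-then x≢0 (on-then n≢0 x))) (adv-popL w≡0 x≢0 n≢0))
    ...   | yes n≡0 = inj₁ (via (λ x → on-else w≡0 (on-then x≢0 (on-else n≡0 x))) (adv-endL w≡0 x≢0 n≡0))
    advance-or-halt | yes w≡0 | yes x≡0
      with ⟦ lt ⟧ (m 11 0) (m 10 0) * ⟦ lt ⟧ (m 12 0) (m 0 1) ≟ 0
    ... | yes fin = inj₁ (via (λ x → on-else w≡0 (on-else x≡0 (on-else fin x))) (adv-finish w≡0 x≡0 fin))
    ... | no  unf with m 23 (pair g (m 13 0)) ≟ 0
    ...   | no n≢0 = inj₁ (via (λ x → on-else w≡0 (on-else x≡0 (on-then unf (on-then n≢0 x))))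
                       (adv-popA w≡0 x≡0 s<k n≢0))
      where
      s<k : m 12 0 < m 0 1
      s<k = lt⇒< _ _ λ z → unf (trans (cong (⟦ lt ⟧ (m 11 0) (m 10 0) *_) z) (*-zeroʳ (⟦ lt ⟧ (m 11 0) (m 10 0))))
    ...   | yes n≡0 with ⟦ lt ⟧ (m 13 0) (m 11 0) ≟ 0
    ...     | no q<f = inj₁ (via (λ x → on-else w≡0 (on-else x≡0 (on-then unf (on-else n≡0 (on-then q<f x)))))
                         (adv-advance n≡0 (lt⇒< _ _ q<f)))
    ...     | yes q≮f with ⟦ lt ⟧ (m 14 0) (m 4 0) ≟ 0
    ...       | no p<M = inj₁ (via (λ x → on-else w≡0 (on-else x≡0 (on-then unf (on-else n≡0 (on-else q≮f (on-then p<M x))))))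
                           (adv-load w≡0 x≡0 (lt⇒< _ _ p<M)))
    ...       | yes p≮M = inj₂
      ( on-else w≡0 (on-else x≡0 (on-then unf (on-else n≡0 (on-else q≮f (on-else p≮M (set refl refl))))))
      , record
        { w≡0 = w≡0 ; x≡0 = x≡0
        ; f<o = lt⇒< _ _ λ z → unf (cong (_* ⟦ lt ⟧ (m 12 0) (m 0 1)) z)
        ; q≡f = ≤-antisym q≤f (lt⇒≥ _ _ q≮f) ; p≡M = ≤-antisym p≤M (lt⇒≥ _ _ p≮M)
        ; A∅ = Stacks-empty (m 23) (m 24) g A _ stA n≡0 })

  -- Serving one update

  record Fits-in (G : Graph) : Set where
    field
      left<n  : left G < n
      left≤Z  : left G ≤ Z
      right≤Z : right G ≤ Z
      edges<e : length (edges G) < e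
      edges≤Z : length (edges G) ≤ Z

  record Served (c : Cmd) (G : Graph) (m : Memory) (budget : ℕ) : Set where
    field
      m′    : Memory
      gh′   : Ghost
      t′ τ  : ℕ
      run   : Run B c m m′ τ
      good  : Good G m′ gh′ t′
      small : Small m′
      quiet : Quiet m′ (Ghost.A gh′)
      cost  : τ + κ * total m′ gh′ t′ ≤ budget

  -- The bound `j` on `total` serves as fuel, as `total` drops in every round but the last. The
  -- summand `κ + 3` is the halting round with the exit test.
  loop : ∀ {G} → Fits-in G → ∀ j m gh t → total m gh t ≤ j → Good G m gh t → Small m → m 30 0 ≢ 0 →
         Served (while (reg 30) round) G m (κ * total m gh t + (κ + 3))
  loop {G} fi j m gh@(ghost C S L R A) t le good small on
    with Step.advance-or-halt G (Fits-in.left<n fi) (Fits-in.edges<e fi) (Fits-in.edges≤Z fi) m C S L R A t good small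
  ... | inj₂ (x , quiet) with Executions.run x small
  ...   | (s , r , s≤) , small′ = record
    { m′ = m ◂ ((30 , 0 , 0) ∷ []) ; gh′ = gh ; t′ = t
    ; run = run-repeat (checked small (reg 30)) on r (run-exit (checked small′ (reg 30)) refl)
    ; good = record { Good good } ; small = small′ ; quiet = record { Quiet quiet }
    ; cost = ≤-trans (+-monoˡ-≤ (κ * total m gh t) (+-monoˡ-≤ 3 (≤-trans (+-monoʳ-≤ 3 s≤) round-cost))) (≤-reflexive (+-comm (κ + 3) _)) }
  loop {G} fi zero m gh t le good small on | inj₁ (Step.adv ws gh₁ t₁ x good₁ flag below) =
    contradiction (≤-trans below le) λ ()
  loop {G} fi (suc j) m gh t le good small on | inj₁ (Step.adv ws gh₁ t₁ x good₁ flag below)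
    with Executions.run x small
  ... | (s , r , s≤) , small₁
    with loop fi j (m ◂ ws) gh₁ t₁ (≤-pred (≤-trans below le)) good₁ small₁ (on ∘ trans (sym flag))
  ...   | sv = record
    { m′ = m′ ; gh′ = gh′ ; t′ = t′
    ; run = run-repeat (checked small (reg 30)) on r run
    ; good = good′ ; small = small′ ; quiet = quiet ; cost = begin
        3 + s + τ + κ * total m′ gh′ t′               ≡⟨ +-assoc (3 + s) τ _ ⟩
        3 + s + (τ + κ * total m′ gh′ t′)             ≤⟨ +-mono-≤ (≤-trans (+-monoʳ-≤ 3 s≤) round-cost) cost ⟩
        κ + (κ * total (m ◂ ws) gh₁ t₁ + (κ + 3))     ≡⟨ +-assoc κ _ (κ + 3) ⟨
        κ + κ * total (m ◂ ws) gh₁ t₁ + (κ + 3)       ≡⟨ cong (_+ (κ + 3)) (*-suc κ (total (m ◂ ws) gh₁ t₁)) ⟨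
        κ * suc (total (m ◂ ws) gh₁ t₁) + (κ + 3)     ≤⟨ +-monoˡ-≤ (κ + 3) (*-monoʳ-≤ κ below) ⟩
        κ * total m gh t + (κ + 3)                    ∎ }
    where
    open Served sv renaming (good to good′; small to small′)
    open ≤-Reasoning

  received : Memory → (tag u v : ℕ) → Memory
  received m tag u v = ((m [ request at 0 ≔ tag ]) [ request at 1 ≔ u ]) [ request at 2 ≔ v ]

  Small-received : ∀ {m tag u v} → Small m → tag ≤ Z → u ≤ Z → v ≤ Z → Small (received m tag u v)
  Small-received sm ht hu hv =
    Small-write 1 2 (Small-write 1 1 (Small-write 1 0 sm (up ht)) (up hu)) (up hv)
    where
    up : ∀ {x} → x ≤ Z → x ≤ Z ^ 1
    up le = ≤-trans le (≤-reflexive (sym (*-identityʳ Z)))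

  -- Common to all updates: whatever the insertion does, it raises the potential by at most 9.
  finish-update : ∀ {G G′ m tag u v ws gh gh₀ t} → Fits-in G′ → Good G m gh₀ t →
    Executions.Exec (received m tag u v) insertion [] ws →
    Good G′ (received m tag u v ◂ ((30 , 0 , 1) ∷ ws)) gh t →
    total (received m tag u v ◂ ((30 , 0 , 1) ∷ ws)) gh t ≤ 9 + total m gh₀ t →
    Small (received m tag u v) → Served program G′ (received m tag u v) (κ * total m gh₀ t + κ′)
  finish-update {G} {G′} {m} {tag} {u} {v} {ws} {gh} {gh₀} {t} fi good x good′ le small
    with Executions.run x small
  ... | (s , r , s≤) , small₁
    with Executions.run (Executions.set (received m tag u v) {30} {lit 0} {lit 1} {ws = ws} refl refl) small₁
  ... | (s₁ , r₁ , s₁≤) , small₂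
    with loop fi _ _ gh t ≤-refl good′ small₂ (λ ())
  ... | sv = record
    { m′ = m′ ; gh′ = gh′ ; t′ = t′
    ; run = run-then (checked small kᵉ) k≢0′ (run-seq r (run-seq r₁ run))
    ; good = good″ ; small = small″ ; quiet = quiet ; cost = begin
        3 + (s + (s₁ + τ)) + κ * total m′ gh′ t′           ≡⟨ e₁ s s₁ τ (κ * total m′ gh′ t′) ⟩
        3 + (s + s₁) + (τ + κ * total m′ gh′ t′)           ≤⟨ +-mono-≤ (+-monoʳ-≤ 3 (+-mono-≤ (≤-trans s≤ (proj₂ insertion-cost)) s₁≤)) cost ⟩
        3 + (κ₀ + 3) + (κ * T₀ + (κ + 3))                    ≤⟨ +-monoʳ-≤ (3 + (κ₀ + 3)) (+-monoˡ-≤ (κ + 3) (*-monoʳ-≤ κ le)) ⟩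
        3 + (κ₀ + 3) + (κ * (9 + total m gh₀ t) + (κ + 3))  ≡⟨ e₂ (3 + (κ₀ + 3)) κ (total m gh₀ t) (κ + 3) ⟩
        κ * total m gh₀ t + κ′                             ∎ }
    where
    open Served sv renaming (good to good″; small to small″)
    open ≤-Reasoning
    T₀ : ℕ
    T₀ = total (received m tag u v ◂ ((30 , 0 , 1) ∷ ws)) gh t
    k≢0′ : m 0 1 ≢ 0
    k≢0′ z = ≢-nonZero⁻¹ k (trans (sym (Params.k≡ (Good.paramsᵐ good))) z)
    e₁ : ∀ s s₁ τ x → 3 + (s + (s₁ + τ)) + x ≡ 3 + (s + s₁) + (τ + x)
    e₁ = solve-∀
    e₂ : ∀ c κ T₀ d → c + (κ * (9 + T₀) + d) ≡ κ * T₀ + (c + (9 * κ + d))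
    e₂ = solve-∀

  serve-newLeft : ∀ {G m gh t} → Fits-in (apply G newLeft) → Good G m gh t → Small m →
    Served program (apply G newLeft) (receive newLeft m) (κ * total m gh t + κ′)
  serve-newLeft {G} {m} {gh} {t} fi good small =
    finish-update {G} {apply G newLeft} {m} {0} {0} {0} {[]} {gh} {gh} {t} fi good (Executions.on-else _ refl (Executions.do-skip _))
      (record
        { paramsᵐ = paramsᵐ
        ; edgesᵐ = record { Edges edgesᵐ hiding (range) ; range = λ e → let l , r = Edges.range edgesᵐ e in m<n⇒m<1+n l , r }
        ; inv = inv ; tables = tables ; block≡ = block≡ ; region = region ; ansᵐ = record { Answer ansᵐ }
        ; g≤o = g≤o ; workᵐ = workᵐ })
      (m≤n+m _ 9) (Small-received small z≤n z≤n z≤n)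
    where open Good good

  serve-newRight : ∀ {G m gh t} → Fits-in (apply G newRight) → Good G m gh t → Small m →
    Served program (apply G newRight) (receive newRight m) (κ * total m gh t + κ′)
  serve-newRight {G} {m} {gh} {t} fi good small =
    finish-update {G} {apply G newRight} {m} {1} {0} {0} {[]} {gh} {gh} {t} fi good (Executions.on-else _ refl (Executions.do-skip _))
      (record
        { paramsᵐ = paramsᵐ
        ; edgesᵐ = record { Edges edgesᵐ hiding (range) ; range = λ e → let l , r = Edges.range edgesᵐ e in l , m<n⇒m<1+n r }
        ; inv = inv ; tables = tables ; block≡ = block≡ ; region = region ; ansᵐ = record { Answer ansᵐ }
        ; g≤o = g≤o ; workᵐ = workᵐ })
      (m≤n+m _ 9) (Small-received small 1≤Z z≤n z≤n)
    where open Good good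

  serve-newEdge : ∀ {G m gh t} u v → Fits-in (apply G (newEdge u v)) →
    u < left G → v < right G → (u , v) ∉ edges G → Good G m gh t → Small m →
    Served program (apply G (newEdge u v)) (receive (newEdge u v) m) (κ * total m gh t + κ′)
  serve-newEdge {G} {m} {gh} {t} u v fi u<l v<r new good small = go refl refl
    where
    open Good good
    open Edges edgesᵐ
    open Answer ansᵐ
    M : ℕ
    M = m 4 0
    M≤Z : M ≤ Z
    M≤Z = ≤-trans (≤-reflexive (trans (sym (length-pre _ M)) (cong length edges≡)))
            (≤-trans (n≤1+n _) (Fits-in.edges≤Z fi))
    fd≤Z : m 7 u ≤ Z
    fd≤Z = ≤-trans (≤-reflexive (out≡ u)) (≤-trans (count≤length _ (edges G)) (≤-trans (n≤1+n _) (Fits-in.edges≤Z fi)))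
    9Z : ∀ {x} → x ≤ Z → x ≤ 9 * Z
    9Z x≤Z = ≤-trans x≤Z (m≤m+n Z _)
    go : ∀ {d x} → suc (m 7 u) ≡ d → m 8 0 + (d ∸ m 8 0) ≡ x →
         Served program (apply G (newEdge u v)) (receive (newEdge u v) m) (κ * total m gh t + κ′)
    go {d} {x} refl e₂ = finish-update {G} {apply G (newEdge u v)} {m} {2} {u} {v} {_} {gh} {gh} {t} fi good
      (Executions.on-then (received m 2 u v) (λ ())
        (Executions.exec-insertEdge (received m 2 u v) {M} {u} {v} {d} {x}
          (grow5 (9Z fd≤Z)) x≤ (grow5 (9Z M≤Z)) refl refl refl refl e₂))
      (record
        { paramsᵐ = paramsᵐ
        ; edgesᵐ = record
          { edges≡ = cong₂ _∷_ (cong₂ _,_ (upd-same (m 5) M u) (upd-same (m 6) M v))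
                       (trans (sym (pre-cong M old)) edges≡)
          ; range = λ { (here refl) → u<l , v<r ; (there e) → range e }
          ; unique = All.tabulate (λ {e} e∈ same → new (subst (_∈ edges G) (sym same) e∈)) ∷ unique
          ; out≡ = out-degree
          ; out≤ = bounded
          ; out∃ = attained }
        ; inv = proj₁ inserted
        ; tables = tables ; block≡ = block≡ ; region = region
        ; ansᵐ = record
          { o′ = o′ ; C′ = C′ ; greedy = greedy ; uniq = uniq
          ; C⊆ = λ c → let u′ , s , e = C⊆ c in u′ , s , there e
          ; nodes = λ s → let v′ , e = nodes s in v′ , there e
          ; size≤k = size≤k
          ; close = [ inj₁ , (λ (u′ , le) → inj₂ (u′ , ≤-trans le (m≤n+m _ (bit (u ≡ᵇ u′))))) ]′ close }
        ; g≤o = g≤o ; workᵐ = workᵐ })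
      (≤-reflexive (trans (cong (_+ 9 * (bound ∸ t)) (proj₂ inserted)) (+-assoc 9 (energy (abs m gh)) _)))
      (Small-received small 2≤Z
        (≤-trans (<⇒≤ u<l) (Fits-in.left≤Z fi)) (≤-trans (<⇒≤ v<r) (Fits-in.right≤Z fi)))
      where
      x≡ : x ≡ m 8 0 ⊔ d
      x≡ = trans (sym e₂) (m+[n∸m]≡m⊔n (m 8 0) d)
      x≤ : x ≤ Z ^ 5
      x≤ = ≤-trans (≤-reflexive x≡) (⊔-lub (small 8 0) (grow5 (9Z fd≤Z)))
      old : ∀ i → i < M → (m 5 i , m 6 i) ≡ (upd (m 5) M u i , upd (m 6) M v i)
      old i i<M = cong₂ _,_ (sym (upd-other (m 5) u (>⇒≢ i<M))) (sym (upd-other (m 6) v (>⇒≢ i<M)))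
      inserted = Inv-insert {gh = gh} old inv
      out-degree : ∀ z → upd (m 7) u d z ≡ outdegree z ((u , v) ∷ edges G)
      out-degree z with u ≟ z
      ... | yes refl rewrite ≡ᵇ-refl u = cong suc (out≡ u)
      ... | no u≢z rewrite ≢⇒≡ᵇ u≢z = out≡ z
      bounded : ∀ z → upd (m 7) u d z ≤ x
      bounded z with u ≟ z
      ... | yes refl = ≤-trans (≤-reflexive (upd-same (m 7) u d)) (≤-trans (m≤n⊔m (m 8 0) d) (≤-reflexive (sym x≡)))
      ... | no u≢z = ≤-trans (≤-reflexive (upd-other (m 7) d u≢z))
                       (≤-trans (out≤ z) (≤-trans (m≤m⊔n (m 8 0) d) (≤-reflexive (sym x≡))))
      attained : ∃[ z ] x ≤ upd (m 7) u d z
      attained with ≤-total d (m 8 0) | out∃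
      ... | inj₂ md≤d | _ = u , ≤-reflexive (trans x≡ (trans (m≤n⇒m⊔n≡n md≤d) (sym (upd-same (m 7) u d))))
      ... | inj₁ d≤md | z , md≤ = z , ≤-trans (≤-reflexive (trans x≡ (m≥n⇒m⊔n≡m d≤md))) (≤-trans md≤ grows)
        where
        grows : m 7 z ≤ upd (m 7) u d z
        grows with u ≟ z
        ... | yes refl = ≤-trans (n≤1+n _) (≤-reflexive (sym (upd-same (m 7) u d)))
        ... | no u≢z   = ≤-reflexive (sym (upd-other (m 7) d u≢z))

  -- From a halted state to the approximation guarantee

  -- A guess taken from a degree would not be quiet, as that degree can only have grown. In the
  -- other case integrality absorbs the rounding: `b (opt + 1) ≤ b o ≤ (a + b) o′ + b`.
  quiet⇒close : ∀ {G m gh t} → (good : Good G m gh t) → Quiet m (Ghost.A gh) →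
    b * opt k G ≤ (a + b) * Answer.o′ (Good.ansᵐ good)
  quiet⇒close {G} {m} {ghost C S L R A} good quiet = [ near , (λ (u , le) → contradiction le (<⇒≱ (far u))) ]′ close
    where
    open Quiet quiet
    open Good good
    open Inv inv
    open Answer ansᵐ
    open Edges edgesᵐ using (edges≡; unique)
    all : ∀ {u v} → (u , v) ∈ edges G → v ∈ C ⊎ (v , u) ∈ R
    all e = Live.P⊆CR live (subst (_ ∈_) (trans (sym edges≡) (cong (pre _) (sym p≡M))) e)
    calm : ∀ u → k * gain (suc u) R + length C < m 10 0
    calm u = subst₂ (λ i j → i * gain (suc u) R + j < m 10 0) (Params.k≡ paramsᵐ) f≡
               (quiet-gain _ _ _ _ _ _ _ _ _ _ C S L R A w≡0 x≡0 q≡f f<o inv A∅ u)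
    far : ∀ u → outdegree u (edges G) < m 10 0
    far u = quiet⇒outdegree< k G C R u (>-nonZero⁻¹ k) unique all (calm u)
    near : b * m 10 0 ≤ (a + b) * o′ + b → b * opt k G ≤ (a + b) * o′
    near le = +-cancelʳ-≤ b _ _ (begin
      b * opt k G + b        ≡⟨ +-comm (b * opt k G) b ⟩
      b + b * opt k G        ≡⟨ *-suc b (opt k G) ⟨
      b * suc (opt k G)      ≤⟨ *-monoʳ-≤ b (quiet⇒opt< k G C R (>-nonZero⁻¹ k) all calm) ⟩
      b * m 10 0             ≤⟨ le ⟩
      (a + b) * o′ + b       ∎)
      where open ≤-Reasoning

  solution : ∀ {G m gh t} ε .{{_ : Positive ε}} → numerator ε ≡ a → ↧ₙ ε ≡ b →
             Good G m gh t → Quiet m (Ghost.A gh) → Solution k ε G m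
  solution {G} {m} ε refl refl good quiet = record
    { inV_L  = All.tabulate λ u∈ → let v , e = nodes (∈-held⇒∈-block m u∈) in proj₁ (range e)
    ; size≤k = ≤-trans (∣fromList∣≤length (left G) (held m)) (≤-trans (≤-reflexive (length-held m)) size≤k)
    ; approx = Greedy⇒AtLeast {k} {o′} {length C′} ε (>-nonZero⁻¹ k) greedy
                 (coverage-≥ G C′ (held m) uniq λ c → let u , u∈ , e = C⊆ c in
                   proj₂ (range e) , u , ∈-block⇒∈-held m u∈ , proj₁ (range e) , e)
                 (quiet⇒close good quiet) }
    where
    open Good good
    open Answer ansᵐ
    open Edges edgesᵐ using (range)

  -- Each update adds exactly one, so the number of updates bounds nodes and edges alike.
  size : Graph → ℕ
  size G = left G + right G + length (edges G)

  size-apply : ∀ G u → size (apply G u) ≡ suc (size G)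
  size-apply G newLeft       = refl
  size-apply G newRight      = cong (_+ length (edges G)) (+-suc (left G) (right G))
  size-apply G (newEdge u v) = +-suc (left G + right G) (length (edges G))

  left-apply : ∀ G u → left G ≤ left (apply G u)
  left-apply G newLeft       = n≤1+n (left G)
  left-apply G newRight      = ≤-refl
  left-apply G (newEdge u v) = ≤-refl

  left-foldl : ∀ G us → left G ≤ left (foldl apply G us)
  left-foldl G []       = ≤-refl
  left-foldl G (u ∷ us) = ≤-trans (left-apply G u) (left-foldl (apply G u) us)

  serve : ∀ {N G m gh t} u → Fits-in (apply G u) → Allowed N G u → Good G m gh t → Small m →
          Served program (apply G u) (receive u m) (κ * total m gh t + κ′)
  serve newLeft       fi _                  = serve-newLeft fi
  serve newRight      fi _                  = serve-newRight fi
  serve (newEdge u v) fi (u<l , v<r , new) = serve-newEdge u v fi u<l v<r new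

  size⇒Fits-in : ∀ {G len} → size G ≤ len → len ≤ Z → len < e → left G < n → Fits-in G
  size⇒Fits-in {G} sz len≤Z len<e l<n = record
    { left<n  = l<n
    ; left≤Z  = ≤-trans (≤-trans (m≤m+n (left G) (right G)) both≤) len≤Z
    ; right≤Z = ≤-trans (≤-trans (m≤n+m (right G) (left G)) both≤) len≤Z
    ; edges<e = ≤-<-trans edges≤ len<e
    ; edges≤Z = ≤-trans edges≤ len≤Z }
    where
    both≤ = ≤-trans (m≤m+n (left G + right G) (length (edges G))) sz
    edges≤ = ≤-trans (m≤n+m (length (edges G)) (left G + right G)) sz

  maintain : ∀ {N G m gh t} ε .{{_ : Positive ε}} → numerator ε ≡ a → ↧ₙ ε ≡ b → ∀ len → len ≤ Z → len < e →
    ∀ us → size G + length us ≤ len → left (foldl apply G us) < n → Incremental N G us →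
    Good G m gh t → Small m → Solution k ε G m →
    ∃[ τ ] (Maintains B k ε program G m us τ × τ ≤ κ * total m gh t + κ′ * length us)
  maintain ε a≡ b≡ len len≤Z len<e [] sz l<n inc good small sol = 0 , done sol , z≤n
  maintain {N} {G} {m} {gh} {t} ε a≡ b≡ len len≤Z len<e (u ∷ us) sz l<n (al ∷ inc) good small sol =
    τ + τ₂ , next sol run mt , (begin
      τ + τ₂                                            ≤⟨ +-monoʳ-≤ τ le ⟩
      τ + (κ * total m′ gh′ t′ + κ′ * length us)        ≡⟨ +-assoc τ _ _ ⟨
      τ + κ * total m′ gh′ t′ + κ′ * length us          ≤⟨ +-monoˡ-≤ _ cost ⟩
      κ * total m gh t + κ′ + κ′ * length us            ≡⟨ +-assoc (κ * total m gh t) κ′ _ ⟩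
      κ * total m gh t + (κ′ + κ′ * length us)          ≡⟨ cong (κ * total m gh t +_) (*-suc κ′ (length us)) ⟨
      κ * total m gh t + κ′ * suc (length us)           ∎)
    where
    open ≤-Reasoning
    sz′ : size (apply G u) + length us ≤ len
    sz′ = ≤-trans (≤-reflexive (trans (cong (_+ length us) (size-apply G u)) (sym (+-suc (size G) (length us))))) sz
    sv : Served program (apply G u) (receive u m) (κ * total m gh t + κ′)
    sv = serve u (size⇒Fits-in (≤-trans (m≤m+n _ (length us)) sz′) len≤Z len<e
                   (≤-<-trans (left-foldl (apply G u) us) l<n)) al good small
    open Served sv renaming (good to good′; small to small′)
    rest = maintain ε a≡ b≡ len len≤Z len<e us sz′ l<n inc good′ small′ (solution ε a≡ b≡ good′ quiet)
    τ₂ = proj₁ rest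
    mt = proj₁ (proj₂ rest)
    le = proj₂ (proj₂ rest)

-- Degenerate instances, logarithms and constants

opt≡0 : ∀ k G → (∀ T → ∣ T ∣ ≤ k → coverage G T < 1) → opt k G ≡ 0
opt≡0 k G h = n<1⇒n≡0 (opt-< k G (s≤s z≤n) h)

opt-0 : ∀ G → opt 0 G ≡ 0
opt-0 G = opt≡0 0 G λ T T≤0 → s≤s (≤-trans (coverage-≤ G T [] (map swap (edges G)) (λ e → inj₂ (∈-map⁺ swap e)))
  (≤-reflexive (count≡0 _ (map swap (edges G)) (λ {e} _ → cong (proj₂ e ∈ᵇ_) (no-elements (elements T) (trans (length-elements T) (n≤0⇒n≡0 T≤0)))))))
  where
  open import Data.Product.Base using (swap)
  no-elements : ∀ (xs : List ℕ) → length xs ≡ 0 → xs ≡ []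
  no-elements [] _ = refl

opt-empty : ∀ k → opt k empty ≡ 0
opt-empty k = opt≡0 k empty λ T _ → s≤s (coverage-≤ empty T [] [] λ ())

-- Covers the time before the first update and the whole run when `k = 0`.
Solution-0 : ∀ k ε G m → m 2 0 ≡ 0 → opt k G ≡ 0 → Solution k ε G m
Solution-0 k ε G m len≡0 opt≡ = record
  { inV_L  = subst (All (_< left G)) (sym none) []
  ; size≤k = ≤-trans (∣fromList∣≤length (left G) (held m)) (≤-trans (≤-reflexive (cong length none)) z≤n)
  ; approx = subst (AtLeast[1-1/e- ε ] x) (sym opt≡) (AtLeast-0 ε x) }
  where
  x : ℕ
  x = coverage G (fromList (left G) (held m))
  none : held m ≡ []
  none rewrite len≡0 = refl

-- With k = 0 the empty answer is never touched.
maintain-0 : ∀ B → 1 ≤ B → ∀ ε us G m → m 0 1 ≡ 0 → m 2 0 ≡ 0 → Maintains B 0 ε program G m us (length us * 4)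
maintain-0 B 1≤B ε []       G m k≡0 len≡0 = done (Solution-0 0 ε G m len≡0 (opt-0 G))
maintain-0 B 1≤B ε (u ∷ us) G m k≡0 len≡0 =
  next (Solution-0 0 ε G m len≡0 (opt-0 G))
    (run-else (≤-trans (≤-reflexive k≡0′) z≤n , 1≤B) k≡0′ run-skip)
    (maintain-0 B 1≤B ε us (apply G u) (receive u m) k≡0′ (trans (keeps-answer u) len≡0))
  where
  keeps-k : ∀ u → receive u m 0 1 ≡ m 0 1
  keeps-k newLeft       = refl
  keeps-k newRight      = refl
  keeps-k (newEdge _ _) = refl
  keeps-answer : ∀ u → receive u m 2 0 ≡ m 2 0
  keeps-answer newLeft       = refl
  keeps-answer newRight      = refl
  keeps-answer (newEdge _ _) = refl
  k≡0′ : receive u m 0 1 ≡ 0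
  k≡0′ = trans (keeps-k u) k≡0

n≤2^⌈log₂n⌉ : ∀ n → n ≤ 2 ^ ⌈log₂ n ⌉
n≤2^⌈log₂n⌉ = <-rec _ go
  where
  open ≤-Reasoning
  go : ∀ n → (∀ {i} → i < n → i ≤ 2 ^ ⌈log₂ i ⌉) → n ≤ 2 ^ ⌈log₂ n ⌉
  go 0               rec = z≤n
  go 1               rec = m^n>0 2 ⌈log₂ 1 ⌉
  go n@(suc (suc j)) rec = begin
    n                             ≡⟨ ⌊n/2⌋+⌈n/2⌉≡n n ⟨
    ⌊ n /2⌋ + ⌈ n /2⌉             ≤⟨ +-mono-≤ (⌊n/2⌋≤⌈n/2⌉ n) (≤-reflexive (sym (+-identityʳ ⌈ n /2⌉))) ⟩
    2 * ⌈ n /2⌉                   ≤⟨ *-monoʳ-≤ 2 (rec (⌈n/2⌉<n j)) ⟩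
    2 ^ suc ⌈log₂ ⌈ n /2⌉ ⌉       ≡⟨ cong (λ i → 2 ^ suc i) (⌈log₂⌈n/2⌉⌉≡⌈log₂n⌉∸1 n) ⟩
    2 ^ suc (⌈log₂ n ⌉ ∸ 1)       ≡⟨ cong (2 ^_) (m+[n∸m]≡n (1≤⌈log₂⌉ n (s≤s (s≤s z≤n)))) ⟩
    2 ^ ⌈log₂ n ⌉                 ∎
    where
    1≤⌈log₂⌉ : ∀ n → 2 ≤ n → 1 ≤ ⌈log₂ n ⌉
    1≤⌈log₂⌉ n 2≤n = ≤-trans (≤-reflexive (sym (⌈log₂2^n⌉≡n 1))) (⌈log₂⌉-mono-≤ 2≤n)

-- 126 is `9 * 7 * 2`: the units per edge, the 7 in `D + D * (3 + λ′) + 2 ≤ 7 * (D * λ′)`, and the 2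
-- in `suc len ≤ 2 * len`. The 4 is the cost of an update when `k = 0`.
c₁ : ℕ
c₁ = κ * 126 + κ′ + 4

spread : ∀ D λ′ len → 1 ≤ D → 1 ≤ λ′ → 1 ≤ len →
  κ * (9 * ((D + D * (3 + λ′) + 2) * suc len)) + κ′ * len ≤ c₁ * (D * λ′ * len)
spread D λ′ len 1≤D 1≤λ 1≤len = begin
  κ * (9 * ((D + D * (3 + λ′) + 2) * suc len)) + κ′ * len
    ≤⟨ +-mono-≤ (*-monoʳ-≤ κ (*-monoʳ-≤ 9 (*-mono-≤ seven two))) (*-monoʳ-≤ κ′ (≤-trans (≤-reflexive (sym (*-identityˡ len))) (*-monoˡ-≤ len 1≤X))) ⟩
  κ * (9 * (7 * X * (2 * len))) + κ′ * (X * len)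
    ≤⟨ m≤m+n _ (4 * (X * len)) ⟩
  κ * (9 * (7 * X * (2 * len))) + κ′ * (X * len) + 4 * (X * len)
    ≡⟨ e₁ κ κ′ X len ⟩
  c₁ * (X * len) ∎
  where
  open ≤-Reasoning
  X : ℕ
  X = D * λ′
  1≤X : 1 ≤ X
  1≤X = *-mono-≤ 1≤D 1≤λ
  D≤X : D ≤ X
  D≤X = ≤-trans (≤-reflexive (sym (*-identityʳ D))) (*-monoʳ-≤ D 1≤λ)
  two : suc len ≤ 2 * len
  two = +-mono-≤ 1≤len (≤-reflexive (sym (+-identityʳ len)))
  e₀ : ∀ D l → D + D * (3 + l) + 2 ≡ 4 * D + D * l + 2 * 1
  e₀ = solve-∀
  e₀′ : ∀ X → 4 * X + X + 2 * X ≡ 7 * X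
  e₀′ = solve-∀
  seven : D + D * (3 + λ′) + 2 ≤ 7 * X
  seven = ≤-trans (≤-reflexive (e₀ D λ′))
    (≤-trans (+-mono-≤ (+-monoˡ-≤ X (*-monoʳ-≤ 4 D≤X)) (*-monoʳ-≤ 2 1≤X)) (≤-reflexive (e₀′ X)))
  e₁ : ∀ κ κ′ X len → κ * (9 * (7 * X * (2 * len))) + κ′ * (X * len) + 4 * (X * len) ≡ (κ * 126 + κ′ + 4) * (X * len)
  e₁ = solve-∀

logOf : List Update → ℕ
logOf us = ⌈log₂ (2 ⊔ left (foldl apply empty us)) ⌉

1≤logOf : ∀ us → 1 ≤ logOf us
1≤logOf us = ≤-trans (≤-reflexive (sym (⌈log₂2^n⌉≡n 1))) (⌈log₂⌉-mono-≤ (m≤m⊔n 2 (left (foldl apply empty us))))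

time-bound : ∀ ε .{{_ : Positive ε}} us τ → τ ≤ c₁ * (recip⁺ ε * logOf us * length us) →
             ℕ→ℚ τ ℚ.≤ ℕ→ℚ (c₁ * 2) ℚ.* ε⁻¹log ε us ℚ.* ℕ→ℚ (length us)
time-bound ε us τ le = begin
  ℕ→ℚ τ                                    ≤⟨ ℕ→ℚ-mono le ⟩
  ℕ→ℚ (c₁ * (d * l * len))                 ≡⟨ trans (ℕ→ℚ-* c₁ (d * l * len)) (cong (ℕ→ℚ c₁ ℚ.*_)
                                                (trans (ℕ→ℚ-* (d * l) len) (cong (ℚ._* ℕ→ℚ len) (ℕ→ℚ-* d l)))) ⟩
  ℕ→ℚ c₁ ℚ.* (ℕ→ℚ d ℚ.* ℕ→ℚ l ℚ.* ℕ→ℚ len)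
    ≤⟨ ℚₚ.*-monoˡ-≤-nonNeg (ℕ→ℚ c₁) {{nn c₁}} (ℚₚ.*-monoʳ-≤-nonNeg (ℕ→ℚ len) {{nn len}}
         (ℚₚ.*-monoʳ-≤-nonNeg (ℕ→ℚ l) {{nn l}} (recip⁺≤ ε))) ⟩
  ℕ→ℚ c₁ ℚ.* (ℕ→ℚ 2 ℚ.* u ℚ.* ℕ→ℚ l ℚ.* ℕ→ℚ len)
    ≡⟨ solve 5 (λ c t u l n → c :* (t :* u :* l :* n) := c :* t :* (u :* l) :* n) refl (ℕ→ℚ c₁) (ℕ→ℚ 2) u (ℕ→ℚ l) (ℕ→ℚ len) ⟩
  ℕ→ℚ c₁ ℚ.* ℕ→ℚ 2 ℚ.* (u ℚ.* ℕ→ℚ l) ℚ.* ℕ→ℚ len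
    ≡⟨ cong (λ c → c ℚ.* (u ℚ.* ℕ→ℚ l) ℚ.* ℕ→ℚ len) (ℕ→ℚ-* c₁ 2) ⟨
  ℕ→ℚ (c₁ * 2) ℚ.* (u ℚ.* ℕ→ℚ l) ℚ.* ℕ→ℚ len ∎
  where
  open ℚₚ.≤-Reasoning
  open +-*-Solver
  d l len : ℕ
  d = recip⁺ ε
  l = logOf us
  len = length us
  u : ℚ
  u = 1ℚ ℚ.⊔ (ℚ.1/ ε) {{ℚₚ.pos⇒nonZero ε}}
  nn : ∀ n → ℚ.NonNegative (ℕ→ℚ n)
  nn n = ℚ.nonNegative (ℕ→ℚ-mono {0} {n} z≤n)

1≤recip⁺ : ∀ ε .{{_ : Positive ε}} → 1 ≤ recip⁺ ε
1≤recip⁺ ε = n≢0⇒n>0 λ z → contradiction (≤-trans (↧≤recip⁺*↥ ε) (≤-reflexive (cong (_* numerator ε) z))) λ ()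

-- The starting memory and the choice of parameters

module Initial (k N : ℕ) (ε : ℚ) .{{pos : Positive ε}} (u : Update) (us : List Update) where

  len nf n : ℕ
  len = suc (length us)
  nf  = left (foldl apply empty (u ∷ us))
  -- Strictly above the final number of left nodes; the maximum with 2 is the argument of the
  -- logarithm in `ε⁻¹log`.
  n   = suc (2 ⊔ nf)

  -- The base of `wordBound`, so that `B` is the word bound of the theorem.
  Z : ℕ
  Z = N + suc k + numerator ε + ↧ₙ ε + len

  -- For `w ≥ 2`, `2 * suc w ≤ 3 * w < 8 * w`; the factor 8 is the 3 added to the logarithm.
  wide : 2 * n < 2 ^ (3 + logOf (u ∷ us))
  wide = begin-strict
    2 * suc w         ≡⟨ *-suc 2 w ⟩
    2 + 2 * w         ≤⟨ +-monoˡ-≤ (2 * w) (m≤m⊔n 2 nf) ⟩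
    w + 2 * w         <⟨ m<m+n (w + 2 * w) (≤-trans (≤-trans (s≤s z≤n) (m≤m⊔n 2 nf)) (m≤m+n w (4 * w))) ⟩
    w + 2 * w + (w + 4 * w)   ≡⟨ e₁ w ⟩
    8 * w             ≤⟨ *-monoʳ-≤ 8 (n≤2^⌈log₂n⌉ w) ⟩
    8 * 2 ^ ⌈log₂ w ⌉ ≡⟨ ^-distribˡ-+-* 2 3 ⌈log₂ w ⌉ ⟨
    2 ^ (3 + ⌈log₂ w ⌉) ∎
    where
    open ≤-Reasoning
    w : ℕ
    w = 2 ⊔ nf
    e₁ : ∀ w → w + 2 * w + (w + 4 * w) ≡ 8 * w
    e₁ = solve-∀

  k≤Z : suc k ≤ Z
  k≤Z = ≤-trans (m≤n+m (suc k) N) (≤-trans (m≤m+n _ (numerator ε)) (≤-trans (m≤m+n _ (↧ₙ ε)) (m≤m+n _ len)))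

  len≤Z : len ≤ Z
  len≤Z = m≤n+m len _

  2≤Z : 2 ≤ Z
  2≤Z = +-mono-≤ (≤-trans (s≤s z≤n) (≤-trans (m≤n+m (suc k) N) (≤-trans (m≤m+n _ (numerator ε)) (m≤m+n _ (↧ₙ ε))))) (s≤s z≤n)

  a+b≤Z : numerator ε + ↧ₙ ε ≤ Z
  a+b≤Z = ≤-trans (≤-trans (m≤n+m (numerator ε + ↧ₙ ε) (N + suc k)) (≤-reflexive (sym (+-assoc (N + suc k) (numerator ε) (↧ₙ ε))))) (m≤m+n _ len)

  instance
    a≢0 : NonZero (numerator ε)
    a≢0 = numerator≢0 ε

  open Machine (suc k) (numerator ε) (↧ₙ ε) Z n (suc len) (recip⁺ ε) (3 + logOf (u ∷ us))
               (↧≤recip⁺*↥ ε) wide 2≤Z k≤Z a+b≤Z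

  m₀ : Memory
  m₀ = start N (suc k) ε

  up : ∀ {x} → x ≤ Z → x ≤ Z ^ 5
  up le = ≤-trans le (≤-trans (≤-reflexive (sym (*-identityʳ Z))) (^-monoʳ-≤ Z {1} {5} (s≤s z≤n)))

  small₀ : Small m₀
  small₀ = Small-write 0 3 (Small-write 0 2 (Small-write 0 1 (Small-write 0 0 (λ _ _ → z≤n)
    (up (≤-trans (m≤m+n N _) (≤-trans (m≤m+n _ (numerator ε)) (≤-trans (m≤m+n _ (↧ₙ ε)) (m≤m+n _ len)))))) (up k≤Z))
    (up (≤-trans (m≤m+n _ _) a+b≤Z))) (up (≤-trans (m≤n+m _ _) a+b≤Z))

  gh₀ : Ghost
  gh₀ = ghost [] [] [] [] []

  good₀ : Good empty m₀ gh₀ 0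
  good₀ = record
    { paramsᵐ = record { k≡ = refl ; a≡ = refl ; b≡ = refl }
    ; edgesᵐ = record
      { edges≡ = refl ; range = λ () ; unique = [] ; out≡ = λ _ → refl ; out≤ = λ _ → z≤n ; out∃ = 0 , z≤n }
    ; inv = Inv-new (suc k) 0 0 _ refl refl
    ; tables = record
      { degrees = λ _ → refl ; covers = λ _ → refl ; stL = λ _ → refl ; stR = λ _ → refl ; stA = λ _ → refl
      ; frD = λ _ _ _ → refl ; frC = λ _ _ _ → refl ; frL = λ _ _ _ → refl
      ; frR = λ _ _ _ → refl ; frA = λ _ _ _ → refl }
    ; block≡ = refl ; region = z≤n
    ; ansᵐ = record
      { o′ = 0 ; C′ = [] ; greedy = ≤-trans (≤-reflexive (*-zeroʳ (suc k ^ suc k))) z≤n ; uniq = []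
      ; C⊆ = λ () ; nodes = λ () ; size≤k = z≤n
      ; close = inj₁ (≤-trans (≤-reflexive (*-zeroʳ (↧ₙ ε))) z≤n) }
    ; g≤o = z≤n ; workᵐ = Work-start }

  served : Incremental N empty (u ∷ us) →
    ∃[ τ ] (Maintains B (suc k) ε program empty m₀ (u ∷ us) τ ×
            τ ≤ c₁ * (recip⁺ ε * logOf (u ∷ us) * len))
  served inc = let τ , mt , le = maintain ε refl refl len len≤Z ≤-refl (u ∷ us) ≤-refl (s≤s (m≤n⊔m 2 nf)) inc good₀ small₀
                    (Solution-0 (suc k) ε empty m₀ refl (opt-empty (suc k)))
    in τ , mt , ≤-trans le (spread (recip⁺ ε) (logOf (u ∷ us)) len (1≤recip⁺ ε) (1≤logOf (u ∷ us)) (s≤s z≤n))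

theorem3p12 :
    ∃[ c ] ∃[ C ] ∃[ d ]
      ∀ (N k : ℕ) (ε : ℚ) .{{_ : Positive ε}} (us : List Update) →
      Incremental N empty us →
      ∃[ t ]
        (Maintains (wordBound d N k ε us) k ε c empty (start N k ε) us t ×
         ℕ→ℚ t ℚ.≤ ℕ→ℚ C ℚ.* ε⁻¹log ε us ℚ.* ℕ→ℚ (length us))
-- The factor 2 replaces the integer `recip⁺ ε` by the maximum of 1 and `1/ε`.
theorem3p12 = program , c₁ * 2 , degree , maintains
  where
  maintains : ∀ (N k : ℕ) (ε : ℚ) .{{_ : Positive ε}} (us : List Update) → Incremental N empty us →
    ∃[ t ] (Maintains (wordBound degree N k ε us) k ε program empty (start N k ε) us t ×
            ℕ→ℚ t ℚ.≤ ℕ→ℚ (c₁ * 2) ℚ.* ε⁻¹log ε us ℚ.* ℕ→ℚ (length us))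
  maintains N zero ε us inc = length us * 4
    , maintain-0 (wordBound degree N 0 ε us) (m^n>0 (N + 0 + numerator ε + ↧ₙ ε + length us) {{>-nonZero pos}} degree) ε us empty (start N 0 ε) refl refl
    , time-bound ε us (length us * 4) few
    where
    pos : 0 < N + 0 + numerator ε + ↧ₙ ε + length us
    pos = ≤-trans (≤-trans (s≤s z≤n) (m≤n+m (↧ₙ ε) (N + 0 + numerator ε))) (m≤m+n _ (length us))
    few : length us * 4 ≤ c₁ * (recip⁺ ε * logOf us * length us)
    few = ≤-trans (≤-reflexive (*-comm (length us) 4)) (*-mono-≤ (m≤n+m 4 (κ * 126 + κ′))
      (≤-trans (≤-reflexive (sym (*-identityˡ (length us)))) (*-monoˡ-≤ (length us) (*-mono-≤ (1≤recip⁺ ε) (1≤logOf us)))))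
  maintains N (suc k) ε [] inc = 0 , done (Solution-0 (suc k) ε empty _ refl (opt-empty (suc k)))
    , time-bound ε [] 0 z≤n
  maintains N (suc k) ε us@(u ∷ us′) inc =
    let τ , mt , le = Initial.served k N ε u us′ inc in τ , mt , time-bound ε us τ le
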